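{- Let $\mathcal{M}$ be a countable nonstandard model of $\mathsf{PA}$, and let $\lambda$ be a countable order type (possibly $\lambda=0$). Then $\mathcal{M}$ has a humble extension $\mathcal{N}$ such that $\mathrm{Lt}_0(\mathcal{N}/\mathcal{M})$ is a linear order of order type $1+\lambda+1$.
   Context: An element $c$ generates $\mathcal{N}\succ\mathcal{M}$ over $\mathcal{M}$ if $\mathcal{N}$ is the smallest elementary substructure of $\mathcal{N}$ containing $M\cup\{c\}$. $\mathcal{N}$ is a humble extension of nonstandard $\mathcal{M}$ if $\mathcal{M}\prec\mathcal{N}$ (proper elementary extension) and $\mathcal{N}$ is generated over $\mathcal{M}$ by an element $c$ with $\{a\in M:\mathcal{N}\models a<c\}=\omega$. $\mathrm{Lt}_0(\mathcal{N}/\mathcal{M})$ is the set of $\mathcal{K}$ with $\mathcal{M}\preccurlyeq\mathcal{K}\preccurlyeq\mathcal{N}$ that are finitely generated over $\mathcal{M}$ (including $\mathcal{M}$ itself), ordered by elementary substructure. Order types are added in the usual way; $1$ denotes the order type of a one-element chain. -}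

module Defs where

open import Level using (Level; 0ℓ) renaming (suc to lsuc)
open import Data.Nat using (ℕ; zero; suc)
open import Data.List using (List; []; _∷_)
open import Data.List.Membership.Propositional using (_∈_)
open import Data.Product using (Σ; _×_; _,_; proj₁; proj₂)
open import Data.Sum using (_⊎_; inj₁; inj₂)
open import Data.Unit using (⊤; tt)
open import Data.Empty using (⊥)
open import Relation.Nullary using (¬_)
open import Relation.Binary.PropositionalEquality using (_≡_)
open import Relation.Binary.Structures using (IsStrictTotalOrder)
open import Function using (_∘_)
open import Function.Definitions using (Injective)

-- First-order language of arithmetic {0, 1, +, ×, <}, de Bruijn variables

data Term : Set where
  var   : ℕ → Term
  t0 t1 : Term
  _⊕_   : Term → Term → Term
  _⊗_   : Term → Term → Term

data Formula : Set where
  _≐_ _≺_          : Term → Term → Formula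
  ff               : Formula
  ¬f_              : Formula → Formula
  _∧f_ _∨f_ _⇒f_   : Formula → Formula → Formula
  ∀f_ ∃f_          : Formula → Formula

-- L-structures (equality is interpreted as true equality)
record Structure : Set₁ where
  field
    Carrier : Set
    zer one : Carrier
    add mul : Carrier → Carrier → Carrier
    lt      : Carrier → Carrier → Set

open Structure public

Env : Set → Set
Env A = ℕ → A

_∷ₑ_ : {A : Set} → A → Env A → Env A
(a ∷ₑ ρ) zero    = a
(a ∷ₑ ρ) (suc n) = ρ n

eval : (M : Structure) → Term → Env (Carrier M) → Carrier M
eval M (var n) ρ = ρ n
eval M t0      ρ = zer M
eval M t1      ρ = one M
eval M (t ⊕ s) ρ = add M (eval M t ρ) (eval M s ρ)
eval M (t ⊗ s) ρ = mul M (eval M t ρ) (eval M s ρ)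

Sat : (M : Structure) → Formula → Env (Carrier M) → Set
Sat M (t ≐ s)  ρ = eval M t ρ ≡ eval M s ρ
Sat M (t ≺ s)  ρ = lt M (eval M t ρ) (eval M s ρ)
Sat M ff       ρ = ⊥
Sat M (¬f φ)   ρ = ¬ Sat M φ ρ
Sat M (φ ∧f ψ) ρ = Sat M φ ρ × Sat M ψ ρ
Sat M (φ ∨f ψ) ρ = Sat M φ ρ ⊎ Sat M ψ ρ
Sat M (φ ⇒f ψ) ρ = Sat M φ ρ → Sat M ψ ρ
Sat M (∀f φ)   ρ = (a : Carrier M) → Sat M φ (a ∷ₑ ρ)
Sat M (∃f φ)   ρ = Σ (Carrier M) λ a → Sat M φ (a ∷ₑ ρ)

numeral : (M : Structure) → ℕ → Carrier M
numeral M zero    = zer M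
numeral M (suc n) = add M (numeral M n) (one M)

record IsPA (M : Structure) : Set where
  field
    succ-nonzero : ∀ x → ¬ (add M x (one M) ≡ zer M)
    succ-inj     : ∀ x y → add M x (one M) ≡ add M y (one M) → x ≡ y
    add-zero     : ∀ x → add M x (zer M) ≡ x
    add-succ     : ∀ x y → add M x (add M y (one M)) ≡ add M (add M x y) (one M)
    mul-zero     : ∀ x → mul M x (zer M) ≡ zer M
    mul-succ     : ∀ x y → mul M x (add M y (one M)) ≡ add M (mul M x y) x
    lt-def       : ∀ x y → (lt M x y → Σ (Carrier M) λ z → add M x (add M z (one M)) ≡ y)
                         × ((Σ (Carrier M) λ z → add M x (add M z (one M)) ≡ y) → lt M x y)
    pred-exists  : ∀ x → ¬ (x ≡ zer M) → Σ (Carrier M) λ y → x ≡ add M y (one M)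
    induction    : ∀ (φ : Formula) (ρ : Env (Carrier M))
                   → Sat M φ (zer M ∷ₑ ρ)
                   → (∀ x → Sat M φ (x ∷ₑ ρ) → Sat M φ (add M x (one M) ∷ₑ ρ))
                   → ∀ x → Sat M φ (x ∷ₑ ρ)

Countable : Structure → Set
Countable M = Σ (ℕ → Carrier M) λ e → ∀ x → Σ ℕ λ n → e n ≡ x

Nonstandard : Structure → Set
Nonstandard M = Σ (Carrier M) λ a → ∀ n → lt M (numeral M n) a

ElemEmb : (M N : Structure) → (Carrier M → Carrier N) → Set
ElemEmb M N h = ∀ φ ρ → (Sat M φ ρ → Sat N φ (h ∘ ρ)) × (Sat N φ (h ∘ ρ) → Sat M φ ρ)

Pred : Structure → Set₁
Pred N = Carrier N → Set

_⊆_ : {N : Structure} → Pred N → Pred N → Set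
_⊆_ {N} A B = ∀ (x : Carrier N) → A x → B x

record Closed (N : Structure) (S : Pred N) : Set where
  field
    cl-zer : S (zer N)
    cl-one : S (one N)
    cl-add : ∀ x y → S x → S y → S (add N x y)
    cl-mul : ∀ x y → S x → S y → S (mul N x y)

Sub : (N : Structure) (S : Pred N) → Closed N S → Structure
Sub N S c = record
  { Carrier = Σ (Carrier N) S
  ; zer = zer N , Closed.cl-zer c
  ; one = one N , Closed.cl-one c
  ; add = λ x y → add N (proj₁ x) (proj₁ y) , Closed.cl-add c (proj₁ x) (proj₁ y) (proj₂ x) (proj₂ y)
  ; mul = λ x y → mul N (proj₁ x) (proj₁ y) , Closed.cl-mul c (proj₁ x) (proj₁ y) (proj₂ x) (proj₂ y)
  ; lt  = λ x y → lt N (proj₁ x) (proj₁ y)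
  }

IsElemSub : (N : Structure) → Pred N → Set
IsElemSub N S = Σ (Closed N S) λ c → ElemEmb (Sub N S c) N proj₁

GeneratedBy : (N : Structure) → Pred N → Pred N → Set₁
GeneratedBy N A K =
  IsElemSub N K × (_⊆_ {N} A K) × (∀ (K′ : Pred N) → IsElemSub N K′ → _⊆_ {N} A K′ → _⊆_ {N} K K′)

Img : {M N : Structure} → (Carrier M → Carrier N) → Pred N
Img {M} h y = Σ (Carrier M) λ x → h x ≡ y

_∪L_ : {N : Structure} → Pred N → List (Carrier N) → Pred N
(A ∪L cs) y = A y ⊎ y ∈ cs

Humble : (M N : Structure) → (Carrier M → Carrier N) → Set₁
Humble M N h =
  ElemEmb M N h
  × ¬ (∀ y → Img {M} {N} h y)
  × Σ (Carrier N) λ c →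
      GeneratedBy N (_∪L_ {N} (Img {M} {N} h) (c ∷ [])) (λ _ → ⊤)
      × (∀ a → (lt N (h a) c → Σ ℕ λ n → a ≡ numeral M n)
             × ((Σ ℕ λ n → a ≡ numeral M n) → lt N (h a) c))

IsLt0 : (M N : Structure) → (Carrier M → Carrier N) → Pred N → Set₁
IsLt0 M N h K = Σ (List (Carrier N)) λ cs → GeneratedBy N (_∪L_ {N} (Img {M} {N} h) cs) K

Lt0 : (M N : Structure) → (Carrier M → Carrier N) → Set₁
Lt0 M N h = Σ (Pred N) (IsLt0 M N h)

record CountableLinOrder : Set₁ where
  field
    L      : Set
    _<L_   : L → L → Set
    isSTO  : IsStrictTotalOrder _≡_ _<L_
    code   : L → ℕ
    code-injective : Injective _≡_ _≡_ code

open CountableLinOrder public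

data OneΛOne (Λ : CountableLinOrder) : Set where
  bot : OneΛOne Λ
  mid : L Λ → OneΛOne Λ
  top : OneΛOne Λ

data _<₃_ {Λ : CountableLinOrder} : OneΛOne Λ → OneΛOne Λ → Set where
  bot<mid : ∀ {a} → bot <₃ mid a
  bot<top : bot <₃ top
  mid<mid : ∀ {a b} → _<L_ Λ a b → mid a <₃ mid b
  mid<top : ∀ {a} → mid a <₃ top

_≤₃_ : {Λ : CountableLinOrder} → OneΛOne Λ → OneΛOne Λ → Set
x ≤₃ y = x <₃ y ⊎ x ≡ y

-- The poset (Lt₀(N/M), ≼) (substructures compared by inclusion, equal up to
-- mutual inclusion) is isomorphic to the order 1 + λ + 1
HasOrderType1λ1 : (M N : Structure) (h : Carrier M → Carrier N) (Λ : CountableLinOrder) → Set₁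
HasOrderType1λ1 M N h Λ =
  Σ (Lt0 M N h → OneΛOne Λ) λ f →
    (∀ K₁ K₂ → (_⊆_ {N} (proj₁ K₁) (proj₁ K₂) → f K₁ ≤₃ f K₂)
             × (f K₁ ≤₃ f K₂ → _⊆_ {N} (proj₁ K₁) (proj₁ K₂)))
    × (∀ y → Σ (Lt0 M N h) λ K → f K ≡ y)

{-# OPTIONS --safe #-}

-- N consists of the M-definable functions modulo an ultrafilter U on the traces on ω of M-definable sets, and is
-- generated over M by the class c of the identity, which fills the cut ω. Every finitely generated intermediate model
-- is M(f(c)) for a definable f, and it depends only on the equivalence relation that f induces on ω modulo U.
-- U is built in ω steps from conditions: finitely many definable levels F₁, …, Fₖ labelled by elements of λ and the top
-- element, each refining the previous one, and a definable X containing for every n the leaves of a finite n-branching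
-- tree whose levels are the Fᵢ. By a canonical partition theorem for such trees, X can be thinned until a given definable
-- function is constant on X or has the same kernel as some Fᵢ; and the children of the nodes of a level can be grouped
-- so as to insert a new level at any place. Largeness refers to finite trees because the family of traces on ω is not
-- closed under the jump; it is closed under primitive recursion, which suffices to join the finite trees to a definable X.

module Submission where

open import Defs
open import Level using (0ℓ; Lift; lift) renaming (suc to lsuc)
open import Axiom.ExcludedMiddle using (ExcludedMiddle)
open import Data.Product using (Σ; _×_; _,_; proj₁; proj₂)
open import Data.Sum using (_⊎_; inj₁; inj₂)
import Data.Sum as Sum
open import Data.Unit using (⊤; tt)
open import Data.Empty using (⊥; ⊥-elim)
open import Data.Nat using (ℕ; zero; suc; _+_; _*_; _∸_; _≤_; _<_; _≤?_; _⊔_; z≤n; s≤s; _!; >-nonZero; _≤′_; ≤′-reflexive; ≤′-step)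
open import Data.Nat.Properties using (*-suc; *-zeroʳ; +-cancelˡ-≤; +-comm; +-identityʳ; +-mono-<; +-mono-≤; +-monoʳ-≤; +-monoˡ-≤; +-suc; 1≤n!; <-cmp; <-irrefl; <-trans; <⇒≤; <⇒≱; _≟_; m+[n∸m]≡n; m+n∸m≡n; m<n⇒0<n∸m; m<n⇒n≢0; m∸n≤m; m≤m*n; m≤m+n; m≤n+m; m≤n⇒m<n∨m≡n; m≤n⇒m≤1+n; m≤n⇒m⊓n≡m; n<1+n; n≢0⇒n>0; n≤0⇒n≡0; n≤1+n; n≮0; suc-injective; ∸-monoˡ-≤; ≤-<-trans; ≤-pred; ≤-refl; ≤-reflexive; ≤-trans; ≤⇒≤′; ≰⇒>; m≤m⊔n; m≤n⊔m; module ≤-Reasoning)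
open import Data.Nat.Divisibility using (_∣_; divides; ∣-trans; ∣-refl; ∣1⇒≡1; ∣m+n∣m⇒∣n; ∣n⇒∣m*n; m∣m*n; m≤n⇒m!∣n!)
open import Data.Nat.Coprimality using (Coprime; coprime-divisor) renaming (sym to coprime-sym)
open import Data.Nat.Induction using (<-rec)
open import Data.Nat.ListAction using (product)
open import Data.Nat.ListAction.Properties using (∈⇒∣product)
open import Data.Nat.Tactic.RingSolver using (solve-∀)
open import Data.List using (List; []; _∷_; map; _++_; length; take; drop; filter; upTo)
open import Data.List.Properties using (map-++; length-map; length-++; length-take; length-drop; length-upTo)
open import Data.List.Membership.Propositional using (_∈_; _∉_)
open import Data.List.Membership.Propositional.Properties using (∈-map⁺; ∈-map⁻; ∈-++⁺ˡ; ∈-++⁺ʳ; ∈-++⁻; ∈-upTo⁺; ∈-upTo⁻; ∈-filter⁺; ∈-filter⁻)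
open import Data.List.Membership.DecPropositional _≟_ using (_∈?_)
open import Data.List.Relation.Unary.Any using (here; there)
open import Data.List.Relation.Unary.Any.Properties using (¬Any[])
open import Data.List.Relation.Unary.All using (All; []; _∷_) renaming (lookup to lookupAll; tabulate to tabulateAll)
open import Data.List.Relation.Unary.All.Properties using () renaming (++⁺ to All-++⁺)
open import Data.List.Relation.Unary.AllPairs using (AllPairs; []; _∷_) renaming (map to mapPairs)
open import Data.List.Relation.Unary.Unique.Propositional.Properties using (upTo⁺)
open import Data.List.Relation.Binary.Pointwise using (Pointwise; []; _∷_)
open import Function using (_∘_)
open import Relation.Nullary using (¬_; Dec; yes; no)
open import Relation.Nullary.Decidable using (True; toWitness; fromWitness; decidable-stable)
open import Relation.Binary.Definitions using (tri<; tri≈; tri>)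
open import Relation.Binary.Structures using (IsStrictTotalOrder)
open import Relation.Binary.PropositionalEquality using (_≡_; _≢_; refl; sym; trans; cong; cong₂; subst; subst₂)

import Data.Sum as Sum

-- On ω only bounded quantification is internal, so the largeness of a set cannot be expressed; that
-- a coded finite set contains an n-branching tree can. Thinning therefore takes at step n the least
-- code of a finite set that enlarges the previous one by such a tree, built from numbers too large
-- to change what was settled before. Each new tree has to fit the old ones. It avoids the finitely
-- many values already used, so that an old and a new leaf agree nowhere and no relation between
-- them needs checking. The one obstacle is a function that is constant on each tree with constants
-- that vary from tree to tree: a child taken from each of many such trees gives a tree on which the
-- function has the kernel of the coarsest level. No separate step makes U an ultrafilter. An
-- indicator function has at most two values while a level has arbitrarily many on every condition,
-- so a decided indicator is constant. Likewise every element of N is either in M or interdefinable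
-- over M with a level, which makes the intermediate models a chain; they are distinct because a
-- node of one level has several children at the next.

infix 1 _⟷_
_⟷_ : ∀ {a b} → Set a → Set b → Set _
A ⟷ B = (A → B) × (B → A)

⟷-refl : {A : Set} → A ⟷ A
⟷-refl = (λ x → x) , (λ x → x)

⟷-sym : {A B : Set} → A ⟷ B → B ⟷ A
⟷-sym (f , g) = g , f

⟷-trans : {A B C : Set} → A ⟷ B → B ⟷ C → A ⟷ C
⟷-trans (f , g) (f′ , g′) = (λ x → f′ (f x)) , (λ x → g (g′ x))

¬-cong : {A B : Set} → A ⟷ B → (¬ A) ⟷ (¬ B)
¬-cong (f , g) = (λ na b → na (g b)) , (λ nb a → nb (f a))

×-cong : {A B C D : Set} → A ⟷ B → C ⟷ D → (A × C) ⟷ (B × D)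
×-cong (f , g) (f′ , g′) = (λ (a , c) → f a , f′ c) , (λ (b , d) → g b , g′ d)

⊎-cong : {A B C D : Set} → A ⟷ B → C ⟷ D → (A ⊎ C) ⟷ (B ⊎ D)
⊎-cong (f , g) (f′ , g′) = Sum.map f f′ , Sum.map g g′

→-cong : {A B C D : Set} → A ⟷ B → C ⟷ D → (A → C) ⟷ (B → D)
→-cong (f , g) (f′ , g′) = (λ h b → f′ (h (g b))) , (λ h a → g′ (h (f a)))

Π-cong : {A : Set} {B C : A → Set} → (∀ a → B a ⟷ C a) → (∀ a → B a) ⟷ (∀ a → C a)
Π-cong h = (λ f a → proj₁ (h a) (f a)) , (λ f a → proj₂ (h a) (f a))

Σ-cong : {A : Set} {B C : A → Set} → (∀ a → B a ⟷ C a) → Σ A B ⟷ Σ A C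
Σ-cong h = (λ (a , b) → a , proj₁ (h a) b) , (λ (a , c) → a , proj₂ (h a) c)

≡-cong : {A : Set} {a b a′ b′ : A} → a ≡ a′ → b ≡ b′ → (a ≡ b) ⟷ (a′ ≡ b′)
≡-cong refl refl = ⟷-refl

-- Environments and renaming of variables

tl : {A : Set} → Env A → Env A
tl ρ i = ρ (suc i)

∷ₑ-cong : {A : Set} {a b : A} {ρ ρ′ : Env A} → a ≡ b → (∀ i → ρ i ≡ ρ′ i) → ∀ i → (a ∷ₑ ρ) i ≡ (b ∷ₑ ρ′) i
∷ₑ-cong p q zero = p
∷ₑ-cong p q (suc i) = q i

renT : (ℕ → ℕ) → Term → Term
renT σ (var i) = var (σ i)
renT σ t0 = t0
renT σ t1 = t1
renT σ (t ⊕ s) = renT σ t ⊕ renT σ s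
renT σ (t ⊗ s) = renT σ t ⊗ renT σ s

lft : (ℕ → ℕ) → ℕ → ℕ
lft σ = zero ∷ₑ (λ i → suc (σ i))

ren : (ℕ → ℕ) → Formula → Formula
ren σ (t ≐ s) = renT σ t ≐ renT σ s
ren σ (t ≺ s) = renT σ t ≺ renT σ s
ren σ ff = ff
ren σ (¬f φ) = ¬f ren σ φ
ren σ (φ ∧f ψ) = ren σ φ ∧f ren σ ψ
ren σ (φ ∨f ψ) = ren σ φ ∨f ren σ ψ
ren σ (φ ⇒f ψ) = ren σ φ ⇒f ren σ ψ
ren σ (∀f φ) = ∀f ren (lft σ) φ
ren σ (∃f φ) = ∃f ren (lft σ) φ

boundT : Term → ℕ
boundT (var i) = suc i
boundT t0 = 0
boundT t1 = 0
boundT (t ⊕ s) = boundT t ⊔ boundT s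
boundT (t ⊗ s) = boundT t ⊔ boundT s

bound : Formula → ℕ
bound (t ≐ s) = boundT t ⊔ boundT s
bound (t ≺ s) = boundT t ⊔ boundT s
bound ff = 0
bound (¬f φ) = bound φ
bound (φ ∧f ψ) = bound φ ⊔ bound ψ
bound (φ ∨f ψ) = bound φ ⊔ bound ψ
bound (φ ⇒f ψ) = bound φ ⊔ bound ψ
bound (∀f φ) = bound φ
bound (∃f φ) = bound φ

module _ (M : Structure) where
  private
    C = Carrier M

  eval-ren : ∀ σ t (ρ ρ′ : Env C) → (∀ i → i < boundT t → ρ (σ i) ≡ ρ′ i) → eval M (renT σ t) ρ ≡ eval M t ρ′
  eval-ren σ (var i) ρ ρ′ h = h i ≤-refl
  eval-ren σ t0 ρ ρ′ h = refl
  eval-ren σ t1 ρ ρ′ h = refl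
  eval-ren σ (t ⊕ s) ρ ρ′ h = cong₂ (add M)
    (eval-ren σ t ρ ρ′ λ i p → h i (≤-trans p (m≤m⊔n _ _))) (eval-ren σ s ρ ρ′ λ i p → h i (≤-trans p (m≤n⊔m (boundT t) _)))
  eval-ren σ (t ⊗ s) ρ ρ′ h = cong₂ (mul M)
    (eval-ren σ t ρ ρ′ λ i p → h i (≤-trans p (m≤m⊔n _ _))) (eval-ren σ s ρ ρ′ λ i p → h i (≤-trans p (m≤n⊔m (boundT t) _)))

  Sat-ren : ∀ σ φ (ρ ρ′ : Env C) → (∀ i → i < bound φ → ρ (σ i) ≡ ρ′ i) → Sat M (ren σ φ) ρ ⟷ Sat M φ ρ′

  Sat-lft : ∀ σ φ (ρ ρ′ : Env C) → (∀ i → i < bound φ → ρ (σ i) ≡ ρ′ i) →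
            ∀ a → Sat M (ren (lft σ) φ) (a ∷ₑ ρ) ⟷ Sat M φ (a ∷ₑ ρ′)
  Sat-lft σ φ ρ ρ′ h a = Sat-ren (lft σ) φ (a ∷ₑ ρ) (a ∷ₑ ρ′) λ where
    zero _ → refl
    (suc i) p → h i (<-trans (n<1+n i) p)

  Sat-ren σ (t ≐ s) ρ ρ′ h = ≡-cong (eval-ren σ t ρ ρ′ λ i p → h i (≤-trans p (m≤m⊔n _ _)))
    (eval-ren σ s ρ ρ′ λ i p → h i (≤-trans p (m≤n⊔m (boundT t) _)))
  Sat-ren σ (t ≺ s) ρ ρ′ h
    rewrite eval-ren σ t ρ ρ′ (λ i p → h i (≤-trans p (m≤m⊔n _ _)))
          | eval-ren σ s ρ ρ′ (λ i p → h i (≤-trans p (m≤n⊔m (boundT t) _))) = ⟷-refl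
  Sat-ren σ ff ρ ρ′ h = ⟷-refl
  Sat-ren σ (¬f φ) ρ ρ′ h = ¬-cong (Sat-ren σ φ ρ ρ′ h)
  Sat-ren σ (φ ∧f ψ) ρ ρ′ h = ×-cong (Sat-ren σ φ ρ ρ′ λ i p → h i (≤-trans p (m≤m⊔n _ _)))
    (Sat-ren σ ψ ρ ρ′ λ i p → h i (≤-trans p (m≤n⊔m (bound φ) _)))
  Sat-ren σ (φ ∨f ψ) ρ ρ′ h = ⊎-cong (Sat-ren σ φ ρ ρ′ λ i p → h i (≤-trans p (m≤m⊔n _ _)))
    (Sat-ren σ ψ ρ ρ′ λ i p → h i (≤-trans p (m≤n⊔m (bound φ) _)))
  Sat-ren σ (φ ⇒f ψ) ρ ρ′ h = →-cong (Sat-ren σ φ ρ ρ′ λ i p → h i (≤-trans p (m≤m⊔n _ _)))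
    (Sat-ren σ ψ ρ ρ′ λ i p → h i (≤-trans p (m≤n⊔m (bound φ) _)))
  Sat-ren σ (∀f φ) ρ ρ′ h = Π-cong (Sat-lft σ φ ρ ρ′ h)
  Sat-ren σ (∃f φ) ρ ρ′ h = Σ-cong (Sat-lft σ φ ρ ρ′ h)

  Sat-local : ∀ φ (ρ ρ′ : Env C) → (∀ i → i < bound φ → ρ i ≡ ρ′ i) → Sat M φ ρ ⟷ Sat M φ ρ′
  Sat-local φ ρ ρ′ h = ⟷-trans (⟷-sym (Sat-ren (λ i → i) φ ρ ρ λ _ _ → refl)) (Sat-ren (λ i → i) φ ρ ρ′ h)

  Sat-ext : ∀ φ {ρ ρ′ : Env C} → (∀ i → ρ i ≡ ρ′ i) → Sat M φ ρ ⟷ Sat M φ ρ′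
  Sat-ext φ h = Sat-local φ _ _ λ i _ → h i

-- Arguments and parameters are interleaved because both form infinite sequences, and neither can be
-- shifted past the other. Exchanging the two at every step makes the recursion structural.
mix : {A : Set} → Env A → Env A → Env A
mix ρ π zero = ρ zero
mix ρ π (suc n) = mix π (tl ρ) n

ev od : ℕ → ℕ
ev zero = zero
ev (suc i) = suc (suc (ev i))
od i = suc (ev i)

mix-ev : {A : Set} (ρ π : Env A) → ∀ i → mix ρ π (ev i) ≡ ρ i
mix-ev ρ π zero = refl
mix-ev ρ π (suc i) = mix-ev (tl ρ) (tl π) i

mix-od : {A : Set} (ρ π : Env A) → ∀ i → mix ρ π (od i) ≡ π i
mix-od ρ π i = mix-ev π (tl ρ) i

mix-map : {A B : Set} (f : A → B) (r s : Env A) (ρ π : Env B) →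
          (∀ i → f (r i) ≡ ρ i) → (∀ i → f (s i) ≡ π i) → ∀ n → f (mix r s n) ≡ mix ρ π n
mix-map f r s ρ π h k zero = h zero
mix-map f r s ρ π h k (suc n) = mix-map f s (tl r) π (tl ρ) k (λ i → h (suc i)) n

-- Pairs and finite sets of numbers

triangle : ℕ → ℕ
triangle zero = zero
triangle (suc s) = suc s + triangle s

pair : ℕ → ℕ → ℕ
pair x y = triangle (x + y) + y

diagonal-step : ℕ × ℕ → ℕ × ℕ
diagonal-step (zero , y) = suc y , zero
diagonal-step (suc x , y) = x , suc y

unpair : ℕ → ℕ × ℕ
unpair zero = zero , zero
unpair (suc n) = diagonal-step (unpair n)

π₁ π₂ : ℕ → ℕ
π₁ n = proj₁ (unpair n)
π₂ n = proj₂ (unpair n)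

pair-step₁ : ∀ y → pair (suc y) 0 ≡ suc (pair 0 y)
pair-step₁ y rewrite +-identityʳ y | +-identityʳ (y + triangle y) = cong suc (+-comm y (triangle y))

pair-step₂ : ∀ x y → pair x (suc y) ≡ suc (pair (suc x) y)
pair-step₂ x y rewrite +-suc x y = +-suc (suc (x + y + triangle (x + y))) y

unpair-pair′ : ∀ n x y → pair x y ≡ n → unpair n ≡ (x , y)
unpair-pair′ zero zero zero p = refl
unpair-pair′ zero (suc x) zero ()
unpair-pair′ zero x (suc y) p with trans (sym (pair-step₂ x y)) p
... | ()
unpair-pair′ (suc n) zero zero ()
unpair-pair′ (suc n) (suc x) zero p
  rewrite unpair-pair′ n zero x (suc-injective (trans (sym (pair-step₁ x)) p)) = refl
unpair-pair′ (suc n) x (suc y) p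
  rewrite unpair-pair′ n (suc x) y (suc-injective (trans (sym (pair-step₂ x y)) p)) = refl

unpair-pair : ∀ x y → unpair (pair x y) ≡ (x , y)
unpair-pair x y = unpair-pair′ _ x y refl

π₁-pair : ∀ x y → π₁ (pair x y) ≡ x
π₁-pair x y = cong proj₁ (unpair-pair x y)

π₂-pair : ∀ x y → π₂ (pair x y) ≡ y
π₂-pair x y = cong proj₂ (unpair-pair x y)

pair-diagonal-step : ∀ p → pair (proj₁ (diagonal-step p)) (proj₂ (diagonal-step p)) ≡ suc (pair (proj₁ p) (proj₂ p))
pair-diagonal-step (zero , y) = pair-step₁ y
pair-diagonal-step (suc x , y) = pair-step₂ x y

pair-π : ∀ n → pair (π₁ n) (π₂ n) ≡ n
pair-π zero = refl
pair-π (suc n) = trans (pair-diagonal-step (unpair n)) (cong suc (pair-π n))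

double-triangle : ∀ s → triangle s + triangle s ≡ s * suc s
double-triangle zero = refl
double-triangle (suc s) = trans (eq₁ s (triangle s)) (trans (cong (suc s + suc s +_) (double-triangle s)) (eq₂ s))
  where
    eq₁ : ∀ s t → (suc s + t) + (suc s + t) ≡ (suc s + suc s) + (t + t)
    eq₁ = solve-∀
    eq₂ : ∀ s → (suc s + suc s) + s * suc s ≡ suc s * suc (suc s)
    eq₂ = solve-∀

-- Doubling removes the halving from Cantor's pairing function and leaves a polynomial identity,
-- which the language of arithmetic can state.
double-pair : ∀ x y → pair x y + pair x y ≡ (x + y) * suc (x + y) + (y + y)
double-pair x y = trans (ring (triangle (x + y)) y) (cong (_+ (y + y)) (double-triangle (x + y)))
  where
    ring : ∀ a y → a + y + (a + y) ≡ a + a + (y + y)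
    ring = solve-∀

m≤triangle : ∀ m → m ≤ triangle m
m≤triangle zero = z≤n
m≤triangle (suc m) = m≤m+n (suc m) _

x≤pair : ∀ x y → x ≤ pair x y
x≤pair x y = ≤-trans (m≤m+n x y) (≤-trans (m≤triangle (x + y)) (m≤m+n _ y))

y≤pair : ∀ x y → y ≤ pair x y
y≤pair x y = m≤n+m y _

π₁≤ : ∀ n → π₁ n ≤ n
π₁≤ n = subst (π₁ n ≤_) (pair-π n) (x≤pair (π₁ n) (π₂ n))

π₂≤ : ∀ n → π₂ n ≤ n
π₂≤ n = subst (π₂ n ≤_) (pair-π n) (y≤pair (π₁ n) (π₂ n))

-- A number t codes a finite set through the pairwise coprime moduli 1 + (1 + x) b of Gödel's β-function,
-- where t is read as the triple of a bound, a product and b.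
modulus : ℕ → ℕ → ℕ
modulus b x = 1 + (1 + x) * b

infix 4 _ε_
record _ε_ (x t : ℕ) : Set where
  constructor _,_
  field
    below-bound : x < π₁ t
    modulus-divides : modulus (π₂ (π₂ t)) x ∣ π₁ (π₂ t)

ε⇒< : ∀ {x} t → x ε t → x < t
ε⇒< t (p , _) = ≤-trans p (π₁≤ t)

k∣n! : ∀ {k n} → 0 < k → k ≤ n → k ∣ n !
k∣n! {suc k} _ p = ∣-trans (m∣m*n (k !)) (m≤n⇒m!∣n! p)

-- A common divisor of the two moduli divides their difference `(y ∸ x) * n !` and is coprime to
-- `n !`. So it divides `y ∸ x`, hence `n !`, hence 1.
coprime-moduli-< : ∀ n {x y} → x < y → y < n → Coprime (modulus (n !) x) (modulus (n !) y)
coprime-moduli-< n {x} {y} x<y y<n {d} (p , q) = ∣1⇒≡1 (∣m+n∣m⇒∣n (subst (d ∣_) (+-comm 1 _) p) (∣n⇒∣m*n (1 + x) d∣b))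
  where
    b = n !
    k = y ∸ x
    coprime : Coprime d b
    coprime {c} (r , s) = ∣1⇒≡1 (∣m+n∣m⇒∣n (subst (c ∣_) (+-comm 1 _) (∣-trans r p)) (∣n⇒∣m*n (1 + x) s))
    eq : modulus b y ≡ modulus b x + b * k
    eq = trans (cong (modulus b) (sym (m+[n∸m]≡n (<⇒≤ x<y)))) (ring b x k)
      where
        ring : ∀ b x k → 1 + (1 + (x + k)) * b ≡ 1 + (1 + x) * b + b * k
        ring = solve-∀
    d∣b : d ∣ b
    d∣b = ∣-trans (coprime-divisor coprime (∣m+n∣m⇒∣n (subst (d ∣_) eq q) p))
                  (k∣n! (m<n⇒0<n∸m x<y) (≤-trans (m∸n≤m y x) (<⇒≤ y<n)))

coprime-moduli : ∀ n {x y} → x ≢ y → x < n → y < n → Coprime (modulus (n !) x) (modulus (n !) y)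
coprime-moduli n {x} {y} x≢y x<n y<n with <-cmp x y
... | tri< p _ _ = coprime-moduli-< n p y<n
... | tri≈ _ p _ = ⊥-elim (x≢y p)
... | tri> _ _ p = coprime-sym (coprime-moduli-< n p x<n)

coprime-* : ∀ {m a b} → Coprime m a → Coprime m b → Coprime m (a * b)
coprime-* {m} {a} p q {d} (r , s) = q (r , coprime-divisor (λ (u , v) → p (∣-trans u r , v)) s)

coprime-product : ∀ n {x} xs → x < n → (∀ {y} → y ∈ xs → y < n) → x ∉ xs →
                  Coprime (modulus (n !) x) (product (map (modulus (n !)) xs))
coprime-product n [] x<n _ _ (_ , q) = ∣1⇒≡1 q
coprime-product n (y ∷ ys) x<n h x∉ = coprime-*
  (coprime-moduli n (λ p → x∉ (here p)) x<n (h (here refl)))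
  (coprime-product n ys x<n (λ p → h (there p)) (λ p → x∉ (there p)))

list-bound : (xs : List ℕ) → Σ ℕ λ n → ∀ {x} → x ∈ xs → x < n
list-bound [] = 0 , λ ()
list-bound (x ∷ xs) with list-bound xs
... | n , h = suc x ⊔ n , λ where
  (here refl) → m≤m⊔n (suc x) n
  (there p) → ≤-trans (h p) (m≤n⊔m (suc x) n)

-- A number below the bound but outside the list has a modulus coprime to the product; as `n !` is
-- positive, this modulus is not 1 and cannot divide. The bound excludes the larger numbers, whose
-- moduli need not be coprime to the others.
code-set : (xs : List ℕ) → Σ ℕ λ t → ∀ x → (x ε t) ⟷ (x ∈ xs)
code-set xs with list-bound xs
... | n , h = pair n (pair a b) , λ x → to x , from x
  where
    b = n !
    a = product (map (modulus b) xs)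
    bound-eq : π₁ (pair n (pair a b)) ≡ n
    bound-eq = π₁-pair n (pair a b)
    a-eq : π₁ (π₂ (pair n (pair a b))) ≡ a
    a-eq = trans (cong π₁ (π₂-pair n (pair a b))) (π₁-pair a b)
    b-eq : π₂ (π₂ (pair n (pair a b))) ≡ b
    b-eq = trans (cong π₂ (π₂-pair n (pair a b))) (π₂-pair a b)
    nontrivial : ∀ x → modulus b x ≢ 1
    nontrivial x p = m<n⇒n≢0 (≤-trans (1≤n! n) (m≤m+n b (x * b))) (suc-injective p)
    to : ∀ x → x ε pair n (pair a b) → x ∈ xs
    to x (p , q) with x ∈? xs
    ... | yes r = r
    ... | no r = ⊥-elim (nontrivial x (coprime-product n xs (subst (x <_) bound-eq p) h r (∣-refl , subst₂ (λ b a → modulus b x ∣ a) b-eq a-eq q)))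
    from : ∀ x → x ∈ xs → x ε pair n (pair a b)
    from x p = subst (x <_) (sym bound-eq) (h p) , subst₂ (λ b a → modulus b x ∣ a) (sym b-eq) (sym a-eq) (∈⇒∣product (∈-map⁺ (modulus b) p))

-- Enumeration of formulas

decodeT : ℕ → ℕ → Term
decodeT-tag : ℕ → ℕ → ℕ → Term
decodeT zero _ = t0
decodeT (suc k) n = decodeT-tag k (π₁ n) (π₂ n)
decodeT-tag k 0 r = var r
decodeT-tag k 1 r = t1
decodeT-tag k 2 r = decodeT k (π₁ r) ⊕ decodeT k (π₂ r)
decodeT-tag k 3 r = decodeT k (π₁ r) ⊗ decodeT k (π₂ r)
decodeT-tag k (suc (suc (suc (suc _)))) r = t0

decodeF : ℕ → ℕ → Formula
decodeF-tag : ℕ → ℕ → ℕ → Formula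
decodeF zero _ = ff
decodeF (suc k) n = decodeF-tag k (π₁ n) (π₂ n)
decodeF-tag k 0 r = decodeT k (π₁ r) ≐ decodeT k (π₂ r)
decodeF-tag k 1 r = decodeT k (π₁ r) ≺ decodeT k (π₂ r)
decodeF-tag k 2 r = ¬f decodeF k r
decodeF-tag k 3 r = decodeF k (π₁ r) ∧f decodeF k (π₂ r)
decodeF-tag k 4 r = decodeF k (π₁ r) ∨f decodeF k (π₂ r)
decodeF-tag k 5 r = decodeF k (π₁ r) ⇒f decodeF k (π₂ r)
decodeF-tag k 6 r = ∀f decodeF k r
decodeF-tag k 7 r = ∃f decodeF k r
decodeF-tag k (suc (suc (suc (suc (suc (suc (suc (suc _)))))))) r = ff

-- The first argument of a decoder bounds the depth, so a code has to work for all large enough bounds.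
Decodable : {A : Set} → (ℕ → ℕ → A) → A → Set
Decodable d a = Σ ℕ λ n → Σ ℕ λ k₀ → ∀ k → k₀ ≤ k → d k n ≡ a

module _ {A B : Set} (d : ℕ → ℕ → A) (dtag : ℕ → ℕ → ℕ → A) (d-suc : ∀ k n → d (suc k) n ≡ dtag k (π₁ n) (π₂ n)) (d′ : ℕ → ℕ → B) where

  private
    untag : ∀ i r k {a} → dtag k i r ≡ a → d (suc k) (pair i r) ≡ a
    untag i r k p = trans (d-suc k (pair i r)) (subst (λ q → dtag k (proj₁ q) (proj₂ q) ≡ _) (sym (unpair-pair i r)) p)

  decodable-leaf : ∀ i r {a} → (∀ k → dtag k i r ≡ a) → Decodable d a
  decodable-leaf i r h = pair i r , 1 , λ where (suc k) (s≤s _) → untag i r k (h k)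

  decodable-unary : (c : B → A) (i : ℕ) → (∀ k r → dtag k i r ≡ c (d′ k r)) → ∀ {b} → Decodable d′ b → Decodable d (c b)
  decodable-unary c i h (r , k₀ , p) = pair i r , suc k₀ , λ where
    (suc k) (s≤s q) → untag i r k (trans (h k r) (cong c (p k q)))

  decodable-binary : (c : B → B → A) (i : ℕ) → (∀ k r → dtag k i r ≡ c (d′ k (π₁ r)) (d′ k (π₂ r))) →
                     ∀ {b b′} → Decodable d′ b → Decodable d′ b′ → Decodable d (c b b′)
  decodable-binary c i h (r , k₀ , p) (r′ , k₀′ , p′) = pair i (pair r r′) , suc (k₀ ⊔ k₀′) , λ where
    (suc k) (s≤s q) → untag i (pair r r′) k (trans (h k (pair r r′))
      (cong₂ c (trans (cong (d′ k) (π₁-pair r r′)) (p k (≤-trans (m≤m⊔n k₀ k₀′) q)))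
               (trans (cong (d′ k) (π₂-pair r r′)) (p′ k (≤-trans (m≤n⊔m k₀ k₀′) q)))))

decodableT : ∀ t → Decodable decodeT t
decodableT (var i) = decodable-leaf decodeT decodeT-tag (λ _ _ → refl) decodeT 0 i (λ _ → refl)
decodableT t0 = decodable-leaf decodeT decodeT-tag (λ _ _ → refl) decodeT 4 0 (λ _ → refl)
decodableT t1 = decodable-leaf decodeT decodeT-tag (λ _ _ → refl) decodeT 1 0 (λ _ → refl)
decodableT (t ⊕ s) = decodable-binary decodeT decodeT-tag (λ _ _ → refl) decodeT _⊕_ 2 (λ _ _ → refl) (decodableT t) (decodableT s)
decodableT (t ⊗ s) = decodable-binary decodeT decodeT-tag (λ _ _ → refl) decodeT _⊗_ 3 (λ _ _ → refl) (decodableT t) (decodableT s)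

decodableF : ∀ φ → Decodable decodeF φ
decodableF (t ≐ s) = decodable-binary decodeF decodeF-tag (λ _ _ → refl) decodeT _≐_ 0 (λ _ _ → refl) (decodableT t) (decodableT s)
decodableF (t ≺ s) = decodable-binary decodeF decodeF-tag (λ _ _ → refl) decodeT _≺_ 1 (λ _ _ → refl) (decodableT t) (decodableT s)
decodableF ff = decodable-leaf decodeF decodeF-tag (λ _ _ → refl) decodeF 8 0 (λ _ → refl)
decodableF (¬f φ) = decodable-unary decodeF decodeF-tag (λ _ _ → refl) decodeF ¬f_ 2 (λ _ _ → refl) (decodableF φ)
decodableF (φ ∧f ψ) = decodable-binary decodeF decodeF-tag (λ _ _ → refl) decodeF _∧f_ 3 (λ _ _ → refl) (decodableF φ) (decodableF ψ)
decodableF (φ ∨f ψ) = decodable-binary decodeF decodeF-tag (λ _ _ → refl) decodeF _∨f_ 4 (λ _ _ → refl) (decodableF φ) (decodableF ψ)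
decodableF (φ ⇒f ψ) = decodable-binary decodeF decodeF-tag (λ _ _ → refl) decodeF _⇒f_ 5 (λ _ _ → refl) (decodableF φ) (decodableF ψ)
decodableF (∀f φ) = decodable-unary decodeF decodeF-tag (λ _ _ → refl) decodeF ∀f_ 6 (λ _ _ → refl) (decodableF φ)
decodableF (∃f φ) = decodable-unary decodeF decodeF-tag (λ _ _ → refl) decodeF ∃f_ 7 (λ _ _ → refl) (decodableF φ)

formula : ℕ → Formula
formula n = decodeF (π₁ n) (π₂ n)

formula-surjective : ∀ φ → Σ ℕ λ n → formula n ≡ φ
formula-surjective φ with decodableF φ
... | n , k , h = pair k n , trans (cong₂ decodeF (π₁-pair k n) (π₂-pair k n)) (h k ≤-refl)

-- Trees of levels and the canonical partition theorem

Distinct : {I K : Set} → (I → K) → List I → Set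
Distinct key = AllPairs (λ i j → key i ≢ key j)

distinct-injective : {I K : Set} (key : I → K) {is : List I} → Distinct key is →
                     ∀ {i j} → i ∈ is → j ∈ is → key i ≡ key j → i ≡ j
distinct-injective key (h ∷ d) (here refl) (here refl) p = refl
distinct-injective key (h ∷ d) (here refl) (there q) p = ⊥-elim (lookupAll h q p)
distinct-injective key (h ∷ d) (there q) (here refl) p = ⊥-elim (lookupAll h q (sym p))
distinct-injective key (h ∷ d) (there q) (there r) p = distinct-injective key d q r p

distinct-map : {I K : Set} (key : I → K) {is : List I} → Distinct key is → Distinct (λ k → k) (map key is)
distinct-map key [] = []
distinct-map key {i ∷ is} (h ∷ d) = tabulateAll fresh ∷ distinct-map key d
  where
    fresh : ∀ {k} → k ∈ map key is → key i ≢ k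
    fresh p e with ∈-map⁻ key p
    ... | j , q , refl = lookupAll h q e

∈-take : {I : Set} (n : ℕ) {is : List I} {i : I} → i ∈ take n is → i ∈ is
∈-take (suc n) {_ ∷ _} (here p) = here p
∈-take (suc n) {_ ∷ _} (there p) = there (∈-take n p)

distinct-take : {I K : Set} {key : I → K} (n : ℕ) {is : List I} → Distinct key is → Distinct key (take n is)
distinct-take zero d = []
distinct-take (suc n) [] = []
distinct-take (suc n) (h ∷ d) = tabulateAll (λ p → lookupAll h (∈-take n p)) ∷ distinct-take n d

length-take-≤ : {I : Set} (n : ℕ) {is : List I} → n ≤ length is → length (take n is) ≡ n
length-take-≤ n {is} p = trans (length-take n is) (m≤n⇒m⊓n≡m p)

module _ (dec : (P : Set) → Dec P) where

  record Split {I : Set} (R : I → I → Set) (P : I → Set) (is : List I) : Set where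
    field
      ins outs : List I
      ins-pairs : AllPairs R ins
      outs-pairs : AllPairs R outs
      ins-∈ : ∀ {i} → i ∈ ins → i ∈ is × P i
      outs-∈ : ∀ {i} → i ∈ outs → i ∈ is × ¬ P i
      lengths : length ins + length outs ≡ length is

  split : {I : Set} {R : I → I → Set} (P : I → Set) {is : List I} → AllPairs R is → Split R P is
  split P [] = record { ins = [] ; outs = [] ; ins-pairs = [] ; outs-pairs = [] ; ins-∈ = λ () ; outs-∈ = λ () ; lengths = refl }
  split P {i ∷ is} (h ∷ d) with split P d | dec (P i)
  ... | s | yes p = record
    { ins = i ∷ ins ; outs = outs ; ins-pairs = tabulateAll (λ q → lookupAll h (proj₁ (ins-∈ q))) ∷ ins-pairs
    ; outs-pairs = outs-pairs
    ; ins-∈ = λ { (here refl) → here refl , p ; (there q) → there (proj₁ (ins-∈ q)) , proj₂ (ins-∈ q) }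
    ; outs-∈ = λ q → there (proj₁ (outs-∈ q)) , proj₂ (outs-∈ q)
    ; lengths = cong suc lengths }
    where open Split s
  ... | s | no p = record
    { ins = ins ; outs = i ∷ outs ; ins-pairs = ins-pairs
    ; outs-pairs = tabulateAll (λ q → lookupAll h (proj₁ (outs-∈ q))) ∷ outs-pairs
    ; ins-∈ = λ q → there (proj₁ (ins-∈ q)) , proj₂ (ins-∈ q)
    ; outs-∈ = λ { (here refl) → here refl , p ; (there q) → there (proj₁ (outs-∈ q)) , proj₂ (outs-∈ q) }
    ; lengths = trans (+-suc (length ins) (length outs)) (cong suc lengths) }
    where open Split s

  Select : {I : Set} (R : I → I → Set) (is : List I) (n : ℕ) (P : I → Set) → Set
  Select {I} R is n P = Σ (List I) λ us → AllPairs R us × n ≤ length us × (∀ {i} → i ∈ us → i ∈ is × P i)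

  length-outs : ∀ {I : Set} {R : I → I → Set} {P : I → Set} {is : List I} (s : Split R P is) {a b : ℕ} →
                a + b ≤ length is → length (Split.ins s) ≤ a → b ≤ length (Split.outs s)
  length-outs s {a} {b} p q = +-cancelˡ-≤ a _ _ (≤-trans p (≤-trans (≤-reflexive (sym lengths)) (+-monoˡ-≤ (length outs) q)))
    where open Split s

  pigeonhole-colour : {I C : Set} {R : I → I → Set} (P : C → I → Set) (c : C) (cs : List C) (m : ℕ) (is : List I) → AllPairs R is →
    (∀ {i} → i ∈ is → Σ C λ c′ → c′ ∈ (c ∷ cs) × P c′ i) → suc (length cs) * m ≤ length is →
    Σ C λ c′ → c′ ∈ (c ∷ cs) × Select R is m (P c′)
  pigeonhole-colour P c [] m is d h len = c , here refl , is , d , ≤-trans (≤-reflexive (sym (+-identityʳ m))) len ,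
    λ p → p , only (h p)
    where
      only : ∀ {i} → (Σ _ λ c′ → c′ ∈ (c ∷ []) × P c′ i) → P c i
      only (_ , here refl , q) = q
  pigeonhole-colour P c (c′ ∷ cs) m is d h len with split (P c) d
  ... | s with m ≤? length (Split.ins s)
  ...   | yes q = c , here refl , ins , ins-pairs , q , ins-∈
    where open Split s
  ...   | no q with pigeonhole-colour P c′ cs m outs outs-pairs h′ (length-outs s len (<⇒≤ (≰⇒> q)))
    where
      open Split s
      h′ : ∀ {i} → i ∈ outs → Σ _ λ c″ → c″ ∈ (c′ ∷ cs) × P c″ i
      h′ p with h (proj₁ (outs-∈ p))
      ... | _ , here refl , r = ⊥-elim (proj₂ (outs-∈ p) r)
      ... | c″ , there r , t = c″ , r , t
  ...     | c″ , r , us , d′ , len′ , sel = c″ , there r , us , d′ , len′ ,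
    λ p → proj₁ (Split.outs-∈ s (proj₁ (sel p))) , proj₂ (sel p)

  -- As long as no value is taken `n` times, discarding all items with the value of the first one
  -- costs at most `n` items, so `j * n` items last for `j` rounds. The third alternative arises
  -- when the list runs out because `n` is zero.
  pigeonhole-value : {I W : Set} {R : I → I → Set} (e : I → W) (n j : ℕ) (is : List I) → AllPairs R is → j * n ≤ length is →
    (Σ W λ w → Select R is n (λ i → e i ≡ w)) ⊎
    (Σ (List I) λ us → AllPairs R us × Distinct e us × j ≤ length us × (∀ {i} → i ∈ us → i ∈ is)) ⊎ (n ≡ 0)
  pigeonhole-value e n zero is d len = inj₂ (inj₁ ([] , [] , [] , z≤n , λ ()))
  pigeonhole-value e n (suc j) [] d len = inj₂ (inj₂ (n≤0⇒n≡0 (≤-trans (m≤m+n n (j * n)) len)))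
  pigeonhole-value {R = R} e n (suc j) (i ∷ is) d@(h ∷ _) len with split (λ k → e k ≡ e i) d
  ... | s with n ≤? length (Split.ins s)
  ...   | yes q = inj₁ (e i , ins , ins-pairs , q , ins-∈)
    where open Split s
  ...   | no q with pigeonhole-value e n j (Split.outs s) (Split.outs-pairs s) (length-outs s len (<⇒≤ (≰⇒> q)))
  ...     | inj₁ (w , us , d′ , len′ , sel) = inj₁ (w , us , d′ , len′ , λ p → proj₁ (Split.outs-∈ s (proj₁ (sel p))) , proj₂ (sel p))
  ...     | inj₂ (inj₂ z) = inj₂ (inj₂ z)
  ...     | inj₂ (inj₁ (us , d′ , e′ , len′ , sel)) = inj₂ (inj₁ (i ∷ us , tabulateAll rel ∷ d′ , tabulateAll (λ p → fresh p ∘ sym) ∷ e′ , s≤s len′ , λ where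
      (here refl) → here refl
      (there p) → proj₁ (Split.outs-∈ s (sel p))))
    where
      fresh : ∀ {k} → k ∈ us → e k ≢ e i
      fresh p = proj₂ (Split.outs-∈ s (sel p))
      rel : ∀ {k} → k ∈ us → R i k
      rel p with proj₁ (Split.outs-∈ s (sel p))
      ... | here refl = ⊥-elim (fresh p refl)
      ... | there r = lookupAll h r

  module Trees (V : Set) where

    Level : Set
    Level = ℕ → V

    -- S contains the leaves of a tree that branches n-fold at each level: two leaves share their ancestor
    -- at a level F exactly if F (and every earlier level) agrees on them.
    Tree : List Level → ℕ → (ℕ → Set) → Set
    Tree [] n S = Σ ℕ S
    Tree (F ∷ Fs) n S = Σ (List V) λ vs → Distinct (λ v → v) vs × n ≤ length vs ×
                        (∀ {v} → v ∈ vs → Tree Fs n (λ x → S x × F x ≡ v))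

    tree-mono : ∀ Fs {n S S′} → (∀ {x} → S x → S′ x) → Tree Fs n S → Tree Fs n S′
    tree-mono [] h (x , p) = x , h p
    tree-mono (F ∷ Fs) h (vs , d , len , t) = vs , d , len , λ p → tree-mono Fs (λ (q , r) → h q , r) (t p)

    tree-anti : ∀ Fs {m n S} → m ≤ n → Tree Fs n S → Tree Fs m S
    tree-anti [] h t = t
    tree-anti (F ∷ Fs) h (vs , d , len , t) = vs , d , ≤-trans h len , λ p → tree-anti Fs h (t p)

    tree-nonempty : ∀ Fs {n S} → 0 < n → Tree Fs n S → Σ ℕ S
    tree-nonempty [] h t = t
    tree-nonempty (F ∷ Fs) h ([] , d , len , t) = ⊥-elim (n≮0 (≤-trans h len))
    tree-nonempty (F ∷ Fs) h (v ∷ vs , d , len , t) with tree-nonempty Fs h (t (here refl))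
    ... | x , p , _ = x , p

    size : List Level → ℕ → ℕ
    size [] n = 1
    size (F ∷ Fs) n = n * size Fs n

    -- The bound on the number of leaves tells in advance how many values the trees chosen
    -- afterwards have to avoid.
    tree-finite : ∀ Fs n {S} → Tree Fs n S →
      Σ (List ℕ) λ xs → (∀ {x} → x ∈ xs → S x) × length xs ≤ size Fs n × Tree Fs n (_∈ xs)
    tree-finite [] n (x , p) = x ∷ [] , (λ { (here refl) → p }) , ≤-refl , x , here refl
    tree-finite (F ∷ Fs) n {S} (vs , d , len , t) with collect (take n vs) (λ p → t (∈-take n p))
      where
        collect : (us : List V) → (∀ {v} → v ∈ us → Tree Fs n (λ x → S x × F x ≡ v)) →
          Σ (List ℕ) λ xs → (∀ {x} → x ∈ xs → S x) × length xs ≤ length us * size Fs n ×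
          (∀ {v} → v ∈ us → Tree Fs n (λ x → x ∈ xs × F x ≡ v))
        collect [] t = [] , (λ ()) , z≤n , λ ()
        collect (v ∷ us) t with tree-finite Fs n (t (here refl)) | collect us (λ p → t (there p))
        ... | xs , h , l , s | ys , h′ , l′ , s′ = xs ++ ys , sub ,
              ≤-trans (≤-reflexive (length-++ xs)) (+-mono-≤ l l′) , λ where
                (here refl) → tree-mono Fs (λ q → ∈-++⁺ˡ q , proj₂ (h q)) s
                (there p) → tree-mono Fs (λ (q , r) → ∈-++⁺ʳ xs q , r) (s′ p)
          where
            sub : ∀ {x} → x ∈ xs ++ ys → S x
            sub p with ∈-++⁻ xs p
            ... | inj₁ q = proj₁ (h q)
            ... | inj₂ q = h′ q
    ... | xs , h , l , s = xs , h , subst (λ k → length xs ≤ k * size Fs n) (length-take-≤ n len) l ,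
      take n vs , distinct-take n d , ≤-reflexive (sym (length-take-≤ n len)) , s

    -- Where `g` determines `G`, all leaves with value `w` share one value of `G`. Dropping the
    -- child with this value from the nodes that branch at `G` costs each of them at most one child.
    tree-avoid₁ : ∀ {B : Set} Fs {G n} (g : ℕ → B) (w : B) {S} → G ∈ Fs → (∀ {x y} → S x → S y → g x ≡ g y → G x ≡ G y) →
                  Tree Fs (suc n) S → Tree Fs n (λ x → S x × g x ≢ w)
    tree-avoid₁ (F ∷ Fs) {n = n} g w {S} (here refl) h (vs , d , len , t) = outs , outs-pairs , length-outs s {1} len (atMostOne ins-pairs ins-∈) ,
      λ p → tree-mono Fs (λ (q , r) → (q , λ e → proj₂ (outs-∈ p) (_ , q , r , e)) , r) (tree-anti Fs (n≤1+n n) (t (proj₁ (outs-∈ p))))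
      where
        Bad : V → Set
        Bad v = Σ ℕ λ x → S x × F x ≡ v × g x ≡ w
        s = split Bad d
        open Split s
        atMostOne : ∀ {us} → Distinct (λ v → v) us → (∀ {v} → v ∈ us → v ∈ vs × Bad v) → length us ≤ 1
        atMostOne [] _ = z≤n
        atMostOne {_ ∷ []} _ _ = ≤-refl
        atMostOne {_ ∷ _ ∷ _} ((u≢v ∷ _) ∷ _) b with b (here refl) | b (there (here refl))
        ... | _ , x , p , q , r | _ , y , p′ , q′ , r′ = ⊥-elim (u≢v (trans (sym q) (trans (h p p′ (trans r (sym r′))) q′)))
    tree-avoid₁ (F ∷ Fs) {n = n} g w (there G∈) h (vs , d , len , t) = vs , d , ≤-trans (n≤1+n n) len ,
      λ p → tree-mono Fs (λ ((q , r) , e) → (q , e) , r) (tree-avoid₁ Fs g w G∈ (λ (p , _) (q , _) → h p q) (t p))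

    tree-avoid : ∀ {B : Set} Fs {G n} (g : ℕ → B) (W : List B) {S} → G ∈ Fs → (∀ {x y} → S x → S y → g x ≡ g y → G x ≡ G y) →
                 Tree Fs (length W + n) S → Tree Fs n (λ x → S x × g x ∉ W)
    tree-avoid Fs g [] G∈ h t = tree-mono Fs (λ p → p , λ ()) t
    tree-avoid Fs g (w ∷ W) G∈ h t = tree-mono Fs (λ ((p , q) , r) → p , λ { (here e) → q e ; (there e) → r e })
      (tree-avoid Fs g W G∈ (λ (p , _) (q , _) → h p q) (tree-avoid₁ Fs g w G∈ h t))

    tree-separate : ∀ Fs {G} (W : List V) {S} → G ∈ Fs → Tree Fs (length W + 1) S → Σ ℕ λ x → S x × G x ∉ W
    tree-separate Fs {G} W G∈ t = tree-nonempty Fs ≤-refl (tree-avoid Fs G W G∈ (λ _ _ p → p) t)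

    -- Two leaves below the same node of `F` can be chosen with different values of `G`. This is
    -- what later keeps the models of different labels apart.
    tree-strict : ∀ As {F Bs G S} → G ∈ Bs → Tree (As ++ F ∷ Bs) 2 S → Σ ℕ λ x → Σ ℕ λ y → S x × S y × F x ≡ F y × G x ≢ G y
    tree-strict [] G∈ ([] , _ , () , _)
    tree-strict [] {Bs = Bs} {G} G∈ (v ∷ vs , d , len , t)
      with tree-separate Bs [] G∈ (tree-anti Bs (s≤s z≤n) (t (here refl)))
    ... | x , (p , q) , _ with tree-separate Bs (G x ∷ []) G∈ (t (here refl))
    ...   | y , (p′ , q′) , r = x , y , p , p′ , trans q (sym q′) , λ e → r (here (sym e))
    tree-strict (A ∷ As) G∈ ([] , _ , () , _)
    tree-strict (A ∷ As) G∈ (v ∷ vs , d , len , t) with tree-strict As G∈ (t (here refl))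
    ... | x , y , (p , _) , (q , _) , r = x , y , p , q , r

    ChainAt : List Level → ℕ → ℕ → Set
    ChainAt Fs x y = AllPairs (λ F G → G x ≡ G y → F x ≡ F y) Fs

    Chain : List Level → (ℕ → Set) → Set
    Chain Fs S = ∀ {x y} → S x → S y → ChainAt Fs x y

    Canonical : Level → Level → (ℕ → Set) → Set
    Canonical G E S = ∀ {x y} → S x → S y → (E x ≡ E y) ⟷ (G x ≡ G y)

    -- E-values of different children are kept apart by thinning the children one after the other,
    -- each time avoiding the finitely many values already used.
    module _ (F : Level) (Fs : List Level) (E : Level) (n : ℕ) where

      Child : Set
      Child = V × List ℕ

      thin : ∀ {G} → G ∈ Fs → (W : List V) (is : List Child) →
        (∀ {i} → i ∈ is → Tree Fs (length W + (n + length is * size Fs n)) (_∈ proj₂ i) ×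
                          (∀ {x} → x ∈ proj₂ i → F x ≡ proj₁ i) × Canonical G E (_∈ proj₂ i)) →
        Σ (List ℕ) λ zs → (∀ {z} → z ∈ zs → Σ Child λ i → i ∈ is × z ∈ proj₂ i) × (∀ {z} → z ∈ zs → E z ∉ W) ×
          (∀ {i} → i ∈ is → Tree Fs n (λ x → x ∈ zs × F x ≡ proj₁ i)) × (∀ {x y} → x ∈ zs → y ∈ zs → E x ≡ E y → F x ≡ F y)
      thin G∈ W [] h = [] , (λ ()) , (λ ()) , (λ ()) , λ ()
      thin G∈ W (i ∷ is) h with h (here refl)
      ... | t , k , c with tree-finite Fs n (tree-avoid Fs E W G∈ (λ p q → proj₁ (c p q)) (tree-anti Fs (+-monoʳ-≤ (length W) (m≤m+n n _)) t))
      ...   | ys , sub , len , t′ with thin G∈ (map E ys ++ W) is (λ p → tree-anti Fs arity (proj₁ (h (there p))) , proj₂ (h (there p)))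
        where
          open ≤-Reasoning
          arity : length (map E ys ++ W) + (n + length is * size Fs n) ≤ length W + (n + (size Fs n + length is * size Fs n))
          arity = begin
            length (map E ys ++ W) + (n + length is * size Fs n)          ≡⟨ cong (_+ (n + length is * size Fs n)) (length-++ (map E ys)) ⟩
            length (map E ys) + length W + (n + length is * size Fs n)    ≡⟨ cong (λ l → l + length W + (n + length is * size Fs n)) (length-map E ys) ⟩
            length ys + length W + (n + length is * size Fs n)            ≤⟨ +-monoˡ-≤ _ (+-monoˡ-≤ (length W) len) ⟩
            size Fs n + length W + (n + length is * size Fs n)            ≡⟨ ring (size Fs n) (length W) n (length is * size Fs n) ⟩
            length W + (n + (size Fs n + length is * size Fs n))          ∎
            where
              ring : ∀ a b c d → a + b + (c + d) ≡ b + (c + (a + d))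
              ring = solve-∀
      ...     | zs , sub′ , avoid , trees , disjoint = ys ++ zs , sub″ , avoid″ , trees″ , disjoint″
        where
          sub″ : ∀ {z} → z ∈ ys ++ zs → Σ Child λ j → j ∈ (i ∷ is) × z ∈ proj₂ j
          sub″ p with ∈-++⁻ ys p
          ... | inj₁ q = i , here refl , proj₁ (sub q)
          ... | inj₂ q with sub′ q
          ...   | j , r , s = j , there r , s
          avoid″ : ∀ {z} → z ∈ ys ++ zs → E z ∉ W
          avoid″ p with ∈-++⁻ ys p
          ... | inj₁ q = proj₂ (sub q)
          ... | inj₂ q = λ r → avoid q (∈-++⁺ʳ (map E ys) r)
          trees″ : ∀ {j} → j ∈ (i ∷ is) → Tree Fs n (λ x → x ∈ ys ++ zs × F x ≡ proj₁ j)
          trees″ (here refl) = tree-mono Fs (λ p → ∈-++⁺ˡ p , k (proj₁ (sub p))) t′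
          trees″ (there p) = tree-mono Fs (λ (q , r) → ∈-++⁺ʳ ys q , r) (trees p)
          disjoint″ : ∀ {x y} → x ∈ ys ++ zs → y ∈ ys ++ zs → E x ≡ E y → F x ≡ F y
          disjoint″ p q e with ∈-++⁻ ys p | ∈-++⁻ ys q
          ... | inj₁ r | inj₁ s = trans (k (proj₁ (sub r))) (sym (k (proj₁ (sub s))))
          ... | inj₁ r | inj₂ s = ⊥-elim (avoid s (∈-++⁺ˡ (subst (_∈ map E ys) e (∈-map⁺ E r))))
          ... | inj₂ r | inj₁ s = ⊥-elim (avoid r (∈-++⁺ˡ (subst (_∈ map E ys) (sym e) (∈-map⁺ E s))))
          ... | inj₂ r | inj₂ s = disjoint r s e

    concat-children : {A : Set} (f : A → List ℕ) (is : List A) →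
      Σ (List ℕ) λ zs → (∀ {z} → z ∈ zs → Σ A λ i → i ∈ is × z ∈ f i) × (∀ {i} → i ∈ is → ∀ {z} → z ∈ f i → z ∈ zs)
    concat-children f [] = [] , (λ ()) , λ ()
    concat-children f (i ∷ is) with concat-children f is
    ... | zs , h , k = f i ++ zs , to , λ where
          (here refl) p → ∈-++⁺ˡ p
          (there p) q → ∈-++⁺ʳ (f i) (k p q)
      where
        to : ∀ {z} → z ∈ f i ++ zs → Σ _ λ j → j ∈ (i ∷ is) × z ∈ f j
        to p with ∈-++⁻ (f i) p
        ... | inj₁ q = i , here refl , q
        ... | inj₂ q with h q
        ...   | j , r , s = j , there r , s

    attach : (C : V → Set) (vs : List V) → (∀ {v} → v ∈ vs → C v) → Distinct (λ v → v) vs →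
      Σ (List (Σ V C)) λ is → Distinct proj₁ is × length is ≡ length vs × (∀ {i} → i ∈ is → proj₁ i ∈ vs)
    attach C [] h d = [] , [] , refl , λ ()
    attach C (v ∷ vs) h (p ∷ d) with attach C vs (λ q → h (there q)) d
    ... | is , d′ , len , mem = (v , h (here refl)) ∷ is , tabulateAll (λ q → lookupAll p (mem q)) ∷ d′ , cong suc len , λ where
      (here refl) → here refl
      (there q) → there (mem q)

    Canonises : List Level → Level → Level → ℕ → (ℕ → Set) → Set
    Canonises Fs G E n S = Σ (List ℕ) λ xs → (∀ {x} → x ∈ xs → S x) × Tree Fs n (_∈ xs) × Canonical G E (_∈ xs)

    module _ (c₀ : V) where

      constant : Level
      constant _ = c₀

      -- Each child of the root is canonised by induction, and many children receive the same type.
      -- If this type is a level below `F`, `thin` keeps the `E`-values of different children apart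
      -- and the type persists. If it is constant, every child has one value: `n` children with
      -- equal values give the constant type, and `n` with distinct values give the kernel of `F`.
      canonical-subtree : ∀ Fs n → 0 < n → Σ ℕ λ N → ∀ E {S} → Chain Fs S → Tree Fs N S →
                          Σ Level λ G → G ∈ (constant ∷ Fs) × Canonises Fs G E n S
      canonical-subtree [] n 0<n = 0 , λ E ch (x , p) → constant , here refl , x ∷ [] , (λ { (here refl) → p }) , (x , here refl) ,
        λ { (here refl) (here refl) → (λ _ → refl) , (λ _ → refl) }
      canonical-subtree (F ∷ Fs) n 0<n with canonical-subtree Fs (n + n * size Fs n) (≤-trans 0<n (m≤m+n n _))
      -- `N′` is the arity needed inside the children. The other summand leaves `n * n` children of
      -- one of the `suc (length Fs)` types, enough for `n` equal or `n` distinct values.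
      ... | N′ , ih = N′ + suc (length Fs) * (n * n) , main
        where
          -- `thin` treats `n` children, and each adds at most `size Fs n` values to those that the
          -- later ones must avoid.
          n′ = n + n * size Fs n
          main : ∀ E {S} → Chain (F ∷ Fs) S → Tree (F ∷ Fs) (N′ + suc (length Fs) * (n * n)) S →
                 Σ Level λ G → G ∈ (constant ∷ F ∷ Fs) × Canonises (F ∷ Fs) G E n S
          main E {S} ch (vs , d , len , t) with attach C vs child d
            where
              C : V → Set
              C v = Σ Level λ G → G ∈ (constant ∷ Fs) × Canonises Fs G E n′ (λ x → S x × F x ≡ v)
              child : ∀ {v} → v ∈ vs → C v
              child p = ih E (λ (q , _) (r , _) → tail (ch q r)) (tree-anti Fs (m≤m+n N′ _) (t p))
                where
                  tail : ∀ {x y} → ChainAt (F ∷ Fs) x y → ChainAt Fs x y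
                  tail (_ ∷ q) = q
          ... | is , dis , len′ , mem = coloured (pigeonhole-colour Q constant Fs (n * n) is dis (λ {i} _ → colour i)
                  (≤-trans (m≤n+m _ N′) (≤-trans len (≤-reflexive (sym len′)))))
            where
              Item = Σ V λ v → Σ Level λ G → G ∈ (constant ∷ Fs) × Canonises Fs G E n′ (λ x → S x × F x ≡ v)
              leaves : Item → List ℕ
              leaves (_ , _ , _ , xs , _) = xs
              leaves-S : ∀ i {x} → x ∈ leaves i → S x × F x ≡ proj₁ i
              leaves-S (_ , _ , _ , xs , sub , _) = sub
              tree : ∀ i → Tree Fs n′ (_∈ leaves i)
              tree (_ , _ , _ , _ , _ , t , _) = t
              Q : Level → Item → Set
              Q G i = Canonical G E (_∈ leaves i)
              colour : ∀ i → Σ Level λ G → G ∈ (constant ∷ Fs) × Q G i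
              colour (_ , G , p , _ , _ , _ , c) = G , p , c
              witness : ∀ i → Σ ℕ (_∈ leaves i)
              witness i = tree-nonempty Fs (≤-trans 0<n (m≤m+n n _)) (tree i)
              e : Item → V
              e i = E (proj₁ (witness i))
              assemble : (us : List Item) → Distinct proj₁ us → n ≤ length us → (zs : List ℕ) →
                (∀ {i} → i ∈ us → Tree Fs n (λ x → x ∈ zs × F x ≡ proj₁ i)) → Tree (F ∷ Fs) n (_∈ zs)
              assemble us du lu zs h = map proj₁ us , distinct-map proj₁ du , ≤-trans lu (≤-reflexive (sym (length-map proj₁ us))) , λ p → at (∈-map⁻ proj₁ p)
                where
                  at : ∀ {v} → (Σ Item λ i → i ∈ us × v ≡ proj₁ i) → Tree Fs n (λ x → x ∈ zs × F x ≡ v)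
                  at (i , p , refl) = h p
              union : (us : List Item) → Distinct proj₁ us → n ≤ length us → (G : Level) →
                (∀ {i j} → i ∈ us → j ∈ us → ∀ {x y} → x ∈ leaves i → y ∈ leaves j → (E x ≡ E y) ⟷ (G x ≡ G y)) →
                Canonises (F ∷ Fs) G E n S
              union us du lu G h with concat-children {A = Item} leaves us
              ... | zs , to , from = zs , (λ p → proj₁ (leaves-S (proj₁ (to p)) (proj₂ (proj₂ (to p))))) ,
                assemble us du lu zs (λ {i} p → tree-mono Fs (λ q → from p q , proj₂ (leaves-S i q)) (tree-anti Fs (m≤m+n n _) (tree i))) ,
                λ p q → h {proj₁ (to p)} {proj₁ (to q)} (proj₁ (proj₂ (to p))) (proj₁ (proj₂ (to q))) (proj₂ (proj₂ (to p))) (proj₂ (proj₂ (to q)))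
              E-value : ∀ i → Q constant i → ∀ {x} → x ∈ leaves i → E x ≡ e i
              E-value i c p = proj₂ (c p (proj₂ (witness i))) refl
              coloured : (Σ Level λ G → G ∈ (constant ∷ Fs) × Select (λ i j → proj₁ i ≢ proj₁ j) is (n * n) (Q G)) →
                         Σ Level λ G → G ∈ (constant ∷ F ∷ Fs) × Canonises (F ∷ Fs) G E n S
              coloured (_ , here refl , us , du , lu , sel) with pigeonhole-value {R = λ i j → proj₁ i ≢ proj₁ j} e n n us du lu
              ... | inj₂ (inj₂ refl) = ⊥-elim (n≮0 0<n)
              ... | inj₁ (w , ws , dw , lw , sel′) = constant , here refl , union ws dw lw constant λ {i} {j} p q r s →
                      (λ _ → refl) , λ _ → trans (const i p r) (sym (const j q s))
                where
                  const : ∀ i → i ∈ ws → ∀ {x} → x ∈ leaves i → E x ≡ w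
                  const i p q = trans (E-value i (proj₂ (sel (proj₁ (sel′ p)))) q) (proj₂ (sel′ p))
              ... | inj₂ (inj₁ (ws , dw , de , lw , sel′)) = F , there (here refl) , union ws dw lw F λ {i} {j} p q r s →
                      (λ eq → trans (proj₂ (leaves-S i r)) (trans (cong proj₁ (distinct-injective e de p q
                        (trans (sym (const i p r)) (trans eq (const j q s))))) (sym (proj₂ (leaves-S j s))))) ,
                      (λ eq → trans (const i p r) (trans (cong e (distinct-injective proj₁ dw p q
                        (trans (sym (proj₂ (leaves-S i r))) (trans eq (proj₂ (leaves-S j s)))))) (sym (const j q s))))
                where
                  const : ∀ i → i ∈ ws → ∀ {x} → x ∈ leaves i → E x ≡ e i
                  const i p = E-value i (proj₂ (sel (sel′ p)))
              coloured (G , there G∈ , us , du , lu , sel) = finish (thin F Fs E n G∈ [] (map (λ i → proj₁ i , leaves i) ws) pre)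
                where
                  instance _ = >-nonZero 0<n
                  n≤ : n ≤ length us
                  n≤ = ≤-trans (m≤m*n n n) lu
                  ws = take n us
                  dw : Distinct proj₁ ws
                  dw = distinct-take n du
                  lw : length ws ≡ n
                  lw = length-take-≤ n n≤
                  key : Item → V × List ℕ
                  key i = proj₁ i , leaves i
                  pre : ∀ {i} → i ∈ map key ws → Tree Fs (n + length (map key ws) * size Fs n) (_∈ proj₂ i) ×
                          (∀ {x} → x ∈ proj₂ i → F x ≡ proj₁ i) × Canonical G E (_∈ proj₂ i)
                  pre p with ∈-map⁻ key p
                  ... | i , q , refl = subst (λ l → Tree Fs (n + l * size Fs n) (_∈ leaves i)) (sym (trans (length-map key ws) lw)) (tree i) ,
                    (λ r → proj₂ (leaves-S i r)) , proj₂ (sel (∈-take n q))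
                  finish : _ → Σ Level λ G → G ∈ (constant ∷ F ∷ Fs) × Canonises (F ∷ Fs) G E n S
                  finish (zs , sub , _ , trees , disjoint) = G , there (there G∈) , zs , zs-S ,
                      assemble ws dw (≤-reflexive (sym lw)) zs (λ p → trees (∈-map⁺ key p)) ,
                      λ p q → (λ eq → proj₁ (same p q (disjoint p q eq)) eq) ,
                              (λ eq → proj₂ (same p q (G⇒F (ch (zs-S p) (zs-S q)) eq)) eq)
                    where
                      origin : ∀ {z} → z ∈ zs → Σ Item λ i → i ∈ ws × z ∈ leaves i
                      origin p with sub p
                      ... | _ , q , r with ∈-map⁻ key q
                      ...   | i , s , refl = i , s , r
                      zs-S : ∀ {z} → z ∈ zs → S z
                      zs-S p with origin p
                      ... | i , _ , r = proj₁ (leaves-S i r)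
                      G⇒F : ∀ {x y} → ChainAt (F ∷ Fs) x y → G x ≡ G y → F x ≡ F y
                      G⇒F (h ∷ _) = lookupAll h G∈
                      same : ∀ {x y} → x ∈ zs → y ∈ zs → F x ≡ F y → (E x ≡ E y) ⟷ (G x ≡ G y)
                      same p q eq with origin p | origin q
                      ... | i , i∈ , r | j , j∈ , s
                        with refl ← distinct-injective proj₁ dw i∈ j∈ (trans (sym (proj₂ (leaves-S i r))) (trans eq (proj₂ (leaves-S j s))))
                        = proj₂ (sel (∈-take n i∈)) r s

-- Thinning and adding a level

∈-drop : {I : Set} (n : ℕ) {is : List I} {i : I} → i ∈ drop n is → i ∈ is
∈-drop zero p = p
∈-drop (suc n) {_ ∷ _} p = there (∈-drop n p)

distinct-drop : {I K : Set} {key : I → K} (n : ℕ) {is : List I} → Distinct key is → Distinct key (drop n is)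
distinct-drop zero d = d
distinct-drop (suc n) [] = []
distinct-drop (suc n) (h ∷ d) = distinct-drop n d

take-drop-disjoint : {I : Set} (n : ℕ) {is : List I} → Distinct (λ i → i) is → ∀ {i} → i ∈ take n is → i ∉ drop n is
take-drop-disjoint (suc n) (h ∷ d) (here refl) q = lookupAll h (∈-drop n q) refl
take-drop-disjoint (suc n) (h ∷ d) (there p) q = take-drop-disjoint n d p q

distinct-map-injective : {I K : Set} {f : I → K} → (∀ {i j} → f i ≡ f j → i ≡ j) →
  ∀ {is} → Distinct (λ i → i) is → Distinct (λ k → k) (map f is)
distinct-map-injective {f = f} inj d = distinct-map f (mapPairs (λ p q → p (inj q)) d)

module _ (dec : (P : Set) → Dec P) where

  counterexample : {A : Set} {P : A → Set} → ¬ (∀ a → P a) → Σ A λ a → ¬ P a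
  counterexample {A} {P} n with dec (Σ A λ a → ¬ P a)
  ... | yes q = q
  ... | no q = ⊥-elim (n λ a → decidable-stable (dec (P a)) λ r → q (a , r))

  -- A candidate that fails at some `n₀` fails at all larger arguments, so asking the hypothesis at
  -- `n ⊔ n₀` strikes it from the list.
  uniform-choice : {A : Set} (P : A → ℕ → Set) → (∀ {a m n} → m ≤ n → P a n → P a m) → (as : List A) →
    (∀ n → Σ A λ a → a ∈ as × P a n) → Σ A λ a → a ∈ as × (∀ n → P a n)
  uniform-choice P anti [] h with h 0
  ... | _ , () , _
  uniform-choice P anti (a ∷ as) h with dec (∀ n → P a n)
  ... | yes p = a , here refl , p
  ... | no ¬p with counterexample ¬p
  ...   | n₀ , p with uniform-choice P anti as rest
    where
      rest : ∀ n → Σ _ λ a′ → a′ ∈ as × P a′ n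
      rest n with h (n ⊔ n₀)
      ... | _ , here refl , q = ⊥-elim (p (anti (m≤n⊔m n n₀) q))
      ... | a′ , there r , q = a′ , r , anti (m≤m⊔n n n₀) q
  ...     | a′ , r , q = a′ , there r , q

  module Thinning (V : Set) where
    open Trees dec V

    Large : List Level → (ℕ → Set) → Set
    Large Fs S = ∀ n → Tree Fs n S

    canonises-anti : ∀ Fs {G E m n S} → m ≤ n → Canonises Fs G E n S → Canonises Fs G E m S
    canonises-anti Fs h (xs , sub , t , c) = xs , sub , tree-anti Fs h t , c

    no-tree-bound : ∀ Fs (P : ℕ → ℕ → Set) (ys : List ℕ) → (∀ {y} → y ∈ ys → Σ ℕ λ n → ¬ Tree Fs n (P y)) →
                    Σ ℕ λ N → ∀ {y} → y ∈ ys → ¬ Tree Fs N (P y)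
    no-tree-bound Fs P [] h = 0 , λ ()
    no-tree-bound Fs P (y ∷ ys) h with h (here refl) | no-tree-bound Fs P ys (λ p → h (there p))
    ... | n , p | N , q = n ⊔ N , λ where
      (here refl) t → p (tree-anti Fs (m≤m⊔n n N) t)
      (there r) t → q r (tree-anti Fs (m≤n⊔m n N) t)

    module _ (c₀ : V) (F : Level) (Fs : List Level) (E : Level) (X : ℕ → Set) where

      -- If E is constant on trees of every size but with no single value, then children taken from trees
      -- with different values give trees on which E and the coarsest level F agree.
      branch-canonises : (∀ n → Canonises (F ∷ Fs) (constant c₀) E n X) →
        ¬ (Σ ℕ λ x₀ → ∀ n → Tree (F ∷ Fs) n (λ x → X x × E x ≡ E x₀)) → ∀ n → Canonises (F ∷ Fs) F E n X
      branch-canonises can none n with pick n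
        where
          Item : Set
          Item = V × ℕ × List ℕ
          value : Item → V
          value (_ , y , _) = E y
          Good : Item → Set
          Good (u , y , xs) = (∀ {x} → x ∈ xs → X x × F x ≡ u × E x ≡ E y) × Tree Fs n (_∈ xs)
          small : ∀ y → Σ ℕ λ m → ¬ Tree (F ∷ Fs) m (λ x → X x × E x ≡ E y)
          small y = counterexample λ t → none (y , t)
          pick : ∀ j → Σ (List Item) λ is → j ≤ length is × Distinct proj₁ is × Distinct value is × (∀ {i} → i ∈ is → Good i)
          pick zero = [] , z≤n , [] , [] , λ ()
          pick (suc j) with pick j
          ... | is , len , d , d′ , good
            with no-tree-bound (F ∷ Fs) (λ y x → X x × E x ≡ E y) (map (proj₁ ∘ proj₂) is) (λ {y} _ → small y)
          -- No tree of arity `N` carries one of the values used so far, so the constant value on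
          -- the next tree is new. The other argument of the maximum pays for avoiding the used
          -- nodes of `F` and leaves `suc n`, so that a child exists even for `n` zero.
          ...   | N , nt with can (N ⊔ (length (map proj₁ is) + suc n))
          ...     | xs , sub , t , c with tree-avoid (F ∷ Fs) F (map proj₁ is) (here refl) (λ _ _ p → p)
                                          (tree-anti (F ∷ Fs) (m≤n⊔m N _) t)
          ...       | [] , _ , () , _
          ...       | v ∷ _ , _ , _ , t′ with tree-finite Fs (suc n) (t′ (here refl))
          ...         | ys , sub′ , _ , t″ with tree-nonempty Fs (s≤s z≤n) t″
          ...           | y , y∈ = (v , y , ys) ∷ is , s≤s len , tabulateAll freshF ∷ d , tabulateAll freshE ∷ d′ , good′
            where
              y∈xs : y ∈ xs
              y∈xs = proj₁ (proj₁ (sub′ y∈))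
              freshF : ∀ {i} → i ∈ is → v ≢ proj₁ i
              freshF p refl = proj₂ (proj₁ (sub′ y∈)) (subst (_∈ map proj₁ is) (sym (proj₂ (sub′ y∈))) (∈-map⁺ proj₁ p))
              freshE : ∀ {i} → i ∈ is → E y ≢ value i
              freshE {i} p e = nt (∈-map⁺ (proj₁ ∘ proj₂) p)
                (tree-anti (F ∷ Fs) (m≤m⊔n N _) (tree-mono (F ∷ Fs) (λ q → sub q , trans (proj₂ (c q y∈xs) refl) e) t))
              good′ : ∀ {i} → i ∈ ((v , y , ys) ∷ is) → Good i
              good′ (here refl) = (λ q → let (r , _) , s = sub′ q in sub r , s , proj₂ (c r y∈xs) refl) , tree-anti Fs (n≤1+n n) t″
              good′ (there p) = good p
      ... | is , len , d , d′ , good with concat-children (proj₂ ∘ proj₂) is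
      ...   | zs , to , from = zs , (λ p → let _ , q , r = to p in proj₁ (proj₁ (good q) r)) ,
              (map proj₁ is , distinct-map proj₁ d , ≤-trans len (≤-reflexive (sym (length-map proj₁ is))) , λ p → subtree (∈-map⁻ proj₁ p)) ,
              λ p q → same (to p) (to q)
        where
          subtree : ∀ {v} → (Σ _ λ i → i ∈ is × v ≡ proj₁ i) → Tree Fs n (λ x → x ∈ zs × F x ≡ v)
          subtree (i , p , refl) = tree-mono Fs (λ q → from p q , proj₁ (proj₂ (proj₁ (good p) q))) (proj₂ (good p))
          same : ∀ {x y} → (Σ _ λ i → i ∈ is × x ∈ proj₂ (proj₂ i)) → (Σ _ λ i → i ∈ is × y ∈ proj₂ (proj₂ i)) →
                 (E x ≡ E y) ⟷ (F x ≡ F y)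
          same (i , i∈ , p) (j , j∈ , q) with proj₁ (good i∈) p | proj₁ (good j∈) q
          ... | _ , Fx , Ex | _ , Fy , Ey =
            (λ e → trans Fx (trans (cong proj₁ (distinct-injective (λ k → E (proj₁ (proj₂ k))) d′ i∈ j∈ (trans (sym Ex) (trans e Ey)))) (sym Fy))) ,
            (λ e → trans Ex (trans (cong (λ k → E (proj₁ (proj₂ k))) (distinct-injective proj₁ d i∈ j∈ (trans (sym Fx) (trans e Fy)))) (sym Ey)))

      -- One constant for each arity would not do, since trees with different constants cannot be
      -- joined. The first alternative therefore asks for a single value that serves all arities,
      -- and `branch-canonises` takes care of its failure.
      canonical-type-∷ : Chain (F ∷ Fs) X → Large (F ∷ Fs) X →
        (Σ ℕ λ x₀ → Large (F ∷ Fs) (λ x → X x × E x ≡ E x₀)) ⊎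
        (Σ Level λ G → G ∈ (F ∷ Fs) × (∀ n → Canonises (F ∷ Fs) G E n X))
      canonical-type-∷ ch large
        with uniform-choice (λ G n → Canonises (F ∷ Fs) G E n X) (canonises-anti (F ∷ Fs)) (constant c₀ ∷ F ∷ Fs) at
        where
          at : ∀ n → Σ Level λ G → G ∈ (constant c₀ ∷ F ∷ Fs) × Canonises (F ∷ Fs) G E n X
          at n with canonical-subtree c₀ (F ∷ Fs) (suc n) (s≤s z≤n)
          ... | N , h with h E ch (large N)
          ...   | G , G∈ , c = G , G∈ , canonises-anti (F ∷ Fs) (n≤1+n n) c
      ... | G , there G∈ , c = inj₂ (G , G∈ , c)
      ... | _ , here refl , c with dec (Σ ℕ λ x₀ → Large (F ∷ Fs) (λ x → X x × E x ≡ E x₀))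
      ...   | yes p = inj₁ p
      ...   | no p = inj₂ (F , here refl , branch-canonises c p)

    canonical-type : (c₀ : V) → ∀ {Fs G E X} → G ∈ Fs → Chain Fs X → Large Fs X →
      (Σ ℕ λ x₀ → Large Fs (λ x → X x × E x ≡ E x₀)) ⊎ (Σ Level λ G → G ∈ Fs × (∀ n → Canonises Fs G E n X))
    canonical-type c₀ {F ∷ Fs} {E = E} {X} _ = canonical-type-∷ c₀ F Fs E X

    -- Leaves that differ at this level differ at every level, and then the chain condition between
    -- them is vacuous.
    coarsest : ∀ Fs {G} → G ∈ Fs → Σ Level λ H → H ∈ Fs ×
               (∀ {x y} → ChainAt Fs x y → ∀ {K} → K ∈ Fs → K x ≡ K y → H x ≡ H y)
    coarsest (H ∷ Fs) _ = H , here refl , λ where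
      _ (here refl) p → p
      (h ∷ _) (there q) p → lookupAll h q p

    -- New leaves have to exceed the numbers whose membership is already settled; otherwise the
    -- union of the stages would not be internal.
    avoid-≤ : ∀ Fs {G n S} (b : ℕ) → G ∈ Fs → Tree Fs (suc b + n) S → Tree Fs n (λ x → S x × b < x)
    avoid-≤ Fs {G} {n} {S} b G∈ t = tree-mono Fs (λ (p , q) → p , ≰⇒> λ r → q (∈-upTo⁺ (s≤s r)))
      (tree-avoid Fs (λ x → x) (upTo (suc b)) G∈ (λ _ _ → cong G) (subst (λ l → Tree Fs (l + n) S) (sym (length-upTo (suc b))) t))

    -- The new tree avoids all values that `E` and `G` take on `ss`, so for an old and a new leaf
    -- both sides of the equivalence fail.
    extend-canonical : ∀ Fs {G E X} → G ∈ Fs → (∀ n → Canonises Fs G E n X) →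
      (ss : List ℕ) → Canonical G E (_∈ ss) → ∀ n b →
      Σ (List ℕ) λ xs → (∀ {x} → x ∈ xs → X x × b < x) × Tree Fs n (_∈ xs) × Canonical G E (_∈ ss ++ xs)
    extend-canonical Fs {G} {E} {X} G∈ can ss c n b
      with can (length (map E ss) + (length (map G ss) + (suc b + n)))
    ... | xs , sub , t , c′ with tree-finite Fs n (avoid-≤ Fs b G∈
          (tree-avoid Fs G (map G ss) G∈ (λ _ _ p → p) (tree-avoid Fs E (map E ss) G∈ (λ p q → proj₁ (c′ p q)) t)))
    ...   | ys , sub′ , _ , t′ = ys , (λ p → let ((q , _) , _) , r = sub′ p in sub q , r) , t′ , both
      where
        both : Canonical G E (_∈ ss ++ ys)
        both p q with ∈-++⁻ ss p | ∈-++⁻ ss q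
        ... | inj₁ r | inj₁ s = c r s
        ... | inj₂ r | inj₂ s = c′ (proj₁ (proj₁ (proj₁ (sub′ r)))) (proj₁ (proj₁ (proj₁ (sub′ s))))
        ... | inj₁ r | inj₂ s = (λ e → ⊥-elim (proj₂ (proj₁ (proj₁ (sub′ s))) (subst (_∈ map E ss) e (∈-map⁺ E r)))) ,
                                (λ e → ⊥-elim (proj₂ (proj₁ (sub′ s)) (subst (_∈ map G ss) e (∈-map⁺ G r))))
        ... | inj₂ r | inj₁ s = (λ e → ⊥-elim (proj₂ (proj₁ (proj₁ (sub′ r))) (subst (_∈ map E ss) (sym e) (∈-map⁺ E s)))) ,
                                (λ e → ⊥-elim (proj₂ (proj₁ (sub′ r)) (subst (_∈ map G ss) (sym e) (∈-map⁺ G s))))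

    tree-map : (p : ℕ → ℕ) {S₀ : ℕ → Set} {Fs Gs : List Level} → Pointwise (λ F G → ∀ {x} → S₀ x → F x ≡ G (p x)) Fs Gs →
      ∀ {n S S′} → (∀ {x} → S x → S₀ x) → (∀ {x} → S x → S′ (p x)) → Tree Fs n S → Tree Gs n S′
    tree-map p [] h k (x , q) = p x , k q
    tree-map p (e ∷ es) h k (vs , d , len , t) = vs , d , len , λ q →
      tree-map p es (h ∘ proj₁) (λ (r , s) → k r , trans (sym (e (h r))) s) (t q)

    chain-vacuous : ∀ {Fs x y} → (∀ {G} → G ∈ Fs → G x ≢ G y) → ChainAt Fs x y
    chain-vacuous {[]} h = []
    chain-vacuous {F ∷ Fs} h = tabulateAll (λ p e → ⊥-elim (h (there p) e)) ∷ chain-vacuous (λ p → h (there p))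

    chain-sym : ∀ {Fs x y} → ChainAt Fs x y → ChainAt Fs y x
    chain-sym [] = []
    chain-sym (h ∷ c) = tabulateAll (λ p e → sym (lookupAll h p (sym e))) ∷ chain-sym c

    module Insertion (ι : ℕ → V) (ι-injective : ∀ {m n} → ι m ≡ ι n → m ≡ n) where

      lift₁ : List Level → List Level
      lift₁ = map (_∘ π₁)

      -- Levels on pairs: π₂ is a new level between As and Bs, which are read through π₁.
      insert : List Level → List Level → List Level
      insert As Bs = lift₁ As ++ (ι ∘ π₂) ∷ lift₁ Bs

      chain-lift₁ : ∀ {Fs z z′} → ChainAt Fs (π₁ z) (π₁ z′) → ChainAt (lift₁ Fs) z z′
      chain-lift₁ [] = []
      chain-lift₁ {F ∷ Fs} {z} {z′} (h ∷ c) = tabulateAll (λ p → at (∈-map⁻ (_∘ π₁) p)) ∷ chain-lift₁ c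
        where
          at : ∀ {G} → (Σ Level λ K → K ∈ Fs × G ≡ K ∘ π₁) → G z ≡ G z′ → F (π₁ z) ≡ F (π₁ z′)
          at (K , p , refl) = lookupAll h p

      pair-pointwise : ∀ r Fs → Pointwise (λ F G → ∀ {x} → ℕ → F x ≡ G (pair x r)) Fs (lift₁ Fs)
      pair-pointwise r [] = []
      pair-pointwise r (F ∷ Fs) = (λ {x} _ → cong F (sym (π₁-pair x r))) ∷ pair-pointwise r Fs

      module _ (F : Level) (Bs : List Level) (S : ℕ → Set) (n : ℕ) (0<n : 0 < n) where

        Groups : List V → List ℕ → (ℕ → Set) → Set
        Groups vs rs Z = Distinct (λ r → r) rs × (∀ {r} → r ∈ rs → F r ∈ vs) ×
          (∀ {z} → Z z → (S (π₁ z) × F (π₁ z) ∈ vs) × (S (π₂ z) × F (π₂ z) ∈ vs)) ×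
          (∀ {r} → r ∈ rs → Tree (lift₁ (F ∷ Bs)) n (λ z → Z z × ι (π₂ z) ≡ ι r)) ×
          (∀ {z z′} → Z z → Z z′ → F (π₁ z) ≡ F (π₁ z′) → π₂ z ≡ π₂ z′)

        -- The children are cut into `j` blocks of `n`, and each block is named by one of its own
        -- leaves `r`. This number is the value of the new level on the block, and it sits in the
        -- second component of the pairs.
        group : ∀ j (vs : List V) → Distinct (λ v → v) vs → (∀ {v} → v ∈ vs → Tree Bs n (λ x → S x × F x ≡ v)) → j * n ≤ length vs →
                Σ (List ℕ) λ rs → Σ (ℕ → Set) λ Z → j ≤ length rs × Groups vs rs Z
        group zero vs d t len = [] , (λ _ → ⊥) , z≤n , [] , (λ ()) , (λ ()) , (λ ()) , λ ()
        group (suc j) vs d t len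
          with group j (drop n vs) (distinct-drop n d) (λ p → t (∈-drop n p))
                 (≤-trans (≤-trans (≤-reflexive (sym (m+n∸m≡n n (j * n)))) (∸-monoˡ-≤ n len)) (≤-reflexive (sym (length-drop n vs))))
             | first (take n vs) (≤-trans 0<n (≤-reflexive (sym (length-take-≤ n (≤-trans (m≤m+n n (j * n)) len))))) (λ p → p)
          where
            first : ∀ us → 0 < length us → (∀ {v} → v ∈ us → v ∈ take n vs) → Σ ℕ λ r → S r × F r ∈ take n vs
            first (u ∷ us) _ h with tree-nonempty Bs 0<n (t (∈-take n (h (here refl))))
            ... | r , s , e = r , s , subst (_∈ take n vs) (sym e) (h (here refl))
        ... | rs , Z , len′ , dr , Fr , ZS , Zt , ZF | r , Sr , Fr′ =
          r ∷ rs , Z′ , s≤s len′ , tabulateAll fresh ∷ dr , Fr″ , ZS′ , Zt′ , ZF′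
          where
            New : ℕ → Set
            New z = S (π₁ z) × F (π₁ z) ∈ take n vs × π₂ z ≡ r
            Z′ : ℕ → Set
            Z′ z = New z ⊎ Z z
            fresh : ∀ {k} → k ∈ rs → r ≢ k
            fresh p refl = take-drop-disjoint n d Fr′ (Fr p)
            Fr″ : ∀ {k} → k ∈ r ∷ rs → F k ∈ vs
            Fr″ (here refl) = ∈-take n Fr′
            Fr″ (there p) = ∈-drop n (Fr p)
            ZS′ : ∀ {z} → Z′ z → (S (π₁ z) × F (π₁ z) ∈ vs) × (S (π₂ z) × F (π₂ z) ∈ vs)
            ZS′ (inj₁ (p , q , refl)) = (p , ∈-take n q) , (Sr , ∈-take n Fr′)
            ZS′ (inj₂ p) with ZS p
            ... | (q , q′) , (s , s′) = (q , ∈-drop n q′) , (s , ∈-drop n s′)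
            Zt′ : ∀ {k} → k ∈ r ∷ rs → Tree (lift₁ (F ∷ Bs)) n (λ z → Z′ z × ι (π₂ z) ≡ ι k)
            Zt′ (here refl) = take n vs , distinct-take n d , ≤-reflexive (sym (length-take-≤ n (≤-trans (m≤m+n n (j * n)) len))) ,
              λ {v} p → tree-map (λ x → pair x r) (pair-pointwise r Bs) (λ _ → 0) (embed p) (t (∈-take n p))
              where
                embed : ∀ {v} → v ∈ take n vs → ∀ {x} → S x × F x ≡ v →
                        (Z′ (pair x r) × ι (π₂ (pair x r)) ≡ ι r) × F (π₁ (pair x r)) ≡ v
                embed p {x} (q , refl) rewrite π₁-pair x r | π₂-pair x r = (inj₁ (q , p , refl) , refl) , refl
            Zt′ (there p) = tree-mono (lift₁ (F ∷ Bs)) (λ (q , s) → inj₂ q , s) (Zt p)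
            ZF′ : ∀ {z z′} → Z′ z → Z′ z′ → F (π₁ z) ≡ F (π₁ z′) → π₂ z ≡ π₂ z′
            ZF′ (inj₁ (_ , _ , p)) (inj₁ (_ , _ , q)) _ = trans p (sym q)
            ZF′ (inj₁ (_ , p , _)) (inj₂ q) e = ⊥-elim (take-drop-disjoint n d p (subst (_∈ drop n vs) (sym e) (proj₂ (proj₁ (ZS q)))))
            ZF′ (inj₂ q) (inj₁ (_ , p , _)) e = ⊥-elim (take-drop-disjoint n d p (subst (_∈ drop n vs) e (proj₂ (proj₁ (ZS q)))))
            ZF′ (inj₂ p) (inj₂ q) e = ZF p q e

      -- The condition on `π₂ z` records that the name of a block is itself a leaf of the tree. The
      -- levels above the new one can thus be read off from the name.
      Inserted : List Level → List Level → ℕ → (ℕ → Set) → Set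
      Inserted As Bs n S = Σ (List ℕ) λ zs → (∀ {z} → z ∈ zs → S (π₁ z) × S (π₂ z)) ×
                           Tree (insert As Bs) n (_∈ zs) × Chain (insert As Bs) (_∈ zs)

      -- At the place of insertion `n * n` children become `n` blocks of `n` children; above it the
      -- construction is carried out below each node separately.
      insert-level : ∀ As F Bs n {S} → 0 < n → Chain (As ++ F ∷ Bs) S → Tree (As ++ F ∷ Bs) (n * n) S → Inserted As (F ∷ Bs) n S
      insert-level [] F Bs n {S} 0<n ch (vs , d , len , t) = result
        where
          instance _ = >-nonZero 0<n
          Ls = insert [] (F ∷ Bs)
          result : Inserted [] (F ∷ Bs) n S
          result with group F Bs S n 0<n n vs d (λ p → tree-anti Bs (m≤m*n n n) (t p)) len
          ... | rs , Z , len′ , dr , Fr , ZS , Zt , ZF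
            with tree-finite Ls n {Z} (map ι rs , distinct-map-injective ι-injective dr , ≤-trans len′ (≤-reflexive (sym (length-map ι rs))) ,
                   λ p → at (∈-map⁻ ι p))
            where
              at : ∀ {v} → (Σ ℕ λ r → r ∈ rs × v ≡ ι r) → Tree (lift₁ (F ∷ Bs)) n (λ z → Z z × ι (π₂ z) ≡ v)
              at (r , p , refl) = Zt p
          ...   | zs , sub , _ , tz = zs , (λ p → proj₁ (proj₁ (ZS (sub p))) , proj₁ (proj₂ (ZS (sub p)))) , tz , chain
            where
              chain : Chain Ls (_∈ zs)
              chain {z} {z′} p q with ch (proj₁ (proj₁ (ZS (sub p)))) (proj₁ (proj₁ (ZS (sub q))))
              ... | c@(h ∷ _) = tabulateAll (λ r e → cong ι (ZF (sub p) (sub q) (refine (∈-map⁻ (_∘ π₁) r) e))) ∷ chain-lift₁ c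
                where
                  refine : ∀ {G} → (Σ Level λ K → K ∈ (F ∷ Bs) × G ≡ K ∘ π₁) → G z ≡ G z′ → F (π₁ z) ≡ F (π₁ z′)
                  refine (_ , here refl , refl) e = e
                  refine (_ , there s , refl) e = lookupAll h s e
      insert-level (A ∷ As) F Bs n {S} 0<n ch (vs , d , len , t) = result
        where
          instance _ = >-nonZero 0<n
          Ls = insert As (F ∷ Bs)
          C : V → Set
          C v = Inserted As (F ∷ Bs) n (λ x → S x × A x ≡ v)
          tail : ∀ {x y} → ChainAt (A ∷ As ++ F ∷ Bs) x y → ChainAt (As ++ F ∷ Bs) x y
          tail (_ ∷ c) = c
          zs-of : Σ V C → List ℕ
          zs-of (_ , zs , _) = zs
          result : Inserted (A ∷ As) (F ∷ Bs) n S
          result with attach C vs (λ p → insert-level As F Bs n 0<n (λ (q , _) (r , _) → tail (ch q r)) (t p)) d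
          ... | is , di , li , mem with concat-children zs-of is
          ...   | zs , to , from = zs , (λ p → proj₁ (proj₁ (elt p)) , proj₁ (proj₂ (elt p))) ,
                  (map proj₁ is , distinct-map proj₁ di ,
                   ≤-trans (m≤m*n n n) (≤-trans len (≤-reflexive (sym (trans (length-map proj₁ is) li)))) , λ p → subtree (∈-map⁻ proj₁ p)) ,
                  chain
            where
              elt : ∀ {z} (p : z ∈ zs) → (S (π₁ z) × A (π₁ z) ≡ proj₁ (proj₁ (to p))) × (S (π₂ z) × A (π₂ z) ≡ proj₁ (proj₁ (to p)))
              elt p with to p
              ... | (v , zs′ , sub , _) , _ , q = sub q
              subtree : ∀ {v} → (Σ _ λ i → i ∈ is × v ≡ proj₁ i) → Tree Ls n (λ z → z ∈ zs × A (π₁ z) ≡ v)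
              subtree ((v , zs′ , sub , tz , _) , p , refl) = tree-mono Ls (λ q → from p q , proj₂ (proj₁ (sub q))) tz
              same : ∀ {z z′} → z ∈ zs → z′ ∈ zs → A (π₁ z) ≡ A (π₁ z′) → ChainAt Ls z z′
              same p q e with to p | to q | elt p | elt q
              ... | i , i∈ , r | j , j∈ , s | (_ , a) , _ | (_ , b) , _
                with refl ← distinct-injective proj₁ di i∈ j∈ (trans (sym a) (trans e b)) = proj₂ (proj₂ (proj₂ (proj₂ i))) r s
              chain : Chain (insert (A ∷ As) (F ∷ Bs)) (_∈ zs)
              chain {z} {z′} p q = tabulateAll refine ∷ rest
                where
                  head : ∀ {K} → K ∈ As ++ F ∷ Bs → K (π₁ z) ≡ K (π₁ z′) → A (π₁ z) ≡ A (π₁ z′)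
                  head r e with ch (proj₁ (proj₁ (elt p))) (proj₁ (proj₁ (elt q)))
                  ... | h ∷ _ = lookupAll h r e
                  refine : ∀ {G} → G ∈ Ls → G z ≡ G z′ → A (π₁ z) ≡ A (π₁ z′)
                  refine r e with ∈-++⁻ (lift₁ As) r
                  ... | inj₁ s with ∈-map⁻ (_∘ π₁) s
                  ...   | K , u , refl = head (∈-++⁺ˡ u) e
                  refine r e | inj₂ (there s) with ∈-map⁻ (_∘ π₁) s
                  ...   | K , u , refl = head (∈-++⁺ʳ As u) e
                  -- A name lies below the same node of `A` as the leaves of its block, so equal
                  -- names force equal values of `A`.
                  refine r e | inj₂ (here refl) = trans (proj₂ (proj₁ (elt p))) (trans (sym (proj₂ (proj₂ (elt p))))
                    (trans (cong A (ι-injective e)) (trans (proj₂ (proj₂ (elt q))) (sym (proj₂ (proj₁ (elt q)))))))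
                  rest : ChainAt Ls z z′
                  rest with dec (A (π₁ z) ≡ A (π₁ z′))
                  ... | yes e = same p q e
                  ... | no ne = chain-vacuous (λ r e → ne (refine r e))

      -- Old and new pairs are separated at the old levels by fresh values at the coarsest one, and
      -- at the new level because names are leaves and all new leaves exceed the old names. The
      -- chain condition between them is then vacuous.
      extend-inserted : ∀ As F Bs {X} → Chain (As ++ F ∷ Bs) X → Large (As ++ F ∷ Bs) X →
        (ss : List ℕ) → (∀ {z} → z ∈ ss → X (π₁ z)) → Chain (insert As (F ∷ Bs)) (_∈ ss) → ∀ n b →
        Σ (List ℕ) λ zs → (∀ {z} → z ∈ zs → X (π₁ z) × b < π₁ z) × Tree (insert As (F ∷ Bs)) n (_∈ zs) ×
                          Chain (insert As (F ∷ Bs)) (_∈ ss ++ zs)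
      extend-inserted As F Bs {X} ch large ss ss-X ch′ n b
        with coarsest (As ++ F ∷ Bs) {F} (∈-++⁺ʳ As (here refl)) | list-bound (map π₂ ss)
      ... | H , H∈ , coarse | b′ , bound-π₂
        with insert-level As F Bs (suc n) (s≤s z≤n) (λ (p , _) (q , _) → ch (proj₁ p) (proj₁ q))
               (avoid-≤ (As ++ F ∷ Bs) (b ⊔ b′) H∈ (tree-avoid (As ++ F ∷ Bs) H (map (H ∘ π₁) ss) H∈ (λ _ _ p → p) (large _)))
      ...   | zs , sub , t , ch″ = zs , (λ p → proj₁ (proj₁ (proj₁ (sub p))) , ≤-trans (s≤s (m≤m⊔n b b′)) (proj₂ (proj₁ (sub p)))) ,
                tree-anti (insert As (F ∷ Bs)) (n≤1+n n) t , both
        where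
          apart : ∀ {z z′} → z ∈ ss → z′ ∈ zs → ∀ {G} → G ∈ insert As (F ∷ Bs) → G z ≢ G z′
          apart {z} {z′} p q r e = go (∈-++⁻ (lift₁ As) r) e
            where
              same-H : ∀ {K} → K ∈ As ++ F ∷ Bs → K (π₁ z) ≢ K (π₁ z′)
              same-H k e = proj₂ (proj₁ (proj₁ (sub q))) (subst (_∈ map (H ∘ π₁) ss)
                (coarse (ch (ss-X p) (proj₁ (proj₁ (proj₁ (sub q))))) k e) (∈-map⁺ (H ∘ π₁) p))
              go : ∀ {G} → G ∈ lift₁ As ⊎ G ∈ (ι ∘ π₂) ∷ lift₁ (F ∷ Bs) → G z ≢ G z′
              go (inj₁ s) e with ∈-map⁻ (_∘ π₁) s
              ... | K , u , refl = same-H (∈-++⁺ˡ u) e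
              go (inj₂ (there s)) e with ∈-map⁻ (_∘ π₁) s
              ... | K , u , refl = same-H (∈-++⁺ʳ As u) e
              go (inj₂ (here refl)) e = <-irrefl (ι-injective e)
                (≤-trans (≤-trans (bound-π₂ (∈-map⁺ π₂ p)) (≤-trans (m≤n⊔m b b′) (n≤1+n _))) (proj₂ (proj₂ (sub q))))
          both : Chain (insert As (F ∷ Bs)) (_∈ ss ++ zs)
          both p q with ∈-++⁻ ss p | ∈-++⁻ ss q
          ... | inj₁ r | inj₁ s = ch′ r s
          ... | inj₁ r | inj₂ s = chain-vacuous (apart r s)
          ... | inj₂ r | inj₁ s = chain-sym (chain-vacuous (apart s r))
          ... | inj₂ r | inj₂ s = ch″ r s

module Construction (dec : (P : Set) → Dec P) (M : Structure) (pa : IsPA M)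
                    (e : ℕ → Carrier M) (e-surjective : ∀ x → Σ ℕ λ n → e n ≡ x) where

  -- Definability in M

  open IsPA pa

  C : Set
  C = Carrier M

  open Trees dec C
  open Thinning dec C

  num : ℕ → C
  num = numeral M

  -- Every element of M occurs in e, so formulas evaluated with e at the odd variables are formulas with parameters.
  record Def {A : Set} (val : A → C) (P : Env A → Set) : Set where
    constructor _,_
    field
      defining : Formula
      defines : ∀ ρ → P ρ ⟷ Sat M defining (mix (λ i → val (ρ i)) e)

  record DefFun {A : Set} (val : A → C) (f : Env A → A) : Set where
    constructor fun
    field
      graph : Def val (λ ρ → ρ 0 ≡ f (tl ρ))

  open DefFun public

  Sat-mix : ∀ φ {ρ ρ′ : Env C} → (∀ i → ρ i ≡ ρ′ i) → Sat M φ (mix ρ e) ⟷ Sat M φ (mix ρ′ e)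
  Sat-mix φ {ρ} {ρ′} h = Sat-ext M φ (mix-map (λ x → x) ρ e ρ′ e h (λ _ → refl))

  module _ {A : Set} {val : A → C} where

    infixr 7 _∧ᵈ_
    infixr 6 _∨ᵈ_
    infixr 5 _⇒ᵈ_
    infix 8 ¬ᵈ_

    def-ext : {P : Env A → Set} → Def val P → ∀ {ρ ρ′} → (∀ i → ρ i ≡ ρ′ i) → P ρ → P ρ′
    def-ext (φ , h) p x = proj₂ (h _) (proj₁ (Sat-mix φ (λ i → cong val (p i))) (proj₁ (h _) x))

    def-iff : {P Q : Env A → Set} → (∀ ρ → P ρ ⟷ Q ρ) → Def val P → Def val Q
    def-iff h (φ , k) = φ , λ ρ → ⟷-trans (⟷-sym (h ρ)) (k ρ)

    _∧ᵈ_ : {P Q : Env A → Set} → Def val P → Def val Q → Def val (λ ρ → P ρ × Q ρ)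
    (φ , h) ∧ᵈ (ψ , k) = (φ ∧f ψ) , λ ρ → ×-cong (h ρ) (k ρ)

    _∨ᵈ_ : {P Q : Env A → Set} → Def val P → Def val Q → Def val (λ ρ → P ρ ⊎ Q ρ)
    (φ , h) ∨ᵈ (ψ , k) = (φ ∨f ψ) , λ ρ → ⊎-cong (h ρ) (k ρ)

    _⇒ᵈ_ : {P Q : Env A → Set} → Def val P → Def val Q → Def val (λ ρ → P ρ → Q ρ)
    (φ , h) ⇒ᵈ (ψ , k) = (φ ⇒f ψ) , λ ρ → →-cong (h ρ) (k ρ)

    ¬ᵈ_ : {P : Env A → Set} → Def val P → Def val (λ ρ → ¬ P ρ)
    ¬ᵈ (φ , h) = (¬f φ) , λ ρ → ¬-cong (h ρ)

    ⊥ᵈ : Def val (λ _ → ⊥)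
    ⊥ᵈ = ff , λ ρ → ⟷-refl

    def-ren : {P : Env A → Set} (σ : ℕ → ℕ) → Def val P → Def val (λ ρ → P (λ i → ρ (σ i)))
    def-ren {P} σ (φ , h) = ren (mix (λ i → ev (σ i)) od) φ , λ ρ →
      ⟷-trans (h _) (⟷-sym (Sat-ren M (mix (λ i → ev (σ i)) od) φ (mix (λ i → val (ρ i)) e) _ λ i _ →
        mix-map (mix (λ i → val (ρ i)) e) (λ i → ev (σ i)) od (λ i → val (ρ (σ i))) e
          (λ i → mix-ev (λ i → val (ρ i)) e (σ i)) (mix-od (λ i → val (ρ i)) e) i))

  opaque
    fun-ren : {A : Set} {val : A → C} {f : Env A → A} (σ : ℕ → ℕ) → DefFun val f → DefFun val (λ ρ → f (λ i → ρ (σ i)))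
    fun-ren σ (fun d) = fun (def-ren (lft σ) d)

  -- Instantiated for M itself (val the identity) and for ω (val = num).
  module Substitution {A : Set} (val : A → C)
    (sub : ∀ {P : Env A → Set} {f : Env A → A} → Def val P → DefFun val f → Def val (λ ρ → P (f ρ ∷ₑ ρ)))
    (var-def : ∀ i → DefFun val (λ ρ → ρ i)) where

    app₁ : ∀ (P : A → Set) {f} → Def val (λ ρ → P (ρ 0)) → DefFun val f → Def val (λ ρ → P (f ρ))
    app₁ P p f = sub {P = λ ρ → P (ρ 0)} p f

    app₂ : ∀ (R : A → A → Set) {f g} → Def val (λ ρ → R (ρ 0) (ρ 1)) → DefFun val f → DefFun val g → Def val (λ ρ → R (f ρ) (g ρ))
    app₂ R {f} {g} r df dg = sub {P = λ ρ → R (f (tl ρ)) (ρ 0)} (sub {P = λ ρ → R (ρ 0) (ρ 1)} r (fun-ren suc df)) dg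

    app₃ : ∀ (R : A → A → A → Set) {f g h} → Def val (λ ρ → R (ρ 0) (ρ 1) (ρ 2)) → DefFun val f → DefFun val g → DefFun val h →
           Def val (λ ρ → R (f ρ) (g ρ) (h ρ))
    app₃ R {f} {g} {h} r df dg dh = sub {P = λ ρ → R (f (tl ρ)) (g (tl ρ)) (ρ 0)}
      (sub {P = λ ρ → R (f (tl (tl ρ))) (ρ 0) (ρ 1)} (sub {P = λ ρ → R (ρ 0) (ρ 1) (ρ 2)} r (fun-ren (λ i → suc (suc i)) df)) (fun-ren suc dg)) dh

    fun₁ : ∀ (F : A → A) {f} → DefFun val (λ ρ → F (ρ 0)) → DefFun val f → DefFun val (λ ρ → F (f ρ))
    fun₁ F (fun dF) df = fun (app₂ (λ a b → a ≡ F b) dF (var-def 0) (fun-ren suc df))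

    fun₂ : ∀ (F : A → A → A) {f g} → DefFun val (λ ρ → F (ρ 0) (ρ 1)) → DefFun val f → DefFun val g → DefFun val (λ ρ → F (f ρ) (g ρ))
    fun₂ F (fun dF) df dg = fun (app₃ (λ a b c → a ≡ F b c) dF (var-def 0) (fun-ren suc df) (fun-ren suc dg))

  Dfn : (Env C → Set) → Set
  Dfn = Def (λ x → x)

  -- A quantifier adds its variable in front of the interleaved environment, whereas definability
  -- wants it in front of the arguments before interleaving. This renaming passes from one to the
  -- other.
  up : Formula → Formula
  up = ren (mix (0 ∷ₑ (λ i → suc (ev i))) (λ i → suc (od i)))

  Sat-up : ∀ φ a (ρ : Env C) → Sat M (up φ) (a ∷ₑ mix ρ e) ⟷ Sat M φ (mix (a ∷ₑ ρ) e)
  Sat-up φ a ρ = Sat-ren M _ φ _ _ λ i _ → mix-map (a ∷ₑ mix ρ e) _ _ (a ∷ₑ ρ) e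
    (λ { zero → refl ; (suc i) → mix-ev ρ e i }) (mix-od ρ e) i

  opaque
    ∃ᵈ_ : {P : Env C → Set} → Dfn P → Dfn (λ ρ → Σ C λ a → P (a ∷ₑ ρ))
    ∃ᵈ (φ , h) = (∃f up φ) , λ ρ → Σ-cong λ a → ⟷-trans (h (a ∷ₑ ρ)) (⟷-sym (Sat-up φ a ρ))

    ∀ᵈ_ : {P : Env C → Set} → Dfn P → Dfn (λ ρ → ∀ a → P (a ∷ₑ ρ))
    ∀ᵈ (φ , h) = (∀f up φ) , λ ρ → Π-cong λ a → ⟷-trans (h (a ∷ₑ ρ)) (⟷-sym (Sat-up φ a ρ))

  infix 4 ∃ᵈ_ ∀ᵈ_

  DFun : (Env C → C) → Set
  DFun = DefFun (λ x → x)

  opaque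
    sub-M : ∀ {P : Env C → Set} {f : Env C → C} → Dfn P → DFun f → Dfn (λ ρ → P (f ρ ∷ₑ ρ))
    sub-M p (fun f) = def-iff (λ ρ → (λ { (_ , refl , q) → q }) , (λ q → _ , refl , q)) (∃ᵈ f ∧ᵈ p)

    var-M : ∀ i → DFun (λ ρ → ρ i)
    var-M i = fun ((var 0 ≐ var (ev (suc i))) , λ ρ → ≡-cong refl (sym (mix-ev ρ e (suc i))))

    const-M : ∀ a → DFun (λ _ → a)
    const-M a with e-surjective a
    ... | n , refl = fun ((var 0 ≐ var (od n)) , λ ρ → ≡-cong refl (sym (mix-od ρ e n)))

  module M = Substitution (λ x → x) sub-M var-M

  opaque
    _+ᵈ_ : ∀ {f g} → DFun f → DFun g → DFun (λ ρ → add M (f ρ) (g ρ))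
    df +ᵈ dg = M.fun₂ (add M) (fun ((var 0 ≐ (var 2 ⊕ var 4)) , λ ρ → ⟷-refl)) df dg

    _*ᵈ_ : ∀ {f g} → DFun f → DFun g → DFun (λ ρ → mul M (f ρ) (g ρ))
    df *ᵈ dg = M.fun₂ (mul M) (fun ((var 0 ≐ (var 2 ⊗ var 4)) , λ ρ → ⟷-refl)) df dg

    _≡ᵈ_ : ∀ {f g} → DFun f → DFun g → Dfn (λ ρ → f ρ ≡ g ρ)
    df ≡ᵈ dg = M.app₂ _≡_ ((var 0 ≐ var 2) , λ ρ → ⟷-refl) df dg

    _<ᵈ_ : ∀ {f g} → DFun f → DFun g → Dfn (λ ρ → lt M (f ρ) (g ρ))
    df <ᵈ dg = M.app₂ (lt M) ((var 0 ≺ var 2) , λ ρ → ⟷-refl) df dg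

  infixl 9 _+ᵈ_ _*ᵈ_
  infix 8 _≡ᵈ_ _<ᵈ_

  -- Order and numerals in a model of PA

  infix 10 _⁺
  _⁺ : C → C
  x ⁺ = add M x (one M)

  induct : (P : C → Set) → Dfn (λ ρ → P (ρ 0)) → P (zer M) → (∀ x → P x → P (x ⁺)) → ∀ x → P x
  induct P (φ , h) z s x = from (induction (up φ) (mix (λ _ → zer M) e) (to z) (λ y p → to (s y (from p))) x)
    where
      to : ∀ {y} → P y → Sat M (up φ) (y ∷ₑ mix (λ _ → zer M) e)
      to {y} p = proj₂ (Sat-up φ y _) (proj₁ (h (y ∷ₑ (λ _ → zer M))) p)
      from : ∀ {y} → Sat M (up φ) (y ∷ₑ mix (λ _ → zer M) e) → P y
      from {y} p = proj₂ (h (y ∷ₑ (λ _ → zer M))) (proj₁ (Sat-up φ y _) p)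

  zero-add : ∀ x → add M (zer M) x ≡ x
  zero-add = induct _ (const-M (zer M) +ᵈ var-M 0 ≡ᵈ var-M 0) (add-zero _) λ x p → trans (add-succ _ x) (cong _⁺ p)

  succ-add : ∀ x y → add M (x ⁺) y ≡ add M x y ⁺
  succ-add x = induct _ (const-M (x ⁺) +ᵈ var-M 0 ≡ᵈ (const-M x +ᵈ var-M 0) +ᵈ const-M (one M))
    (trans (add-zero _) (cong _⁺ (sym (add-zero x))))
    λ y p → trans (add-succ _ y) (cong _⁺ (trans p (sym (add-succ x y))))

  lt-zero : ∀ x → ¬ lt M x (zer M)
  lt-zero x p with proj₁ (lt-def x _) p
  ... | z , q = succ-nonzero _ (trans (sym (add-succ x z)) q)

  lt-succ : ∀ x y → lt M x (y ⁺) → lt M x y ⊎ x ≡ y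
  lt-succ x y p with proj₁ (lt-def x _) p
  ... | z , q with dec (z ≡ zer M)
  ...   | yes refl = inj₂ (trans (sym (add-zero x)) (succ-inj _ _ (trans (sym (add-succ x _)) q)))
  ...   | no z≢0 with pred-exists z z≢0
  ...     | w , refl = inj₁ (proj₂ (lt-def x y) (w , succ-inj _ _ (trans (sym (add-succ x _)) q)))

  lt-self-succ : ∀ x → lt M x (x ⁺)
  lt-self-succ x = proj₂ (lt-def x _) (zer M , trans (add-succ x _) (cong _⁺ (add-zero x)))

  lt-succ-step : ∀ {x y} → lt M x y → lt M x (y ⁺)
  lt-succ-step {x} {y} p with proj₁ (lt-def x y) p
  ... | z , refl = proj₂ (lt-def x _) (z ⁺ , add-succ x (z ⁺))

  trichotomy : ∀ x y → lt M x y ⊎ x ≡ y ⊎ lt M y x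
  trichotomy x = induct _ (const-M x <ᵈ var-M 0 ∨ᵈ const-M x ≡ᵈ var-M 0 ∨ᵈ var-M 0 <ᵈ const-M x) base step
    where
      base : lt M x (zer M) ⊎ x ≡ zer M ⊎ lt M (zer M) x
      base with dec (x ≡ zer M)
      ... | yes p = inj₂ (inj₁ p)
      ... | no p with pred-exists x p
      ...   | w , refl = inj₂ (inj₂ (proj₂ (lt-def _ _) (w , zero-add (w ⁺))))
      step : ∀ y → lt M x y ⊎ x ≡ y ⊎ lt M y x → lt M x (y ⁺) ⊎ x ≡ y ⁺ ⊎ lt M (y ⁺) x
      step y (inj₁ p) = inj₁ (lt-succ-step p)
      step y (inj₂ (inj₁ refl)) = inj₁ (lt-self-succ y)
      step y (inj₂ (inj₂ p)) with proj₁ (lt-def y x) p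
      ... | z , refl with dec (z ≡ zer M)
      ...   | yes refl = inj₂ (inj₁ (trans (add-succ y _) (cong _⁺ (add-zero y))))
      ...   | no z≢0 with pred-exists z z≢0
      ...     | w , refl = inj₂ (inj₂ (proj₂ (lt-def _ _) (w , trans (succ-add y _) (sym (add-succ y _)))))

  num-+ : ∀ m n → num (m + n) ≡ add M (num m) (num n)
  num-+ m zero = trans (cong num (+-identityʳ m)) (sym (add-zero _))
  num-+ m (suc n) = trans (cong num (+-suc m n)) (trans (cong _⁺ (num-+ m n)) (sym (add-succ _ _)))

  num-* : ∀ m n → num (m * n) ≡ mul M (num m) (num n)
  num-* m zero = trans (cong num (*-zeroʳ m)) (sym (mul-zero _))
  num-* m (suc n) = trans (cong num (trans (*-suc m n) (+-comm m (m * n))))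
    (trans (num-+ (m * n) m) (trans (cong (λ x → add M x (num m)) (num-* m n)) (sym (mul-succ _ _))))

  num-injective : ∀ {m n} → num m ≡ num n → m ≡ n
  num-injective {zero} {zero} p = refl
  num-injective {zero} {suc n} p = ⊥-elim (succ-nonzero _ (sym p))
  num-injective {suc m} {zero} p = ⊥-elim (succ-nonzero _ p)
  num-injective {suc m} {suc n} p = cong suc (num-injective (succ-inj _ _ p))

  num-< : ∀ {m n} → m < n → lt M (num m) (num n)
  num-< {m} {suc n} (s≤s p) with m≤n⇒m<n∨m≡n p
  ... | inj₁ q = lt-succ-step (num-< q)
  ... | inj₂ refl = lt-self-succ _

  below-num : ∀ {x} n → lt M x (num n) → Σ ℕ λ m → m < n × x ≡ num m
  below-num zero p = ⊥-elim (lt-zero _ p)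
  below-num (suc n) p with lt-succ _ _ p
  ... | inj₂ q = n , ≤-refl , q
  ... | inj₁ q with below-num n q
  ...   | m , r , s = m , m≤n⇒m≤1+n r , s

  num-<⁻ : ∀ {m n} → lt M (num m) (num n) → m < n
  num-<⁻ {m} {n} p with below-num n p
  ... | k , q , r with refl ← num-injective {m} {k} r = q

  -- Least solutions and definable choice

  Least : (C → Set) → C → Set
  Least P a = P a × (∀ z → lt M z a → ¬ P z)

  least-unique : ∀ {P a b} → Least P a → Least P b → a ≡ b
  least-unique {P} {a} {b} (p , q) (r , s) with trichotomy a b
  ... | inj₁ l = ⊥-elim (s a l p)
  ... | inj₂ (inj₁ eq) = eq
  ... | inj₂ (inj₂ l) = ⊥-elim (q b l r)

  opaque
    least-def : ∀ {P : Env C → Set} → Dfn P → Dfn (λ ρ → Least (λ a → P (a ∷ₑ tl ρ)) (ρ 0))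
    least-def {P} d = def-iff (λ ρ → ×-cong (def-ext d (η ρ) , def-ext d (λ i → sym (η ρ i))) ⟷-refl)
      (d ∧ᵈ (∀ᵈ var-M 0 <ᵈ var-M 1 ⇒ᵈ ¬ᵈ shifted))
      where
        η : ∀ (ρ : Env C) i → ρ i ≡ (ρ 0 ∷ₑ tl ρ) i
        η ρ zero = refl
        η ρ (suc i) = refl
        shift : ℕ → ℕ
        shift = 0 ∷ₑ (λ i → suc (suc i))
        reindex : ∀ (ρ : Env C) i → ρ (shift i) ≡ (ρ 0 ∷ₑ tl (tl ρ)) i
        reindex ρ zero = refl
        reindex ρ (suc i) = refl
        shifted : Dfn (λ ρ → P (ρ 0 ∷ₑ tl (tl ρ)))
        shifted = def-iff (λ ρ → def-ext d (reindex ρ) , def-ext d (λ i → sym (reindex ρ i))) (def-ren shift d)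

  opaque
    -- The junk value of μ on a predicate without least element is zero.
    μ : (C → Set) → C
    μ P with dec (Σ C (Least P))
    ... | yes (a , _) = a
    ... | no _ = zer M

    μ-least : ∀ {P a} → Least P a → μ P ≡ a
    μ-least {P} {a} l with dec (Σ C (Least P))
    ... | yes (b , l′) = least-unique l′ l
    ... | no n = ⊥-elim (n (a , l))

    μ-default : ∀ {P} → ¬ Σ C (Least P) → μ P ≡ zer M
    μ-default {P} n with dec (Σ C (Least P))
    ... | yes l = ⊥-elim (n l)
    ... | no _ = refl

    μ-def : ∀ {P : Env C → Set} → Dfn P → DFun (λ ρ → μ (λ a → P (a ∷ₑ ρ)))
    μ-def {P} d = fun (def-iff (λ ρ → to ρ , from ρ)
      (least-def d ∨ᵈ (¬ᵈ (∃ᵈ least-shifted)) ∧ᵈ var-M 0 ≡ᵈ const-M (zer M)))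
      where
        least-shifted : Dfn (λ ρ → Least (λ a → P (a ∷ₑ tl (tl ρ))) (ρ 0))
        least-shifted = def-ren (0 ∷ₑ (λ i → suc (suc i))) (least-def d)
        to : ∀ ρ → Least (λ a → P (a ∷ₑ tl ρ)) (ρ 0) ⊎ (¬ (Σ C λ a → Least (λ a → P (a ∷ₑ tl ρ)) a)) × ρ 0 ≡ zer M →
             ρ 0 ≡ μ (λ a → P (a ∷ₑ tl ρ))
        to ρ (inj₁ l) = sym (μ-least l)
        to ρ (inj₂ (n , p)) with dec (Σ C (Least (λ a → P (a ∷ₑ tl ρ))))
        ... | yes l = ⊥-elim (n l)
        ... | no _ = p
        from : ∀ ρ → ρ 0 ≡ μ (λ a → P (a ∷ₑ tl ρ)) →
               Least (λ a → P (a ∷ₑ tl ρ)) (ρ 0) ⊎ (¬ (Σ C λ a → Least (λ a → P (a ∷ₑ tl ρ)) a)) × ρ 0 ≡ zer M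
        from ρ p with dec (Σ C (Least (λ a → P (a ∷ₑ tl ρ))))
        ... | yes (a , l) = inj₁ (subst (Least _) (sym p) l)
        ... | no n = inj₂ (n , p)

  -- Induction shows that no solution lies below `x`. The formula is written out because `P` may
  -- depend on the whole environment `ρ`, while `induct` speaks of predicates of one variable.
  least-exists : ∀ {P : Env C → Set} → Dfn P → ∀ ρ → (Σ C λ a → P (a ∷ₑ ρ)) → Σ C (Least (λ a → P (a ∷ₑ ρ)))
  least-exists {P} d@(φ , h) ρ (a , p) with dec (Σ C (Least (λ a → P (a ∷ₑ ρ))))
  ... | yes l = l
  ... | no none = ⊥-elim (below (a ⁺) a (lt-self-succ a) p)
    where
      Q : C → Set
      Q x = ∀ z → lt M z x → ¬ P (z ∷ₑ ρ)
      ψ = ∀f ((var 0 ≺ var 1) ⇒f (¬f ren (lft suc) (up φ)))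
      ψ-sat : ∀ x → Q x ⟷ Sat M ψ (x ∷ₑ mix ρ e)
      ψ-sat x = Π-cong λ z → →-cong ⟷-refl (¬-cong (⟷-trans (h (z ∷ₑ ρ)) (⟷-trans (⟷-sym (Sat-up φ z ρ))
        (⟷-sym (Sat-ren M (lft suc) (up φ) (z ∷ₑ (x ∷ₑ mix ρ e)) (z ∷ₑ mix ρ e) λ { zero _ → refl ; (suc i) _ → refl })))))
      below : ∀ x → Q x
      below x = proj₂ (ψ-sat x) (induction ψ (mix ρ e) (proj₁ (ψ-sat _) λ z q _ → lt-zero z q) (λ y q → proj₁ (ψ-sat _) (step y (proj₂ (ψ-sat y) q))) x)
        where
          step : ∀ y → Q y → Q (y ⁺)
          step y q z r with lt-succ z y r
          ... | inj₁ s = q z s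
          ... | inj₂ refl = λ pz → none (y , pz , q)

  μ-satisfies : ∀ {P : Env C → Set} → Dfn P → ∀ ρ → (Σ C λ a → P (a ∷ₑ ρ)) → P (μ (λ a → P (a ∷ₑ ρ)) ∷ₑ ρ)
  μ-satisfies {P} d ρ p with least-exists d ρ p
  ... | a , l = subst (λ b → P (b ∷ₑ ρ)) (sym (μ-least l)) (proj₁ l)

  term-def : ∀ t {G : ℕ → Env C → C} → (∀ i → DFun (G i)) → DFun (λ ρ → eval M t (λ i → G i ρ))
  term-def (var i) d = d i
  term-def t0 d = const-M (zer M)
  term-def t1 d = const-M (one M)
  term-def (t ⊕ s) d = term-def t d +ᵈ term-def s d
  term-def (t ⊗ s) d = term-def t d *ᵈ term-def s d

  opaque
    Sat-def : ∀ φ {G : ℕ → Env C → C} → (∀ i → DFun (G i)) → Dfn (λ ρ → Sat M φ (λ i → G i ρ))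
    Sat-def-binder : ∀ φ {G : ℕ → Env C → C} → (∀ i → DFun (G i)) → Dfn (λ ρ → Sat M φ (ρ 0 ∷ₑ (λ i → G i (tl ρ))))
    Sat-def-binder φ {G} d = def-iff (λ ρ → Sat-ext M φ λ { zero → refl ; (suc i) → refl }) (Sat-def φ d′)
      where
        G′ : ℕ → Env C → C
        G′ zero ρ = ρ 0
        G′ (suc i) ρ = G i (tl ρ)
        d′ : ∀ i → DFun (G′ i)
        d′ zero = var-M 0
        d′ (suc i) = fun-ren suc (d i)
    Sat-def (t ≐ s) d = term-def t d ≡ᵈ term-def s d
    Sat-def (t ≺ s) d = term-def t d <ᵈ term-def s d
    Sat-def ff d = ⊥ᵈ
    Sat-def (¬f φ) d = ¬ᵈ Sat-def φ d
    Sat-def (φ ∧f ψ) d = Sat-def φ d ∧ᵈ Sat-def ψ d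
    Sat-def (φ ∨f ψ) d = Sat-def φ d ∨ᵈ Sat-def ψ d
    Sat-def (φ ⇒f ψ) d = Sat-def φ d ⇒ᵈ Sat-def ψ d
    Sat-def (∀f φ) d = ∀ᵈ Sat-def-binder φ d
    Sat-def (∃f φ) d = ∃ᵈ Sat-def-binder φ d

  -- Internal relations on ω

  LeastNat : (ℕ → Set) → ℕ → Set
  LeastNat P n = P n × (∀ m → m < n → ¬ P m)

  opaque
    least-nat : (P : ℕ → Set) → Σ ℕ P → Σ ℕ (LeastNat P)
    least-nat P (n , p) = <-rec (λ n → P n → Σ ℕ (LeastNat P)) step n p
      where
        step : ∀ n → (∀ {m} → m < n → P m → Σ ℕ (LeastNat P)) → P n → Σ ℕ (LeastNat P)
        step n ih p with dec (Σ ℕ λ m → m < n × P m)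
        ... | yes (m , q , r) = ih q r
        ... | no q = n , p , λ m r s → q (m , r , s)

    least-nat-unique : ∀ {P m n} → LeastNat P m → LeastNat P n → m ≡ n
    least-nat-unique {m = m} {n} (p , q) (r , s) with <-cmp m n
    ... | tri< l _ _ = ⊥-elim (s m l p)
    ... | tri≈ _ l _ = l
    ... | tri> _ _ l = ⊥-elim (q n l r)

  -- These are the traces on ω of the relations definable in `M` with parameters; for nonstandard
  -- `M` they make up its standard system.
  Int : (Env ℕ → Set) → Set
  Int = Def num

  IFun : (Env ℕ → ℕ) → Set
  IFun = DefFun num

  restrict : {P : Env C → Set} → Dfn P → Int (λ ρ → P (λ i → num (ρ i)))
  restrict (φ , h) = φ , λ ρ → h _

  hat : {P : Env ℕ → Set} → Int P → Env C → Set
  hat (φ , _) ρ = Sat M φ (mix ρ e)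

  hat-def : {P : Env ℕ → Set} (d : Int P) → Dfn (hat d)
  hat-def (φ , _) = φ , λ ρ → ⟷-refl

  hat-num : {P : Env ℕ → Set} (d : Int P) → ∀ y ρ → P (y ∷ₑ ρ) ⟷ hat d (num y ∷ₑ λ i → num (ρ i))
  hat-num (φ , h) y ρ = ⟷-trans (h (y ∷ₑ ρ)) (Sat-mix φ λ { zero → refl ; (suc i) → refl })

  -- A nonstandard element may satisfy the formula defining the graph of a function on ω, so the value is its least solution.
  hat-least : {f : Env ℕ → ℕ} (d : IFun f) → ∀ ρ → Least (λ a → hat (graph d) (a ∷ₑ λ i → num (ρ i))) (num (f ρ))
  hat-least {f} (fun d) ρ = proj₁ (hat-num d (f ρ) ρ) refl , λ z z<f p → below z<f p
    where
      below : ∀ {z} → lt M z (num (f ρ)) → ¬ hat d (z ∷ₑ λ i → num (ρ i))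
      below z<f p with below-num (f ρ) z<f
      ... | m , m<f , refl = <-irrefl (proj₂ (hat-num d m ρ) p) m<f

  opaque
    sub-I : ∀ {P : Env ℕ → Set} {f : Env ℕ → ℕ} → Int P → IFun f → Int (λ ρ → P (f ρ ∷ₑ ρ))
    sub-I {P} {f} p f′ = def-iff (λ ρ → to ρ , from ρ) (restrict (∃ᵈ least-def (hat-def (graph f′)) ∧ᵈ hat-def p))
      where
        to : ∀ ρ → (Σ C λ y → Least (λ a → hat (graph f′) (a ∷ₑ λ i → num (ρ i))) y × hat p (y ∷ₑ λ i → num (ρ i))) → P (f ρ ∷ₑ ρ)
        to ρ (y , l , q) with refl ← least-unique l (hat-least f′ ρ) = proj₂ (hat-num p (f ρ) ρ) q
        from : ∀ ρ → P (f ρ ∷ₑ ρ) → Σ C λ y → Least (λ a → hat (graph f′) (a ∷ₑ λ i → num (ρ i))) y × hat p (y ∷ₑ λ i → num (ρ i))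
        from ρ q = num (f ρ) , hat-least f′ ρ , proj₁ (hat-num p (f ρ) ρ) q

  num-≡ : ∀ {m n} → (num m ≡ num n) ⟷ (m ≡ n)
  num-≡ = num-injective , cong num

  opaque
    var-I : ∀ i → IFun (λ ρ → ρ i)
    var-I i = fun (def-iff (λ ρ → num-≡) (restrict (graph (var-M i))))

  module I = Substitution num sub-I var-I

  opaque
    const-I : ∀ n → IFun (λ _ → n)
    const-I n = fun (def-iff (λ ρ → num-≡) (restrict (graph (const-M (num n)))))

  infixl 9 _+ⁱ_
  infixl 10 _*ⁱ_
  infix 8 _≡ⁱ_ _<ⁱ_ _∣ⁱ_ _εⁱ_

  opaque
    _+ⁱ_ : ∀ {f g} → IFun f → IFun g → IFun (λ ρ → f ρ + g ρ)
    df +ⁱ dg = I.fun₂ _+_ (fun (def-iff (λ ρ → ⟷-trans (≡-cong refl (sym (num-+ (ρ 1) (ρ 2)))) num-≡)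
      (restrict (graph (var-M 0 +ᵈ var-M 1))))) df dg

  opaque
    _*ⁱ_ : ∀ {f g} → IFun f → IFun g → IFun (λ ρ → f ρ * g ρ)
    df *ⁱ dg = I.fun₂ _*_ (fun (def-iff (λ ρ → ⟷-trans (≡-cong refl (sym (num-* (ρ 1) (ρ 2)))) num-≡)
      (restrict (graph (var-M 0 *ᵈ var-M 1))))) df dg

  opaque
    _≡ⁱ_ : ∀ {f g} → IFun f → IFun g → Int (λ ρ → f ρ ≡ g ρ)
    df ≡ⁱ dg = I.app₂ _≡_ (def-iff (λ ρ → num-≡) (restrict (var-M 0 ≡ᵈ var-M 1))) df dg

  opaque
    _<ⁱ_ : ∀ {f g} → IFun f → IFun g → Int (λ ρ → f ρ < g ρ)
    df <ⁱ dg = I.app₂ _<_ (def-iff (λ ρ → num-<⁻ , num-<) (restrict (var-M 0 <ᵈ var-M 1))) df dg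

  opaque
    suc-I : ∀ {f} → IFun f → IFun (λ ρ → suc (f ρ))
    suc-I df = const-I 1 +ⁱ df

  shift-hat : {P : Env ℕ → Set} (d : Int P) → Dfn (λ ρ → hat d (ρ 0 ∷ₑ tl (tl ρ)))
  shift-hat d = def-iff (λ ρ → Sat-mix (Def.defining d) λ { zero → refl ; (suc i) → refl }) (def-ren (0 ∷ₑ (λ i → suc (suc i))) (hat-def d))

  opaque
    -- ω need not be definable in `M`, but every element below a numeral is a numeral, so a
    -- quantifier of `M` with a numeral as bound ranges over standard numbers only.
    ∀< : ∀ {P : Env ℕ → Set} {b} → IFun b → Int P → Int (λ ρ → ∀ y → y < b ρ → P (y ∷ₑ ρ))
    ∀< {P} {b} db d = sub-I {P = λ ρ → ∀ y → y < ρ 0 → P (y ∷ₑ tl ρ)}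
      (def-iff (λ ρ → (λ h y p → proj₂ (hat-num d y (tl ρ)) (h (num y) (num-< p))) , from ρ)
        (restrict (∀ᵈ var-M 0 <ᵈ var-M 1 ⇒ᵈ shift-hat d))) db
      where
        from : ∀ ρ → (∀ y → y < ρ 0 → P (y ∷ₑ tl ρ)) → ∀ a → lt M a (num (ρ 0)) → hat d (a ∷ₑ λ i → num (tl ρ i))
        from ρ h a p with below-num (ρ 0) p
        ... | m , q , refl = proj₁ (hat-num d m (tl ρ)) (h m q)

  opaque
    ∃< : ∀ {P : Env ℕ → Set} {b} → IFun b → Int P → Int (λ ρ → Σ ℕ λ y → y < b ρ × P (y ∷ₑ ρ))
    ∃< {P} {b} db d = sub-I {P = λ ρ → Σ ℕ λ y → y < ρ 0 × P (y ∷ₑ tl ρ)}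
      (def-iff (λ ρ → to ρ , (λ (y , p , q) → num y , num-< p , proj₁ (hat-num d y (tl ρ)) q))
        (restrict (∃ᵈ var-M 0 <ᵈ var-M 1 ∧ᵈ shift-hat d))) db
      where
        to : ∀ ρ → (Σ C λ a → lt M a (num (ρ 0)) × hat d (a ∷ₑ λ i → num (tl ρ i))) → Σ ℕ λ y → y < ρ 0 × P (y ∷ₑ tl ρ)
        to ρ (a , p , q) with below-num (ρ 0) p
        ... | m , r , refl = m , r , proj₂ (hat-num d m (tl ρ)) q

  opaque
    -- Minimality needs only a quantifier bounded by the value itself. Hence even an unbounded
    -- search is internal if it always succeeds.
    least-I : ∀ {R : Env ℕ → Set} {f} → Int R → (∀ ρ → LeastNat (λ y → R (y ∷ₑ ρ)) (f ρ)) → IFun f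
    least-I {R} {f} d h = fun (def-iff (λ ρ → (λ l → least-nat-unique l (h (tl ρ))) , (λ { p → subst (LeastNat _) (sym p) (h (tl ρ)) }))
      (def-iff (λ ρ → def-ext d (η ρ) , def-ext d (λ i → sym (η ρ i))) d ∧ᵈ ∀< (var-I 0) (¬ᵈ shifted)))
      where
        η : ∀ (ρ : Env ℕ) i → ρ i ≡ (ρ 0 ∷ₑ tl ρ) i
        η ρ zero = refl
        η ρ (suc i) = refl
        reindex : ∀ (ρ : Env ℕ) i → ρ ((0 ∷ₑ (λ i → suc (suc i))) i) ≡ (ρ 0 ∷ₑ tl (tl ρ)) i
        reindex ρ zero = refl
        reindex ρ (suc i) = refl
        shifted : Int (λ ρ → R (ρ 0 ∷ₑ tl (tl ρ)))
        shifted = def-iff (λ ρ → def-ext d (reindex ρ) , def-ext d (λ i → sym (reindex ρ i))) (def-ren (0 ∷ₑ (λ i → suc (suc i))) d)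

  opaque
    _∣ⁱ_ : ∀ {f g} → IFun f → IFun g → Int (λ ρ → f ρ ∣ g ρ)
    _∣ⁱ_ = I.app₂ _∣_ (def-iff (λ ρ → (λ (q , _ , p) → divides q p) , from (ρ 0) (ρ 1))
      (∃< (suc-I (var-I 1)) (var-I 2 ≡ⁱ var-I 0 *ⁱ var-I 1)))
      where
        from : ∀ m n → m ∣ n → Σ ℕ λ q → q < suc n × n ≡ q * m
        from m zero _ = 0 , s≤s z≤n , refl
        from zero n (divides q p) = 0 , s≤s z≤n , trans p (*-zeroʳ q)
        from (suc m) n (divides q p) = q , s≤s (≤-trans (m≤m*n q (suc m)) (≤-reflexive (sym p))) , p

  double-injective : ∀ {m n} → m + m ≡ n + n → m ≡ n
  double-injective {m} {n} p with <-cmp m n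
  ... | tri< q _ _ = ⊥-elim (<-irrefl p (+-mono-< q q))
  ... | tri≈ _ q _ = q
  ... | tri> _ _ q = ⊥-elim (<-irrefl (sym p) (+-mono-< q q))

  opaque
    pair-I : ∀ {f g} → IFun f → IFun g → IFun (λ ρ → pair (f ρ) (g ρ))
    pair-I = I.fun₂ pair (fun (def-iff
      (λ ρ → (λ p → double-injective (trans p (sym (double-pair (ρ 1) (ρ 2))))) , (λ p → trans (cong₂ _+_ p p) (double-pair (ρ 1) (ρ 2))))
      (var-I 0 +ⁱ var-I 0 ≡ⁱ (var-I 1 +ⁱ var-I 2) *ⁱ suc-I (var-I 1 +ⁱ var-I 2) +ⁱ (var-I 2 +ⁱ var-I 2))))

  opaque
    π₁-I : ∀ {f} → IFun f → IFun (λ ρ → π₁ (f ρ))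
    π₁-I = I.fun₁ π₁ (fun (def-iff
      (λ ρ → (λ (y , _ , p) → sym (trans (cong π₁ p) (π₁-pair (ρ 0) y))) ,
             (λ p → π₂ (ρ 1) , s≤s (π₂≤ (ρ 1)) , trans (sym (pair-π (ρ 1))) (cong (λ x → pair x (π₂ (ρ 1))) (sym p))))
      (∃< (suc-I (var-I 1)) (var-I 2 ≡ⁱ pair-I (var-I 1) (var-I 0)))))

  opaque
    π₂-I : ∀ {f} → IFun f → IFun (λ ρ → π₂ (f ρ))
    π₂-I = I.fun₁ π₂ (fun (def-iff
      (λ ρ → (λ (x , _ , p) → sym (trans (cong π₂ p) (π₂-pair x (ρ 0)))) ,
             (λ p → π₁ (ρ 1) , s≤s (π₁≤ (ρ 1)) , trans (sym (pair-π (ρ 1))) (cong (pair (π₁ (ρ 1))) (sym p))))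
      (∃< (suc-I (var-I 1)) (var-I 2 ≡ⁱ pair-I (var-I 0) (var-I 1)))))

  opaque
    _εⁱ_ : ∀ {f g} → IFun f → IFun g → Int (λ ρ → f ρ ε g ρ)
    _εⁱ_ = I.app₂ _ε_ (def-iff (λ ρ → (λ (p , q) → p , q) , λ (p , q) → p , q) (var-I 0 <ⁱ π₁-I (var-I 1) ∧ᵈ
      (suc-I (suc-I (var-I 0) *ⁱ π₂-I (π₂-I (var-I 1))) ∣ⁱ π₁-I (π₂-I (var-I 1)))))

  -- The run up to n is coded by a finite set of pairs, the least code of which is a function of n.
  primrec : (Env ℕ → ℕ) → (Env ℕ → ℕ) → ℕ → Env ℕ → ℕ
  primrec g h zero ρ = g ρ
  primrec g h (suc n) ρ = h (n ∷ₑ (primrec g h n ρ ∷ₑ ρ))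

  module _ {g h : Env ℕ → ℕ} (dg : IFun g) (dh : IFun h) where

    private
      f = primrec g h

      Step : ℕ → ℕ → ℕ → Env ℕ → Set
      Step w i s ρ = (i ≡ 0 × s ≡ g ρ) ⊎ (Σ ℕ λ j → j < w × Σ ℕ λ s′ → s′ < w × i ≡ suc j × pair j s′ ε w × s ≡ h (j ∷ₑ (s′ ∷ₑ ρ)))

      -- Each entry must be justified by an entry one step earlier. Correctness follows by induction
      -- on `i`, without a demand that `w` be functional or that every index up to the last occur.
      Run : Env ℕ → Set
      Run ρ = (Σ ℕ λ y → y < ρ 0 × pair (ρ 1) y ε ρ 0) × (∀ i → i < ρ 0 → ∀ s → s < ρ 0 → pair i s ε ρ 0 → Step (ρ 0) i s (tl (tl ρ)))

      step-def : Int (λ ρ → ρ 2 ≡ h (ρ 1 ∷ₑ (ρ 0 ∷ₑ λ i → ρ (6 + i))))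
      step-def = def-iff (λ ρ → ≡-cong refl (ext λ { zero → refl ; (suc zero) → refl ; (suc (suc i)) → refl }))
        (var-I 2 ≡ⁱ fun-ren σ dh)
        where
          σ : ℕ → ℕ
          σ zero = 1
          σ (suc zero) = 0
          σ (suc (suc i)) = 6 + i
          ext : ∀ {ρ ρ′} → (∀ i → ρ i ≡ ρ′ i) → h ρ ≡ h ρ′
          ext {ρ} {ρ′} p = def-ext (graph dh) {h ρ ∷ₑ ρ} {h ρ ∷ₑ ρ′} (λ { zero → refl ; (suc i) → p i }) refl

      run-def : Int Run
      run-def = ∃< (var-I 0) (pair-I (var-I 2) (var-I 0) εⁱ var-I 1) ∧ᵈ
        ∀< (var-I 0) (∀< (var-I 1) (pair-I (var-I 1) (var-I 0) εⁱ var-I 2 ⇒ᵈ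
          (var-I 1 ≡ⁱ const-I 0 ∧ᵈ var-I 0 ≡ⁱ fun-ren (4 +_) dg) ∨ᵈ
          ∃< (var-I 2) (∃< (var-I 3) (var-I 3 ≡ⁱ suc-I (var-I 1) ∧ᵈ pair-I (var-I 1) (var-I 0) εⁱ var-I 4 ∧ᵈ step-def))))

      run-correct : ∀ {w n ρ} → Run (w ∷ₑ (n ∷ₑ ρ)) → ∀ i s → pair i s ε w → s ≡ f i ρ
      run-correct {w} (_ , r) i s p with r i (≤-<-trans (x≤pair i s) (ε⇒< w p)) s (≤-<-trans (y≤pair i s) (ε⇒< w p)) p
      ... | inj₁ (refl , q) = q
      run-correct {w} {n} {ρ} (y , r) (suc j) s p | inj₂ (j , _ , s′ , _ , refl , q , t) =
        trans t (cong (λ k → h (j ∷ₑ (k ∷ₑ ρ))) (run-correct {w} {n} {ρ} (y , r) j s′ q))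

      run-exists : ∀ n ρ → Σ ℕ λ w → Run (w ∷ₑ (n ∷ₑ ρ))
      run-exists n ρ with code-set (map (λ i → pair i (f i ρ)) (upTo (suc n)))
      ... | w , mem = w , (f n ρ , ≤-<-trans (y≤pair n _) (ε⇒< w last) , last) , λ i _ s _ p → step (∈-map⁻ _ (proj₁ (mem _) p))
        where
          at : ∀ i → i ≤ n → pair i (f i ρ) ε w
          at i p = proj₂ (mem _) (∈-map⁺ (λ i → pair i (f i ρ)) (∈-upTo⁺ (s≤s p)))
          last = at n ≤-refl
          step : ∀ {i s} → (Σ ℕ λ k → k ∈ upTo (suc n) × pair i s ≡ pair k (f k ρ)) → Step w i s ρ
          step {i} {s} (k , k∈ , p)
            with refl ← trans (sym (π₁-pair i s)) (trans (cong π₁ p) (π₁-pair k _))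
               | refl ← trans (sym (π₂-pair i s)) (trans (cong π₂ p) (π₂-pair k (f k ρ))) = go k k∈
            where
              go : ∀ k → k ∈ upTo (suc n) → Step w k (f k ρ) ρ
              go zero _ = inj₁ (refl , refl)
              go (suc j) q with ∈-upTo⁻ q
              ... | s≤s j<n = inj₂ (j , ≤-<-trans (x≤pair j _) (ε⇒< w prev) , f j ρ , ≤-<-trans (y≤pair j _) (ε⇒< w prev) , refl , prev , refl)
                where prev = at j (<⇒≤ j<n)

      least-run : ∀ ρ → Σ ℕ (LeastNat (λ w → Run (w ∷ₑ ρ)))
      least-run ρ = least-nat _ (let w , r = run-exists (ρ 0) (tl ρ) in w , r)

    opaque
     primrec-I : IFun (λ ρ → primrec g h (ρ 0) (tl ρ))
     primrec-I = fun (def-iff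
       (λ ρ → let w , r , _ = least-run (tl ρ) in
         (λ p → run-correct {w} {ρ 1} {tl (tl ρ)} r (ρ 1) (ρ 0) p) , λ p → from {ρ 1} {ρ 0} {tl (tl ρ)} w r p)
       (pair-I (var-I 1) (var-I 0) εⁱ fun-ren suc (least-I {f = λ ρ → proj₁ (least-run ρ)} run-def λ ρ → proj₂ (least-run ρ))))
       where
         from : ∀ {n y ρ} w → Run (w ∷ₑ (n ∷ₑ ρ)) → y ≡ f n ρ → pair n y ε w
         from {n} {y} {ρ} w r@((y′ , _ , p) , _) refl with refl ← run-correct {w} {n} {ρ} r n y′ p = p

  -- Internal trees and fusion

  -- The witnesses are listed downwards, each one bounding the next, and are therefore distinct.
  AtLeast : ℕ → (ℕ → Set) → ℕ → Set
  AtLeast zero P b = ⊤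
  AtLeast (suc n) P b = Σ ℕ λ y → y < b × P y × AtLeast n P y

  atLeast-mono : ∀ n {P b b′} → b ≤ b′ → AtLeast n P b → AtLeast n P b′
  atLeast-mono zero p _ = tt
  atLeast-mono (suc n) p (y , q , r) = y , ≤-trans q p , r

  module _ {P : Env ℕ → Set} (d : Int P) where

    private
      h : Env ℕ → ℕ
      h ρ with dec (P (ρ 0 ∷ₑ tl (tl ρ)))
      ... | yes _ = suc (ρ 1)
      ... | no _ = ρ 1

      shifted : Int (λ ρ → P (ρ 1 ∷ₑ λ i → ρ (3 + i)))
      shifted = def-iff (λ ρ → def-ext d (eq ρ) , def-ext d (λ i → sym (eq ρ i))) (def-ren (1 ∷ₑ (3 +_)) d)
        where
          eq : ∀ (ρ : Env ℕ) i → ρ ((1 ∷ₑ (3 +_)) i) ≡ (ρ 1 ∷ₑ λ i → ρ (3 + i)) i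
          eq ρ zero = refl
          eq ρ (suc i) = refl

      h-def : IFun h
      h-def = fun (def-iff (λ ρ → to ρ , from ρ)
        (shifted ∧ᵈ var-I 0 ≡ⁱ suc-I (var-I 2) ∨ᵈ (¬ᵈ shifted) ∧ᵈ var-I 0 ≡ⁱ var-I 2))
        where
          to : ∀ ρ → P (ρ 1 ∷ₑ λ i → ρ (3 + i)) × ρ 0 ≡ suc (ρ 2) ⊎ (¬ P (ρ 1 ∷ₑ λ i → ρ (3 + i))) × ρ 0 ≡ ρ 2 → ρ 0 ≡ h (tl ρ)
          to ρ p with dec (P (ρ 1 ∷ₑ λ i → ρ (3 + i)))
          to ρ (inj₁ (_ , p)) | yes _ = p
          to ρ (inj₂ (q , _)) | yes r = ⊥-elim (q r)
          to ρ (inj₁ (q , _)) | no r = ⊥-elim (r q)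
          to ρ (inj₂ (_ , p)) | no _ = p
          from : ∀ ρ → ρ 0 ≡ h (tl ρ) → P (ρ 1 ∷ₑ λ i → ρ (3 + i)) × ρ 0 ≡ suc (ρ 2) ⊎ (¬ P (ρ 1 ∷ₑ λ i → ρ (3 + i))) × ρ 0 ≡ ρ 2
          from ρ p with dec (P (ρ 1 ∷ₑ λ i → ρ (3 + i)))
          ... | yes q = inj₁ (q , p)
          ... | no q = inj₂ (q , p)

      count : ℕ → Env ℕ → ℕ
      count = primrec (λ _ → 0) h

      count-suc : ∀ b ρ → count b ρ ≤ count (suc b) ρ
      count-suc b ρ with dec (P (b ∷ₑ ρ))
      ... | yes _ = n≤1+n _
      ... | no _ = ≤-refl

      count-mono : ∀ ρ {b b′} → b ≤ b′ → count b ρ ≤ count b′ ρ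
      count-mono ρ {b} {b′} p = go (≤⇒≤′ p)
        where
          go : ∀ {b′} → b ≤′ b′ → count b ρ ≤ count b′ ρ
          go (≤′-reflexive refl) = ≤-refl
          go (≤′-step {n} q) = ≤-trans (go q) (count-suc n ρ)

      count⇒atLeast : ∀ ρ n b → n ≤ count b ρ → AtLeast n (λ y → P (y ∷ₑ ρ)) b
      count⇒atLeast ρ zero b p = tt
      count⇒atLeast ρ (suc n) (suc b) p with dec (P (b ∷ₑ ρ))
      count⇒atLeast ρ (suc n) (suc b) (s≤s p) | yes q = b , ≤-refl , q , count⇒atLeast ρ n b p
      count⇒atLeast ρ (suc n) (suc b) p | no _ = atLeast-mono (suc n) (n≤1+n b) (count⇒atLeast ρ (suc n) b p)

      atLeast⇒count : ∀ ρ n b → AtLeast n (λ y → P (y ∷ₑ ρ)) b → n ≤ count b ρ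
      atLeast⇒count ρ zero b _ = z≤n
      atLeast⇒count ρ (suc n) b (y , p , q , r) = ≤-trans (≤-trans (s≤s (atLeast⇒count ρ n y r)) one-more) (count-mono ρ p)
        where
          one-more : suc (count y ρ) ≤ count (suc y) ρ
          one-more with dec (P (y ∷ₑ ρ))
          ... | yes _ = ≤-refl
          ... | no q′ = ⊥-elim (q′ q)

    opaque
      -- The number of quantifiers in `AtLeast` grows with its first argument, so for a variable
      -- argument it is not one formula. A count computed by primitive recursion replaces it.
      atLeast-I : ∀ {n b} → IFun n → IFun b → Int (λ ρ → AtLeast (n ρ) (λ y → P (y ∷ₑ ρ)) (b ρ))
      atLeast-I {n} {b} dn db = def-iff (λ ρ → (λ { (s≤s p) → count⇒atLeast ρ (n ρ) (b ρ) p }) , λ p → s≤s (atLeast⇒count ρ (n ρ) (b ρ) p))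
        (sub-I {P = λ ρ → n (tl ρ) < suc (count (ρ 0) (tl ρ))} (fun-ren suc dn <ⁱ suc-I (primrec-I (const-I 0) h-def)) db)

  -- The values of a level are elements of `M` and may be nonstandard, so the level itself need not
  -- be a function on ω; only the equality pattern of its values is a relation on ω.
  Kernel : Level → Set
  Kernel F = Int (λ ρ → F (ρ 0) ≡ F (ρ 1))

  kernel-I : ∀ {F f g} → Kernel F → IFun f → IFun g → Int (λ ρ → F (f ρ) ≡ F (g ρ))
  kernel-I {F} = I.app₂ (λ x y → F x ≡ F y)

  -- A child is represented by its least leaf, so that counting children becomes counting numbers.
  module _ (F : Level) (Fs : List Level) (n : ℕ) (S : ℕ → Set) where

    Rooted : ℕ → Set
    Rooted y = S y × Tree Fs n (λ x → S x × F x ≡ F y)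

    Representative : ℕ → Set
    Representative y = Rooted y × (∀ y′ → y′ < y → ¬ (Rooted y′ × F y′ ≡ F y))

    tree⇒atLeast : ∀ b → (∀ x → S x → x < b) → Tree (F ∷ Fs) n S → AtLeast n Representative b
    tree⇒atLeast b bounded (vs , d , len , t) with dec (n ≡ 0)
    ... | yes refl = tt
    ... | no n≢0 = collect b n vs d len represent
      where
        represent : ∀ {v} → v ∈ vs → Σ ℕ λ y → y < b × Representative y × F y ≡ v
        represent {v} p with tree-nonempty Fs (n≢0⇒n>0 n≢0) (t p)
        ... | x , s , refl with least-nat (λ y → Rooted y × F y ≡ F x) (x , (s , t p) , refl)
        ...   | y , (r , q) , least = y , bounded y (proj₁ r) , (r , λ y′ l (r′ , q′) → least y′ l (r′ , trans q′ q)) , q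
        collect : ∀ b n vs → Distinct (λ v → v) vs → n ≤ length vs → (∀ {v} → v ∈ vs → Σ ℕ λ y → y < b × Representative y × F y ≡ v) →
                  AtLeast n Representative b
        collect b zero vs d len rep = tt
        collect zero (suc n) (v ∷ vs) d len rep with rep (here refl)
        ... | _ , () , _
        collect (suc b) (suc n) vs d len rep with dec (Representative b × F b ∈ vs)
        ... | no p = atLeast-mono (suc n) (n≤1+n b) (collect b (suc n) vs d len below)
          where
            below : ∀ {v} → v ∈ vs → Σ ℕ λ y → y < b × Representative y × F y ≡ v
            below q with rep q
            ... | y , s≤s l , r , refl with m≤n⇒m<n∨m≡n l
            ...   | inj₁ l′ = y , l′ , r , refl
            ...   | inj₂ refl = ⊥-elim (p (r , q))
        ... | yes (p , _) = b , ≤-refl , p , collect b n outs outs-pairs (length-outs dec s {1} len (single ins-pairs ins-∈)) below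
          where
            s = split dec (λ v → v ≡ F b) d
            open Split s
            single : ∀ {us} → Distinct (λ v → v) us → (∀ {v} → v ∈ us → v ∈ vs × v ≡ F b) → length us ≤ 1
            single [] _ = z≤n
            single {_ ∷ []} _ _ = ≤-refl
            single {_ ∷ _ ∷ _} ((u≢v ∷ _) ∷ _) q =
              ⊥-elim (u≢v (trans (proj₂ (q (here refl))) (sym (proj₂ (q (there (here refl)))))))
            below : ∀ {v} → v ∈ outs → Σ ℕ λ y → y < b × Representative y × F y ≡ v
            below q with rep (proj₁ (outs-∈ q))
            ... | y , s≤s l , r , refl with m≤n⇒m<n∨m≡n l
            ...   | inj₁ l′ = y , l′ , r , refl
            ...   | inj₂ refl = ⊥-elim (proj₂ (outs-∈ q) refl)

    atLeast⇒tree : ∀ b → AtLeast n Representative b → Tree (F ∷ Fs) n S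
    atLeast⇒tree b a with collect n b a
      where
        collect : ∀ m b → AtLeast m Representative b → Σ (List C) λ vs → Distinct (λ v → v) vs × m ≤ length vs ×
                  (∀ {v} → v ∈ vs → Σ ℕ λ y → y < b × Representative y × F y ≡ v)
        collect zero b _ = [] , [] , z≤n , λ ()
        collect (suc m) b (y , l , r , a) with collect m y a
        ... | vs , d , len , rep = F y ∷ vs , tabulateAll fresh ∷ d , s≤s len , rep′
          where
            fresh : ∀ {v} → v ∈ vs → F y ≢ v
            fresh p refl with rep p
            ... | y′ , l′ , r′ , q = proj₂ r y′ l′ (proj₁ r′ , q)
            rep′ : ∀ {v} → v ∈ F y ∷ vs → Σ ℕ λ y → y < b × Representative y × F y ≡ v
            rep′ (here refl) = y , l , r , refl
            rep′ (there p) with rep p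
            ... | y′ , l′ , r′ = y′ , <-trans l′ l , r′
    ... | vs , d , len , rep = vs , d , len , λ p → child (rep p)
      where
        child : ∀ {v} → (Σ ℕ λ y → y < b × Representative y × F y ≡ v) → Tree Fs n (λ x → S x × F x ≡ v)
        child (_ , _ , ((_ , t) , _) , refl) = t

  opaque
    -- The list of levels is fixed, so recursion along it gives a single formula with one count of
    -- representatives per level. The bound `b` on the leaves keeps all quantifiers bounded.
    tree-I : ∀ {Fs} → All Kernel Fs → {S : Env ℕ → ℕ → Set} {n b : Env ℕ → ℕ} → Int (λ ρ → S (tl ρ) (ρ 0)) → IFun n → IFun b →
             (∀ ρ x → S ρ x → x < b ρ) → Int (λ ρ → Tree Fs (n ρ) (S ρ))
    tree-I [] {S} dS dn db bounded = def-iff (λ ρ → (λ (x , _ , p) → x , p) , (λ (x , p) → x , bounded ρ x p , p)) (∃< db dS)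
    tree-I {F ∷ Fs} (k ∷ ks) {S} {n} {b} dS dn db bounded = def-iff
      (λ ρ → atLeast⇒tree F Fs (n ρ) (S ρ) (b ρ) , tree⇒atLeast F Fs (n ρ) (S ρ) (b ρ) (bounded ρ))
      (atLeast-I {P = λ ρ → Representative F Fs (n (tl ρ)) (S (tl ρ)) (ρ 0)}
        (rooted ∧ᵈ ∀< (var-I 0) (¬ᵈ (def-ren (0 ∷ₑ (λ i → suc (suc i))) rooted ∧ᵈ kernel-I {F} k (var-I 0) (var-I 1)))) dn db)
      where
        rooted : Int (λ ρ → Rooted F Fs (n (tl ρ)) (S (tl ρ)) (ρ 0))
        rooted = dS ∧ᵈ tree-I ks {S = λ ρ x → S (tl ρ) x × F x ≡ F (ρ 0)}
          (def-ren (0 ∷ₑ (λ i → suc (suc i))) dS ∧ᵈ kernel-I {F} k (var-I 0) (var-I 1)) (fun-ren suc dn) (fun-ren suc db)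
          (λ ρ x p → bounded (tl ρ) x (proj₁ p))

  -- Iterating the least extension of a coded finite set is a primitive recursion, so the union of all stages is internal.
  record Fusion (Q : ℕ → Set) (T : ℕ → ℕ → Set) (ν : ℕ → ℕ) : Set where
    field
      stage : ℕ → ℕ
      stage-I : IFun (λ ρ → stage (ρ 0))
      stage-Q : ∀ n → Q (stage n)
      stage-T : ∀ n → T n (stage (suc n))
      stage-mono : ∀ {m n x} → m ≤ n → x ε stage m → x ε stage n
      stage-stable : ∀ m {x} → x ε stage m → x ε stage (ν x)

  opaque
    -- Step `n` adds only elements with `ν x` greater than `n`, so whatever ever enters has done so
    -- by stage `ν x`. Membership in the union is read off there, without a search through the
    -- stages.
    fusion : ∀ {Q T ν} → Int (λ ρ → Q (ρ 0)) → Int (λ ρ → T (ρ 0) (ρ 1)) → IFun (λ ρ → ν (ρ 0)) → (t₀ : ℕ) → Q t₀ →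
      (∀ n s → Q s → Σ ℕ λ t → (∀ x → x ε s → x ε t) × (∀ x → x ε t → ν x ≤ n → x ε s) × Q t × T n t) → Fusion Q T ν
    fusion {Q} {T} {ν} dQ dT dν t₀ q₀ extend = record
      { stage = stage ; stage-I = stage-I ; stage-Q = Q-stage ; stage-T = λ n → proj₂ (proj₂ (proj₂ (next-spec n)))
      ; stage-mono = λ p → mono (≤⇒≤′ p) ; stage-stable = stable }
      where
        Ext : ℕ → ℕ → ℕ → Set
        Ext n s t = (∀ x → x ε s → x ε t) × (∀ x → x ε t → ν x ≤ n → x ε s) × Q t × T n t
        ext-def : Int (λ ρ → Q (ρ 2) → Ext (ρ 1) (ρ 2) (ρ 0))
        ext-def = I.app₁ Q dQ (var-I 2) ⇒ᵈ
          def-iff (λ ρ → (λ h x p → h x (ε⇒< (ρ 2) p) p) , λ h x _ → h x) (∀< (var-I 2) (var-I 0 εⁱ var-I 3 ⇒ᵈ var-I 0 εⁱ var-I 1)) ∧ᵈ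
          def-iff (λ ρ → (λ h x p q → h x (ε⇒< (ρ 0) p) p (s≤s q)) , λ h x _ p q → h x p (≤-pred q))
            (∀< (var-I 0) (var-I 0 εⁱ var-I 1 ⇒ᵈ I.fun₁ ν dν (var-I 0) <ⁱ suc-I (var-I 2) ⇒ᵈ var-I 0 εⁱ var-I 3)) ∧ᵈ
          I.app₁ Q dQ (var-I 0) ∧ᵈ I.app₂ T dT (var-I 1) (var-I 0)
        -- The premise `Q s` makes the search succeed at codes that are no stages as well, as
        -- `least-I` requires.
        total : ∀ n s → Σ ℕ λ t → Q s → Ext n s t
        total n s with dec (Q s)
        ... | yes q = let t , p = extend n s q in t , λ _ → p
        ... | no q = 0 , λ p → ⊥-elim (q p)
        least-next : ∀ n s → Σ ℕ (LeastNat (λ t → Q s → Ext n s t))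
        least-next n s = least-nat _ (total n s)
        next : ℕ → ℕ → ℕ
        next n s = proj₁ (least-next n s)
        next-I : IFun (λ ρ → next (ρ 0) (ρ 1))
        next-I = least-I {R = λ ρ → Q (ρ 2) → Ext (ρ 1) (ρ 2) (ρ 0)} ext-def λ ρ → proj₂ (least-next (ρ 0) (ρ 1))
        stage : ℕ → ℕ
        stage zero = t₀
        stage (suc n) = next n (stage n)
        stage-primrec : ∀ n ρ → primrec (λ _ → t₀) (λ ρ → next (ρ 0) (ρ 1)) n ρ ≡ stage n
        stage-primrec zero ρ = refl
        stage-primrec (suc n) ρ = cong (next n) (stage-primrec n ρ)
        stage-I : IFun (λ ρ → stage (ρ 0))
        stage-I = fun (def-iff (λ ρ → ≡-cong refl (stage-primrec (ρ 1) (tl (tl ρ)))) (graph (primrec-I (const-I t₀) next-I)))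
        Q-stage : ∀ n → Q (stage n)
        next-spec : ∀ n → Ext n (stage n) (stage (suc n))
        next-spec n = proj₁ (proj₂ (least-next n (stage n))) (Q-stage n)
        Q-stage zero = q₀
        Q-stage (suc n) = proj₁ (proj₂ (proj₂ (next-spec n)))
        mono : ∀ {m n x} → m ≤′ n → x ε stage m → x ε stage n
        mono (≤′-reflexive refl) p = p
        mono (≤′-step {n} q) p = proj₁ (next-spec n) _ (mono q p)
        stable : ∀ m {x} → x ε stage m → x ε stage (ν x)
        stable zero {x} p = mono {zero} {ν x} (≤⇒≤′ z≤n) p
        stable (suc m) {x} p with ν x ≤? m
        ... | yes q = stable m (proj₁ (proj₂ (next-spec m)) x p q)
        ... | no q = mono {suc m} {ν x} (≤⇒≤′ (≰⇒> q)) p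

  -- Internal thinning

  open Insertion num num-injective

  elements : ∀ s → Σ (List ℕ) λ xs → ∀ x → (x ε s) ⟷ (x ∈ xs)
  elements s = filter (λ x → dec (x ε s)) (upTo s) ,
    λ x → (λ p → ∈-filter⁺ (λ x → dec (x ε s)) (∈-upTo⁺ (ε⇒< s p)) p) , λ p → proj₂ (∈-filter⁻ (λ x → dec (x ε s)) {xs = upTo s} p)

  true-I : Int (λ _ → ⊤)
  true-I = def-iff (λ _ → (λ _ → tt) , (λ _ → refl)) (const-I 0 ≡ⁱ const-I 0)

  refines-I : ∀ {F Fs f g} → Kernel F → All Kernel Fs → IFun f → IFun g → Int (λ ρ → All (λ G → G (f ρ) ≡ G (g ρ) → F (f ρ) ≡ F (g ρ)) Fs)
  refines-I k [] df dg = def-iff (λ _ → (λ _ → []) , (λ _ → tt)) true-I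
  refines-I {F} {G ∷ Fs} k (k′ ∷ ks) df dg = def-iff (λ _ → (λ (p , q) → p ∷ q) , λ { (p ∷ q) → p , q })
    ((kernel-I {G} k′ df dg ⇒ᵈ kernel-I {F} k df dg) ∧ᵈ refines-I {F} k ks df dg)

  chainAt-I : ∀ {Fs f g} → All Kernel Fs → IFun f → IFun g → Int (λ ρ → ChainAt Fs (f ρ) (g ρ))
  chainAt-I [] df dg = def-iff (λ _ → (λ _ → []) , (λ _ → tt)) true-I
  chainAt-I {F ∷ Fs} (k ∷ ks) df dg = def-iff (λ _ → (λ (p , q) → p ∷ q) , λ { (p ∷ q) → p , q }) (refines-I {F} k ks df dg ∧ᵈ chainAt-I ks df dg)

  module _ {Fs : List Level} (ks : All Kernel Fs) {X : ℕ → Set} (dX : Int (λ ρ → X (ρ 0))) where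

    module _ {E H : Level} (kE : Kernel E) (H∈ : H ∈ Fs) where

      private
        Q : ℕ → Set
        Q t = (∀ x → x ε t → X x) × (∀ x y → x ε t → y ε t → (E x ≡ E y) ⟷ (H x ≡ H y))

        T : ℕ → ℕ → Set
        T n t = Tree Fs n (_ε t)

        kH : Kernel H
        kH = lookupAll ks H∈

        Q-I : Int (λ ρ → Q (ρ 0))
        Q-I = def-iff (λ ρ → (λ (h , k) → (λ x p → h x (ε⇒< (ρ 0) p) p) , λ x y p q → k x (ε⇒< (ρ 0) p) y (ε⇒< (ρ 0) q) p q) ,
                             (λ (h , k) → (λ x _ → h x) , λ x _ y _ → k x y))
          (∀< (var-I 0) (var-I 0 εⁱ var-I 1 ⇒ᵈ dX) ∧ᵈ
           ∀< (var-I 0) (∀< (var-I 1) (var-I 1 εⁱ var-I 2 ⇒ᵈ var-I 0 εⁱ var-I 2 ⇒ᵈ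
             ((kernel-I {E} kE (var-I 1) (var-I 0) ⇒ᵈ kernel-I {H} kH (var-I 1) (var-I 0)) ∧ᵈ
              (kernel-I {H} kH (var-I 1) (var-I 0) ⇒ᵈ kernel-I {E} kE (var-I 1) (var-I 0))))))

        T-I : Int (λ ρ → T (ρ 0) (ρ 1))
        T-I = tree-I ks {S = λ ρ x → x ε ρ 1} (var-I 0 εⁱ var-I 2) (var-I 0) (var-I 1) (λ ρ x → ε⇒< (ρ 1))

        extend : (∀ n → Canonises Fs H E n X) →
          ∀ n s → Q s → Σ ℕ λ t → (∀ x → x ε s → x ε t) × (∀ x → x ε t → x ≤ n → x ε s) × Q t × T n t
        extend can n s (sX , sC) with elements s
        ... | ss , mem with extend-canonical Fs H∈ can ss (λ p q → sC _ _ (proj₂ (mem _) p) (proj₂ (mem _) q)) n n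
        ...   | xs , sub , t , c with code-set (ss ++ xs)
        ...     | u , mem′ = u , (λ x p → proj₂ (mem′ x) (∈-++⁺ˡ (proj₁ (mem x) p))) , old ,
                  ((λ x p → uX x (∈-++⁻ ss (proj₁ (mem′ x) p))) , λ x y p q → c (proj₁ (mem′ x) p) (proj₁ (mem′ y) q)) ,
                  tree-mono Fs (λ p → proj₂ (mem′ _) (∈-++⁺ʳ ss p)) t
          where
            old : ∀ x → x ε u → x ≤ n → x ε s
            old x p q with ∈-++⁻ ss (proj₁ (mem′ x) p)
            ... | inj₁ r = proj₂ (mem x) r
            ... | inj₂ r = ⊥-elim (<⇒≱ (proj₂ (sub r)) q)
            uX : ∀ x → x ∈ ss ⊎ x ∈ xs → X x
            uX x (inj₁ r) = sX x (proj₂ (mem x) r)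
            uX x (inj₂ r) = proj₁ (sub r)

        conclude : Fusion Q T (λ x → x) → Σ (ℕ → Set) λ Y → Int (λ ρ → Y (ρ 0)) × (∀ {x} → Y x → X x) × Large Fs Y × Canonical H E Y
        conclude f = (λ x → x ε stage x) , var-I 0 εⁱ stage-I , (λ {x} p → proj₁ (stage-Q x) x p) ,
          (λ n → tree-mono Fs (stage-stable (suc n)) (stage-T n)) ,
          λ {x} {y} p q → proj₂ (stage-Q (x ⊔ y)) x y (stage-mono (m≤m⊔n x y) p) (stage-mono (m≤n⊔m x y) q)
          where open Fusion f

      thin-canonical : (∀ n → Canonises Fs H E n X) →
        Σ (ℕ → Set) λ Y → Int (λ ρ → Y (ρ 0)) × (∀ {x} → Y x → X x) × Large Fs Y × Canonical H E Y
      thin-canonical can with code-set []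
      ... | t₀ , mem = conclude (fusion Q-I T-I (var-I 0) t₀ ((λ x p → ⊥-elim (¬Any[] (proj₁ (mem x) p))) , λ x y p → ⊥-elim (¬Any[] (proj₁ (mem x) p))) (extend can))

    opaque
      -- A value that serves all arities cuts out a large set by a formula. Otherwise the finite
      -- trees are joined by a fusion, whose invariant is canonicity on the whole finite set chosen
      -- so far.
      canonise : ∀ {E G} → Kernel E → G ∈ Fs → Chain Fs X → Large Fs X →
        Σ (ℕ → Set) λ Y → Int (λ ρ → Y (ρ 0)) × (∀ {x} → Y x → X x) × Large Fs Y × Σ Level λ H → H ∈ (constant (zer M) ∷ Fs) × Canonical H E Y
      canonise {E} kE G∈ ch large with canonical-type (zer M) {E = E} G∈ ch large
      ... | inj₁ (x₀ , large′) = (λ x → X x × E x ≡ E x₀) , dX ∧ᵈ kernel-I {E} kE (var-I 0) (const-I x₀) , proj₁ , large′ ,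
            constant (zer M) , here refl , λ (_ , p) (_ , q) → (λ _ → refl) , (λ _ → trans p (sym q))
      ... | inj₂ (H , H∈ , can) with thin-canonical kE H∈ can
      ...   | Y , Y-I , sub , large′ , c = Y , Y-I , sub , large′ , H , there H∈ , c

  record Definable₁ (F : C → C) : Set where
    constructor def₁
    field
      fun-def : DFun (λ ρ → F (ρ 0))

  open Definable₁ public

  module _ {P : Env C → Set} (d : Dfn P) where

    -- Parameters are supplied by `e`, so all remaining variables can be filled with the one
    -- argument.
    μ₁ : C → C
    μ₁ y = μ (λ a → P (a ∷ₑ (λ _ → y)))

    private
      binary : Dfn (λ ρ → P (ρ 0 ∷ₑ (λ _ → ρ 1)))
      binary = def-iff (λ ρ → def-ext d (eq ρ) , def-ext d (λ i → sym (eq ρ i))) (def-ren (0 ∷ₑ (λ _ → 1)) d)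
        where
          eq : ∀ (ρ : Env C) i → ρ ((0 ∷ₑ (λ _ → 1)) i) ≡ (ρ 0 ∷ₑ (λ _ → ρ 1)) i
          eq ρ zero = refl
          eq ρ (suc i) = refl

    μ₁-def : Definable₁ μ₁
    μ₁-def = def₁ (μ-def {P = λ ρ → P (ρ 0 ∷ₑ (λ _ → ρ 1))} binary)

  level-kernel : ∀ {F} → Definable₁ F → Kernel (F ∘ num)
  level-kernel {F} (def₁ d) = restrict (M.fun₁ F d (var-M 0) ≡ᵈ M.fun₁ F d (var-M 1))

  -- Internal insertion of a level

  module _ {As : List Level} {B : Level} {Bs : List Level} (kA : All Kernel As) (kB : All Kernel (B ∷ Bs))
           {X : ℕ → Set} (dX : Int (λ ρ → X (ρ 0))) where

    private
      Ls = insert As (B ∷ Bs)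

      kLs : All Kernel Ls
      kLs = All-++⁺ (lifted kA) (def-iff (λ _ → (cong num) , num-injective) (π₂-I (var-I 0) ≡ⁱ π₂-I (var-I 1)) ∷ lifted kB)
        where
          lifted : ∀ {Fs} → All Kernel Fs → All Kernel (lift₁ Fs)
          lifted [] = []
          lifted {F ∷ Fs} (k ∷ ks) = kernel-I {F} k (π₁-I (var-I 0)) (π₁-I (var-I 1)) ∷ lifted ks

      chain-new : ∀ Us {G K Ks x y} → ChainAt (Us ++ G ∷ K ∷ Ks) x y → K x ≡ K y → G x ≡ G y
      chain-new [] ((p ∷ _) ∷ _) = p
      chain-new (_ ∷ Us) (_ ∷ c) = chain-new Us c

      chain-transport : ∀ {Fs Gs z z′ x y} → Pointwise (λ F G → F z ≡ G x × F z′ ≡ G y) Fs Gs → ChainAt Fs z z′ → ChainAt Gs x y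
      chain-transport [] [] = []
      chain-transport {F ∷ _} {G ∷ _} {z} {z′} {x} {y} ((p , q) ∷ ps) (h ∷ c) = refines ps h ∷ chain-transport ps c
        where
          refines : ∀ {Fs Gs} → Pointwise (λ F G → F z ≡ G x × F z′ ≡ G y) Fs Gs → All (λ K → K z ≡ K z′ → F z ≡ F z′) Fs →
                    All (λ K → K x ≡ K y → G x ≡ G y) Gs
          refines [] [] = []
          refines ((r , s) ∷ ps) (k ∷ ks) = (λ t → trans (sym p) (trans (k (trans r (trans t (sym s)))) q)) ∷ refines ps ks

      insert-pointwise : ∀ {F} {R : Level → Level → Set} → (∀ G → R (G ∘ π₁) G) → R (num ∘ π₂) F → Pointwise R Ls (As ++ F ∷ B ∷ Bs)
      insert-pointwise {F} {R} h k = go As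
        where
          lifted : ∀ Fs → Pointwise R (lift₁ Fs) Fs
          lifted [] = []
          lifted (G ∷ Fs) = h G ∷ lifted Fs
          go : ∀ Us → Pointwise R (lift₁ Us ++ (num ∘ π₂) ∷ lift₁ (B ∷ Bs)) (Us ++ F ∷ B ∷ Bs)
          go [] = k ∷ lifted (B ∷ Bs)
          go (G ∷ Us) = h G ∷ go Us

      Q : ℕ → Set
      Q t = (∀ z → z ε t → X (π₁ z)) × (∀ z z′ → z ε t → z′ ε t → ChainAt Ls z z′)

      T : ℕ → ℕ → Set
      T n t = Tree Ls n (_ε t)

      Q-I : Int (λ ρ → Q (ρ 0))
      Q-I = def-iff (λ ρ → (λ (h , k) → (λ x p → h x (ε⇒< (ρ 0) p) p) , λ x y p q → k x (ε⇒< (ρ 0) p) y (ε⇒< (ρ 0) q) p q) ,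
                           (λ (h , k) → (λ x _ → h x) , λ x _ y _ → k x y))
        (∀< (var-I 0) (var-I 0 εⁱ var-I 1 ⇒ᵈ I.app₁ X dX (π₁-I (var-I 0))) ∧ᵈ
         ∀< (var-I 0) (∀< (var-I 1) (var-I 1 εⁱ var-I 2 ⇒ᵈ var-I 0 εⁱ var-I 2 ⇒ᵈ chainAt-I kLs (var-I 1) (var-I 0))))

      T-I : Int (λ ρ → T (ρ 0) (ρ 1))
      T-I = tree-I kLs {S = λ ρ x → x ε ρ 1} (var-I 0 εⁱ var-I 2) (var-I 0) (var-I 1) (λ ρ x → ε⇒< (ρ 1))

      extend : Chain (As ++ B ∷ Bs) X → Large (As ++ B ∷ Bs) X →
        ∀ n s → Q s → Σ ℕ λ t → (∀ x → x ε s → x ε t) × (∀ x → x ε t → π₁ x ≤ n → x ε s) × Q t × T n t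
      extend ch large n s (sX , sC) with elements s
      ... | ss , mem with extend-inserted As B Bs ch large ss (λ p → sX _ (proj₂ (mem _) p)) (λ p q → sC _ _ (proj₂ (mem _) p) (proj₂ (mem _) q)) n n
      ...   | xs , sub , t , c with code-set (ss ++ xs)
      ...     | u , mem′ = u , (λ x p → proj₂ (mem′ x) (∈-++⁺ˡ (proj₁ (mem x) p))) , old ,
                ((λ x p → uX x (∈-++⁻ ss (proj₁ (mem′ x) p))) , λ x y p q → c (proj₁ (mem′ x) p) (proj₁ (mem′ y) q)) ,
                tree-mono Ls (λ p → proj₂ (mem′ _) (∈-++⁺ʳ ss p)) t
        where
          old : ∀ x → x ε u → π₁ x ≤ n → x ε s
          old x p q with ∈-++⁻ ss (proj₁ (mem′ x) p)
          ... | inj₁ r = proj₂ (mem x) r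
          ... | inj₂ r = ⊥-elim (<⇒≱ (proj₂ (sub r)) q)
          uX : ∀ x → x ∈ ss ⊎ x ∈ xs → X (π₁ x)
          uX x (inj₁ r) = sX x (proj₂ (mem x) r)
          uX x (inj₂ r) = proj₁ (sub r)

      module _ (f : Fusion Q T π₁) where
        open Fusion f

        Y : ℕ → Set
        Y x = Σ ℕ λ v → v < stage x × pair x v ε stage x

        R-I : Int (λ ρ → pair (ρ 1) (ρ 0) ε stage (ρ 1))
        R-I = pair-I (var-I 1) (var-I 0) εⁱ I.fun₁ stage stage-I (var-I 1)

        Y-I : Int (λ ρ → Y (ρ 0))
        Y-I = ∃< stage-I R-I

        Y⊆X : ∀ {x} → Y x → X x
        Y⊆X {x} (v , _ , p) = subst X (π₁-pair x v) (proj₁ (stage-Q x) (pair x v) p)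

        F : C → C
        F = μ₁ (hat-def R-I)

        -- Pairs with the same first component agree at the level `B`, which refines the new level.
        -- So they agree there too, and the new level is the second component.
        functional : ∀ {x v w} → pair x v ε stage x → pair x w ε stage x → v ≡ w
        functional {x} {v} {w} p q = trans (sym (π₂-pair x v)) (trans (num-injective (chain-new (lift₁ As) (proj₂ (stage-Q x) _ _ p q)
          (cong B (trans (π₁-pair x v) (sym (π₁-pair x w)))))) (π₂-pair x w))

        F-value : ∀ {x v} → pair x v ε stage x → F (num x) ≡ num v
        F-value {x} {v} p = μ-least (proj₁ (hat-num R-I v (λ _ → x)) p , below)
          where
            below : ∀ z → lt M z (num v) → ¬ hat R-I (z ∷ₑ (λ _ → num x))
            below z z<v q with below-num v z<v
            ... | w , w<v , refl = <-irrefl (functional {x} (proj₂ (hat-num R-I w (λ _ → x)) q) p) w<v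

        member : ∀ {z} → z ε stage (π₁ z) → pair (π₁ z) (π₂ z) ε stage (π₁ z)
        member {z} p = subst (_ε stage (π₁ z)) (sym (pair-π z)) p

        Y-chain : Chain (As ++ (F ∘ num) ∷ B ∷ Bs) Y
        Y-chain {x} {y} (v , _ , p) (w , _ , q) = chain-transport
          (insert-pointwise (λ G → cong G (π₁-pair x v) , cong G (π₁-pair y w))
            (trans (cong num (π₂-pair x v)) (sym (F-value p)) , trans (cong num (π₂-pair y w)) (sym (F-value q))))
          (proj₂ (stage-Q (x ⊔ y)) (pair x v) (pair y w) (stage-mono (m≤m⊔n x y) p) (stage-mono (m≤n⊔m x y) q))

        Y-large : Large (As ++ (F ∘ num) ∷ B ∷ Bs) Y
        Y-large n = tree-map π₁ {S₀ = λ z → z ε stage (π₁ z)}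
          (insert-pointwise {R = λ F G → ∀ {z} → z ε stage (π₁ z) → F z ≡ G (π₁ z)} (λ G _ → refl) (λ p → sym (F-value (member p))))
          (stage-stable (suc n)) (λ {z} p → π₂ z , ≤-<-trans (y≤pair (π₁ z) (π₂ z)) (ε⇒< (stage (π₁ z)) (member (stage-stable (suc n) p))) , member (stage-stable (suc n) p))
          (stage-T n)

    opaque
      -- The fusion joins trees of pairs, with stability read off from the first component. The
      -- first components form the thinned set, and the pairs form the graph on it of the new level,
      -- which the formula for this graph extends to a definable function on all of `M`.
      refine : Chain (As ++ B ∷ Bs) X → Large (As ++ B ∷ Bs) X →
        Σ (ℕ → Set) λ Y → Int (λ ρ → Y (ρ 0)) × (∀ {x} → Y x → X x) × Σ (C → C) λ F → Definable₁ F ×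
          Chain (As ++ (F ∘ num) ∷ B ∷ Bs) Y × Large (As ++ (F ∘ num) ∷ B ∷ Bs) Y
      refine ch large with code-set []
      ... | t₀ , mem = Y f , Y-I f , Y⊆X f , F f , μ₁-def (hat-def (R-I f)) , Y-chain f , Y-large f
        where
          f : Fusion Q T π₁
          f = fusion Q-I T-I (π₁-I (var-I 0)) t₀ ((λ x p → ⊥-elim (¬Any[] (proj₁ (mem x) p))) , λ x y p → ⊥-elim (¬Any[] (proj₁ (mem x) p))) (extend ch large)

  module Generic (Λ : CountableLinOrder) where

    -- The generic sequence of conditions

    Label : Set
    Label = OneΛOne Λ

    <₃-trans : {a b c : Label} → a <₃ b → b <₃ c → a <₃ c
    <₃-trans bot<mid (mid<mid _) = bot<mid
    <₃-trans bot<mid mid<top = bot<top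
    <₃-trans (mid<mid p) (mid<mid q) = mid<mid (IsStrictTotalOrder.trans (isSTO Λ) p q)
    <₃-trans (mid<mid _) mid<top = mid<top

    <₃-irrefl : {a : Label} → ¬ (a <₃ a)
    <₃-irrefl (mid<mid p) = IsStrictTotalOrder.irrefl (isSTO Λ) refl p

    <₃-cmp : (a b : Label) → a <₃ b ⊎ a ≡ b ⊎ b <₃ a
    <₃-cmp bot bot = inj₂ (inj₁ refl)
    <₃-cmp bot (mid _) = inj₁ bot<mid
    <₃-cmp bot top = inj₁ bot<top
    <₃-cmp (mid _) bot = inj₂ (inj₂ bot<mid)
    <₃-cmp (mid a) (mid b) with IsStrictTotalOrder.compare (isSTO Λ) a b
    ... | tri< p _ _ = inj₁ (mid<mid p)
    ... | tri≈ _ refl _ = inj₂ (inj₁ refl)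
    ... | tri> _ _ p = inj₂ (inj₂ (mid<mid p))
    <₃-cmp (mid _) top = inj₁ mid<top
    <₃-cmp top bot = inj₂ (inj₂ bot<top)
    <₃-cmp top (mid _) = inj₂ (inj₂ mid<top)
    <₃-cmp top top = inj₂ (inj₁ refl)

    Entry : Set
    Entry = Label × Σ (C → C) Definable₁

    level : Entry → Level
    level (_ , F , _) = F ∘ num

    levels : List Entry → List Level
    levels = map level

    Sorted : List Entry → Set
    Sorted = AllPairs (λ a b → proj₁ a <₃ proj₁ b)

    top-entry : Entry
    top-entry = top , (λ x → x) , def₁ (var-M 0)

    -- `bot` labels no level because it stands for the constant functions, that is for `M`. The
    -- identity is always present as the level of `top`, so every insertion happens before some
    -- level.
    record Condition : Set₁ where
      field
        entries : List Entry
        sorted : Sorted entries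
        no-bot : ∀ {a} → a ∈ entries → proj₁ a ≢ bot
        has-top : top-entry ∈ entries
        X : ℕ → Set
        X-I : Int (λ ρ → X (ρ 0))
        chain : Chain (levels entries) X
        large : Large (levels entries) X

    open Condition public

    record _≥ᶜ_ (c c′ : Condition) : Set where
      field
        shrinks : ∀ {x} → X c′ x → X c x
        keeps : ∀ {a} → a ∈ entries c → a ∈ entries c′

    open _≥ᶜ_ public

    ≥ᶜ-refl : ∀ {c} → c ≥ᶜ c
    ≥ᶜ-refl = record { shrinks = λ p → p ; keeps = λ p → p }

    ≥ᶜ-trans : ∀ {a b c} → a ≥ᶜ b → b ≥ᶜ c → a ≥ᶜ c
    ≥ᶜ-trans p q = record { shrinks = λ r → shrinks p (shrinks q r) ; keeps = λ r → keeps q (keeps p r) }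

    kernels : ∀ es → All Kernel (levels es)
    kernels [] = []
    kernels ((_ , F , d) ∷ es) = level-kernel d ∷ kernels es

    initial : Condition
    initial = record
      { entries = top-entry ∷ [] ; sorted = [] ∷ [] ; no-bot = λ { (here refl) () } ; has-top = here refl
      ; X = λ _ → ⊤ ; X-I = true-I ; chain = λ _ _ → [] ∷ []
      ; large = λ n → map num (upTo n) , distinct-map-injective num-injective (upTo⁺ n) ,
          ≤-reflexive (sym (trans (length-map num (upTo n)) (length-upTo n))) , λ p → let x , _ , q = ∈-map⁻ num p in x , tt , sym q }

    Decides : Condition → (C → C) → Set
    Decides c E = Canonical (constant (zer M)) (E ∘ num) (X c) ⊎ Σ Entry λ a → a ∈ entries c × Canonical (level a) (E ∘ num) (X c)

    decides-mono : ∀ {c c′ E} → c ≥ᶜ c′ → Decides c E → Decides c′ E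
    decides-mono g (inj₁ h) = inj₁ λ p q → h (shrinks g p) (shrinks g q)
    decides-mono g (inj₂ (a , p , h)) = inj₂ (a , keeps g p , λ p q → h (shrinks g p) (shrinks g q))

    opaque
      decide : ∀ c {E} → Definable₁ E → Σ Condition λ c′ → (c ≥ᶜ c′) × Decides c′ E
      decide c {E} dE with canonise (kernels (entries c)) (X-I c) (level-kernel dE) (∈-map⁺ level (has-top c)) (chain c) (large c)
      ... | Y , Y-I , sub , large′ , H , H∈ , can = c′ , record { shrinks = sub ; keeps = λ p → p } , which H∈ can
        where
          c′ : Condition
          c′ = record c { X = Y ; X-I = Y-I ; chain = λ p q → chain c (sub p) (sub q) ; large = large′ }
          which : ∀ {H} → H ∈ (constant (zer M) ∷ levels (entries c)) → Canonical H (E ∘ num) Y → Decides c′ E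
          which (here refl) can = inj₁ can
          which (there p) can with ∈-map⁻ level p
          ... | a , q , refl = inj₂ (a , q , can)

    cut : (l : L Λ) (es : List Entry) → Sorted es → (∀ {a} → a ∈ es → proj₁ a ≢ mid l) →
      Σ (List Entry) λ As → Σ (List Entry) λ Bs → es ≡ As ++ Bs × (∀ {a} → a ∈ As → proj₁ a <₃ mid l) ×
        (∀ FD → Sorted (As ++ (mid l , FD) ∷ Bs))
    cut l [] s new = [] , [] , refl , (λ ()) , λ _ → [] ∷ []
    cut l (a ∷ es) s@(h ∷ s′) new with <₃-cmp (proj₁ a) (mid l)
    ... | inj₂ (inj₁ p) = ⊥-elim (new (here refl) p)
    ... | inj₂ (inj₂ p) = [] , a ∷ es , refl , (λ ()) , λ _ → (p ∷ tabulateAll (λ q → <₃-trans p (lookupAll h q))) ∷ s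
    ... | inj₁ p with cut l es s′ (λ q → new (there q))
    ...   | As , Bs , refl , below , sort = a ∷ As , Bs , refl , (λ { (here refl) → p ; (there q) → below q }) , λ FD → tabulateAll (above FD) ∷ sort FD
      where
        above : ∀ FD {b} → b ∈ As ++ (mid l , FD) ∷ Bs → proj₁ a <₃ proj₁ b
        above FD q with ∈-++⁻ As q
        ... | inj₁ r = lookupAll h (∈-++⁺ˡ r)
        ... | inj₂ (here refl) = p
        ... | inj₂ (there r) = lookupAll h (∈-++⁺ʳ As r)

    opaque
      add-label : ∀ c l → Σ Condition λ c′ → (c ≥ᶜ c′) × Σ Entry λ a → a ∈ entries c′ × proj₁ a ≡ mid l
      add-label c l with dec (Σ Entry λ a → a ∈ entries c × proj₁ a ≡ mid l)
      ... | yes p = c , ≥ᶜ-refl , p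
      ... | no new with cut l (entries c) (sorted c) (λ p q → new (_ , p , q))
      -- `top` lies above `mid l`, so some level follows the place of insertion.
      ...   | As , [] , eq , below , _ = ⊥-elim (no-top<mid (below (top∈ (subst (top-entry ∈_) eq (has-top c)))))
        where
          no-top<mid : ¬ (_<₃_ {Λ} top (mid l))
          no-top<mid ()
          top∈ : ∀ {As : List Entry} → top-entry ∈ As ++ [] → top-entry ∈ As
          top∈ {As} p with ∈-++⁻ As p
          ... | inj₁ q = q
      ...   | As , B ∷ Bs , eq , below , sort
        with refine {levels As} {level B} {levels Bs} (kernels As) (kernels (B ∷ Bs)) (X-I c)
               (subst (λ Fs → Chain Fs (X c)) (trans (cong levels eq) (map-++ level As (B ∷ Bs))) (chain c))
               (subst (λ Fs → Large Fs (X c)) (trans (cong levels eq) (map-++ level As (B ∷ Bs))) (large c))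
      ...     | Y , Y-I , sub , F , dF , chain′ , large′ = c′ , record { shrinks = sub ; keeps = λ p → old (subst (_ ∈_) eq p) } ,
                  new-entry , ∈-++⁺ʳ As (here refl) , refl
        where
          new-entry : Entry
          new-entry = mid l , F , dF
          old : ∀ {a} → a ∈ As ++ B ∷ Bs → a ∈ As ++ new-entry ∷ B ∷ Bs
          old p with ∈-++⁻ As p
          ... | inj₁ q = ∈-++⁺ˡ q
          ... | inj₂ q = ∈-++⁺ʳ As (there q)
          not-bot : ∀ {a} → a ∈ As ++ new-entry ∷ B ∷ Bs → proj₁ a ≢ bot
          not-bot p with ∈-++⁻ As p
          ... | inj₁ q = no-bot c (subst (_ ∈_) (sym eq) (∈-++⁺ˡ q))
          ... | inj₂ (here refl) = λ ()
          ... | inj₂ (there q) = no-bot c (subst (_ ∈_) (sym eq) (∈-++⁺ʳ As q))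
          c′ : Condition
          c′ = record
            { entries = As ++ new-entry ∷ B ∷ Bs ; sorted = sort (F , dF) ; no-bot = not-bot
            ; has-top = old (subst (top-entry ∈_) eq (has-top c)) ; X = Y ; X-I = Y-I
            ; chain = subst (λ Fs → Chain Fs Y) (sym (map-++ level As (new-entry ∷ B ∷ Bs))) chain′
            ; large = subst (λ Fs → Large Fs Y) (sym (map-++ level As (new-entry ∷ B ∷ Bs))) large′ }

    opaque
      -- A definable function is the least solution of its own graph, so the formulas list all
      -- definable functions. Parameters are included because `e` enumerates `M`; this is where
      -- countability allows a construction in ω steps.
      definable : ℕ → C → C
      definable n = μ₁ {P = λ ρ → Sat M (formula n) (mix ρ e)} (formula n , λ ρ → ⟷-refl)

      definable-def : ∀ n → Definable₁ (definable n)
      definable-def n = μ₁-def {P = λ ρ → Sat M (formula n) (mix ρ e)} (formula n , λ ρ → ⟷-refl)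

      definable-surjective : ∀ {F} → Definable₁ F → Σ ℕ λ n → ∀ x → definable n x ≡ F x
      definable-surjective {F} (def₁ (fun (φ , h))) with formula-surjective φ
      ... | n , refl = n , λ x → proj₂ (h _) (μ-satisfies {P = λ ρ → Sat M (formula n) (mix ρ e)} (formula n , λ ρ → ⟷-refl) (λ _ → x)
        (F x , proj₁ (h (F x ∷ₑ (λ _ → x))) refl))

    opaque
      -- One step meets two requirements, for the function of index `n` and for the label of code
      -- `n`. The label comes second, since a decision survives every later extension.
      next : ∀ n c → Σ Condition λ c′ → (c ≥ᶜ c′) × Decides c′ (definable n) ×
             (∀ l → code Λ l ≡ n → Σ Entry λ a → a ∈ entries c′ × proj₁ a ≡ mid l)
      next n c with decide c (definable-def n)
      ... | c₁ , g₁ , d with dec (Σ (L Λ) λ l → code Λ l ≡ n)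
      ...   | no none = c₁ , g₁ , d , λ l p → ⊥-elim (none (l , p))
      ...   | yes (l , p) with add-label c₁ l
      ...     | c₂ , g₂ , a , a∈ , q = c₂ , ≥ᶜ-trans g₁ g₂ , decides-mono {E = definable n} g₂ d ,
                  λ l′ p′ → a , a∈ , trans q (cong mid (code-injective Λ (trans p (sym p′))))

    cond : ℕ → Condition
    cond zero = initial
    cond (suc n) = proj₁ (next n (cond n))

    cond-≥ : ∀ {m n} → m ≤ n → cond m ≥ᶜ cond n
    cond-≥ p = go (≤⇒≤′ p)
      where
        go : ∀ {m n} → m ≤′ n → cond m ≥ᶜ cond n
        go (≤′-reflexive refl) = ≥ᶜ-refl
        go (≤′-step {n} q) = ≥ᶜ-trans (go q) (proj₁ (proj₂ (next n (cond n))))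

    -- The ultrapower

    Xₛ : ℕ → ℕ → Set
    Xₛ s = X (cond s)

    -- U P: the generic ultrafilter on ω contains (the trace of) P.
    record U (P : C → Set) : Set where
      constructor _,_
      field
        depth : ℕ
        eventually : ∀ {x} → Xₛ depth x → P (num x)

    shrink : ∀ {s t x} → s ≤ t → Xₛ t x → Xₛ s x
    shrink p = shrinks (cond-≥ p)

    generic-nonempty : ∀ s → Σ ℕ (Xₛ s)
    generic-nonempty s = tree-nonempty (levels (entries (cond s))) ≤-refl (large (cond s) 1)

    U-mono : ∀ {P Q : C → Set} → (∀ x → P x → Q x) → U P → U Q
    U-mono h (s , p) = s , λ q → h _ (p q)

    U-∩ : ∀ {P Q : C → Set} → U P → U Q → U (λ x → P x × Q x)
    U-∩ (s , p) (t , q) = s ⊔ t , λ r → p (shrink (m≤m⊔n s t) r) , q (shrink (m≤n⊔m s t) r)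

    U-zip : ∀ {P Q R : C → Set} → (∀ x → P x → Q x → R x) → U P → U Q → U R
    U-zip h p q = U-mono (λ x (r , s) → h x r s) (U-∩ p q)

    U-iff : ∀ {P Q R : C → Set} → U R → (∀ x → R x → P x ⟷ Q x) → U P ⟷ U Q
    U-iff r h = U-zip (λ x p q → proj₁ (h x p) q) r , U-zip (λ x p q → proj₂ (h x p) q) r

    U-⊥ : ¬ U (λ _ → ⊥)
    U-⊥ (s , p) = p (proj₂ (generic-nonempty s))

    U-finite : {P : ℕ → C → Set} → (∀ i → U (P i)) → ∀ n → U (λ x → ∀ i → i < n → P i x)
    U-finite h zero = 0 , λ _ i ()
    U-finite {P} h (suc n) = U-zip both (U-finite h n) (h n)
      where
        both : ∀ x → (∀ i → i < n → P i x) → P n x → ∀ i → i < suc n → P i x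
        both x p q i (s≤s l) with m≤n⇒m<n∨m≡n l
        ... | inj₁ l′ = p i l′
        ... | inj₂ refl = q

    zer≢one : zer M ≢ one M
    zer≢one p = IsPA.succ-nonzero pa (zer M) (trans (zero-add (one M)) (sym p))

    module _ (P : C → Set) (d : Dfn (λ ρ → P (ρ 0))) where

      private
        Indicator : Env C → Set
        Indicator ρ = P (ρ 1) × ρ 0 ≡ zer M ⊎ (¬ P (ρ 1)) × ρ 0 ≡ one M

        indicator-def : Dfn Indicator
        indicator-def = M.app₁ P d (var-M 1) ∧ᵈ var-M 0 ≡ᵈ const-M (zer M) ∨ᵈ (¬ᵈ M.app₁ P d (var-M 1)) ∧ᵈ var-M 0 ≡ᵈ const-M (one M)

        module _ (n : ℕ) (same : ∀ x → definable n x ≡ μ₁ indicator-def x) where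

          χ = definable n

          c = cond (suc n)

          χ-spec : ∀ x → P x × χ x ≡ zer M ⊎ (¬ P x) × χ x ≡ one M
          χ-spec x = subst (λ a → P x × a ≡ zer M ⊎ (¬ P x) × a ≡ one M) (sym (same x)) (μ-satisfies {P = Indicator} indicator-def (λ _ → x) total)
            where
              total : Σ C λ a → P x × a ≡ zer M ⊎ (¬ P x) × a ≡ one M
              total with dec (P x)
              ... | yes p = zer M , inj₁ (p , refl)
              ... | no p = one M , inj₂ (p , refl)

          transfer : ∀ x y → χ x ≡ χ y → P x → P y
          transfer x y p q with χ-spec x | χ-spec y
          ... | _ | inj₁ (r , _) = r
          ... | inj₁ (_ , r) | inj₂ (_ , s) = ⊥-elim (zer≢one (trans (sym r) (trans p s)))
          ... | inj₂ (r , _) | inj₂ _ = ⊥-elim (r q)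

          two-values : ∀ x y z → χ x ≢ χ y → χ x ≢ χ z → χ y ≢ χ z → ⊥
          two-values x y z p q r with χ-spec x | χ-spec y | χ-spec z
          ... | inj₁ (_ , a) | inj₁ (_ , b) | _ = p (trans a (sym b))
          ... | inj₂ (_ , a) | inj₂ (_ , b) | _ = p (trans a (sym b))
          ... | inj₁ (_ , a) | inj₂ _ | inj₁ (_ , b) = q (trans a (sym b))
          ... | inj₂ (_ , a) | inj₁ _ | inj₂ (_ , b) = q (trans a (sym b))
          ... | inj₁ _ | inj₂ (_ , a) | inj₂ (_ , b) = r (trans a (sym b))
          ... | inj₂ _ | inj₁ (_ , a) | inj₁ (_ , b) = r (trans a (sym b))

          conclude : Decides c χ → U P ⊎ U (λ x → ¬ P x)
          conclude (inj₁ can) with generic-nonempty (suc n)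
          ... | x₀ , x₀∈ with dec (P (num x₀))
          ...   | yes p = inj₁ (suc n , λ {y} q → transfer (num x₀) (num y) (proj₂ (can x₀∈ q) refl) p)
          ...   | no p = inj₂ (suc n , λ {y} q r → p (transfer (num y) (num x₀) (proj₂ (can q x₀∈) refl) r))
          conclude (inj₂ (a , a∈ , can)) with ∈-map⁺ level a∈
          ... | m with tree-separate (levels (entries c)) [] m (large c 1)
          ...   | x , x∈ , _ with tree-separate (levels (entries c)) (level a x ∷ []) m (large c 2)
          ...     | y , y∈ , y≢ with tree-separate (levels (entries c)) (level a x ∷ level a y ∷ []) m (large c 3)
          ...       | z , z∈ , z≢ = ⊥-elim (two-values (num x) (num y) (num z)
                        (λ p → y≢ (here (sym (proj₁ (can x∈ y∈) p)))) (λ p → z≢ (here (sym (proj₁ (can x∈ z∈) p))))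
                        (λ p → z≢ (there (here (sym (proj₁ (can y∈ z∈) p))))))

      -- The indicator function of `P` has been decided at some step. It has at most two values,
      -- while a level has at least three on every condition, so it was made constant.
      U-dichotomy : U P ⊎ U (λ x → ¬ P x)
      U-dichotomy with definable-surjective (μ₁-def indicator-def)
      ... | n , same = conclude n same (proj₁ (proj₂ (proj₂ (next n (cond n)))))

    -- Elements of N are least indices of definable functions modulo U, which makes equality in N propositional equality.
    _~_ : ℕ → ℕ → Set
    i ~ j = U (λ x → definable i x ≡ definable j x)

    Minimal : ℕ → Set
    Minimal j = ∀ i → i < j → ¬ (i ~ j)

    Nᶜ : Set
    Nᶜ = Σ ℕ λ j → True (dec (Minimal j))

    val : Nᶜ → C → C
    val (j , _) = definable j

    val-def : ∀ a → Definable₁ (val a)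
    val-def (j , _) = definable-def j

    True-irrelevant : ∀ {P : Set} (d : Dec P) (p q : True d) → p ≡ q
    True-irrelevant (yes _) tt tt = refl

    N-ext : ∀ a b → U (λ x → val a x ≡ val b x) → a ≡ b
    N-ext (i , p) (j , q) h with <-cmp i j
    ... | tri< l _ _ = ⊥-elim (toWitness q i l h)
    ... | tri> _ _ l = ⊥-elim (toWitness p j l (U-mono (λ _ → sym) h))
    ... | tri≈ _ refl _ = cong (i ,_) (True-irrelevant (dec (Minimal i)) p q)

    opaque
      class : ∀ {F} → Definable₁ F → Σ Nᶜ λ a → U (λ x → val a x ≡ F x)
      class {F} d with definable-surjective d
      ... | n , same with least-nat (_~ n) (n , 0 , λ _ → refl)
      ...   | j , p , least = (j , fromWitness minimal) , U-mono (λ x q → trans q (same x)) p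
        where
          minimal : Minimal j
          minimal i l q = least i l (U-zip (λ _ → trans) q p)

    [_] : ∀ {F} → Definable₁ F → Nᶜ
    [ d ] = proj₁ (class d)

    const-def : ∀ a → Definable₁ (λ _ → a)
    const-def a = def₁ (const-M a)

    add-def : ∀ a b → Definable₁ (λ x → add M (val a x) (val b x))
    add-def a b = def₁ (fun-def (val-def a) +ᵈ fun-def (val-def b))

    mul-def : ∀ a b → Definable₁ (λ x → mul M (val a x) (val b x))
    mul-def a b = def₁ (fun-def (val-def a) *ᵈ fun-def (val-def b))

    N : Structure
    N = record
      { Carrier = Nᶜ
      ; zer = [ const-def (zer M) ]
      ; one = [ const-def (one M) ]
      ; add = λ a b → [ add-def a b ]
      ; mul = λ a b → [ mul-def a b ]
      ; lt = λ a b → U (λ x → lt M (val a x) (val b x))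
      }

    at : Env Nᶜ → C → Env C
    at ρ x i = val (ρ i) x

    eval-N : ∀ t (ρ : Env Nᶜ) → U (λ x → val (eval N t ρ) x ≡ eval M t (at ρ x))
    eval-N (var i) ρ = 0 , λ _ → refl
    eval-N t0 ρ = proj₂ (class (const-def (zer M)))
    eval-N t1 ρ = proj₂ (class (const-def (one M)))
    eval-N (t ⊕ s) ρ = U-zip (λ x p (q , r) → trans p (cong₂ (add M) q r)) (proj₂ (class (add-def (eval N t ρ) (eval N s ρ)))) (U-∩ (eval-N t ρ) (eval-N s ρ))
    eval-N (t ⊗ s) ρ = U-zip (λ x p (q , r) → trans p (cong₂ (mul M) q r)) (proj₂ (class (mul-def (eval N t ρ) (eval N s ρ)))) (U-∩ (eval-N t ρ) (eval-N s ρ))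

    at-def : ∀ φ (ρ : Env Nᶜ) → Dfn (λ ρ′ → Sat M φ (at ρ (ρ′ 0)))
    at-def φ ρ = Sat-def φ (λ i → fun-def (val-def (ρ i)))

    at-∷ : ∀ φ a ρ x → Sat M φ (at (a ∷ₑ ρ) x) ⟷ Sat M φ (val a x ∷ₑ at ρ x)
    at-∷ φ a ρ x = Sat-ext M φ λ { zero → refl ; (suc i) → refl }

    skolem : Formula → Env Nᶜ → C → C
    skolem φ ρ x = μ (λ a → Sat M φ (a ∷ₑ at ρ x))

    skolem-def : ∀ φ ρ → Definable₁ (skolem φ ρ)
    skolem-def φ ρ = def₁ (μ-def {P = λ ρ′ → Sat M φ (ρ′ 0 ∷ₑ at ρ (ρ′ 1))} (Sat-def-binder φ (λ i → fun-def (val-def (ρ i)))))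

    skolem-satisfies : ∀ φ ρ x → (Σ C λ a → Sat M φ (a ∷ₑ at ρ x)) → Sat M φ (skolem φ ρ x ∷ₑ at ρ x)
    skolem-satisfies φ ρ x p = μ-satisfies {P = λ ρ′ → Sat M φ (ρ′ 0 ∷ₑ at ρ (ρ′ 1))} (Sat-def-binder φ (λ i → fun-def (val-def (ρ i)))) (λ _ → x) p

    U-skolem : ∀ φ ρ → U (λ x → Σ C λ a → Sat M φ (a ∷ₑ at ρ x)) → U (λ x → Sat M φ (at ([ skolem-def φ ρ ] ∷ₑ ρ) x))
    U-skolem φ ρ = U-zip (λ x p q → proj₂ (at-∷ φ _ ρ x) (subst (λ a → Sat M φ (a ∷ₑ at ρ x)) (sym p) (skolem-satisfies φ ρ x q)))
      (proj₂ (class (skolem-def φ ρ)))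

    -- The existential case takes the least witness at each point: this is a definable function, so
    -- its class lies in `N`. The universal case applies the same to a least counterexample.
    los : ∀ φ (ρ : Env Nᶜ) → Sat N φ ρ ⟷ U (λ x → Sat M φ (at ρ x))
    los (t ≐ s) ρ = ⟷-trans ((λ p → 0 , λ {x} _ → cong (λ a → val a (num x)) p) , N-ext _ _)
      (U-iff (U-∩ (eval-N t ρ) (eval-N s ρ)) λ x (p , q) → ≡-cong p q)
    los (t ≺ s) ρ = U-iff (U-∩ (eval-N t ρ) (eval-N s ρ)) λ x (p , q) → subst₂ (lt M) p q , subst₂ (lt M) (sym p) (sym q)
    los ff ρ = ⊥-elim , U-⊥
    los (¬f φ) ρ = ⟷-trans (¬-cong (los φ ρ)) (to , λ p q → U-⊥ (U-zip (λ _ r s → r s) p q))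
      where
        to : ¬ U (λ x → Sat M φ (at ρ x)) → U (λ x → ¬ Sat M φ (at ρ x))
        to n with U-dichotomy _ (at-def φ ρ)
        ... | inj₁ p = ⊥-elim (n p)
        ... | inj₂ p = p
    los (φ ∧f ψ) ρ = ⟷-trans (×-cong (los φ ρ) (los ψ ρ)) ((λ (p , q) → U-∩ p q) , λ p → U-mono (λ _ → proj₁) p , U-mono (λ _ → proj₂) p)
    los (φ ∨f ψ) ρ = ⟷-trans (⊎-cong (los φ ρ) (los ψ ρ)) ((λ { (inj₁ p) → U-mono (λ _ → inj₁) p ; (inj₂ p) → U-mono (λ _ → inj₂) p }) , from)
      where
        from : U (λ x → Sat M φ (at ρ x) ⊎ Sat M ψ (at ρ x)) → U (λ x → Sat M φ (at ρ x)) ⊎ U (λ x → Sat M ψ (at ρ x))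
        from p with U-dichotomy _ (at-def φ ρ)
        ... | inj₁ q = inj₁ q
        ... | inj₂ q = inj₂ (U-zip (λ { x (inj₁ r) n → ⊥-elim (n r) ; x (inj₂ r) n → r }) p q)
    los (φ ⇒f ψ) ρ = ⟷-trans (→-cong (los φ ρ) (los ψ ρ)) (to , λ p q → U-zip (λ _ r s → r s) p q)
      where
        to : (U (λ x → Sat M φ (at ρ x)) → U (λ x → Sat M ψ (at ρ x))) → U (λ x → Sat M φ (at ρ x) → Sat M ψ (at ρ x))
        to h with U-dichotomy _ (at-def φ ρ)
        ... | inj₁ p = U-mono (λ _ q _ → q) (h p)
        ... | inj₂ p = U-mono (λ _ n q → ⊥-elim (n q)) p
    los (∀f φ) ρ = (λ h → to λ a → proj₁ (los φ (a ∷ₑ ρ)) (h a)) , λ p a → proj₂ (los φ (a ∷ₑ ρ)) (U-mono (λ x q → proj₂ (at-∷ φ a ρ x) (q (val a x))) p)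
      where
        to : (∀ a → U (λ x → Sat M φ (at (a ∷ₑ ρ) x))) → U (λ x → ∀ a → Sat M φ (a ∷ₑ at ρ x))
        to h with U-dichotomy _ (at-def (∀f φ) ρ)
        ... | inj₁ p = p
        ... | inj₂ p = ⊥-elim (U-⊥ (U-zip (λ x n q → proj₁ (at-∷ (¬f φ) _ ρ x) n (proj₁ (at-∷ φ _ ρ x) q))
              (U-skolem (¬f φ) ρ (U-mono (λ _ → counterexample dec) p)) (h [ skolem-def (¬f φ) ρ ])))
    los (∃f φ) ρ = (λ (a , p) → U-mono (λ x q → val a x , proj₁ (at-∷ φ a ρ x) q) (proj₁ (los φ (a ∷ₑ ρ)) p)) ,
      λ p → [ skolem-def φ ρ ] , proj₂ (los φ ([ skolem-def φ ρ ] ∷ₑ ρ)) (U-skolem φ ρ p)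

    h : C → Nᶜ
    h a = [ const-def a ]

    h-val : ∀ a → U (λ x → val (h a) x ≡ a)
    h-val a = proj₂ (class (const-def a))

    -- Each equality holds only on its own set of the ultrafilter, but `φ` has finitely many
    -- variables and finitely many such sets can be intersected.
    los-approx : ∀ φ (ρ : Env Nᶜ) (f : C → Env C) → (∀ i → U (λ x → val (ρ i) x ≡ f x i)) → Sat N φ ρ ⟷ U (λ x → Sat M φ (f x))
    los-approx φ ρ f p = ⟷-trans (los φ ρ) (U-iff (U-finite p (bound φ)) λ x q → Sat-local M φ (at ρ x) (f x) q)

    h-elementary : ElemEmb M N h
    h-elementary φ ρ = (λ p → proj₂ approx (0 , λ _ → p)) , λ p → let s , q = proj₁ approx p in q (proj₂ (generic-nonempty s))
      where
        approx = los-approx φ (h ∘ ρ) (λ _ → ρ) (λ i → h-val (ρ i))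

    module _ (K : Pred N) (K-prop : ∀ {a} (p q : K a) → p ≡ q) (K-closed : Closed N K)
      (K-witness : ∀ φ (ρ : Env (Σ Nᶜ K)) → Sat N (∃f φ) (proj₁ ∘ ρ) → Σ Nᶜ λ a → K a × Sat N φ (a ∷ₑ (proj₁ ∘ ρ))) where

      private
        S = Sub N K K-closed

        eval-S : ∀ t (ρ : Env (Σ Nᶜ K)) → proj₁ (eval S t ρ) ≡ eval N t (proj₁ ∘ ρ)
        eval-S (var i) ρ = refl
        eval-S t0 ρ = refl
        eval-S t1 ρ = refl
        eval-S (t ⊕ s) ρ = cong₂ (add N) (eval-S t ρ) (eval-S s ρ)
        eval-S (t ⊗ s) ρ = cong₂ (mul N) (eval-S t ρ) (eval-S s ρ)

        S-ext : ∀ {a b : Σ Nᶜ K} → proj₁ a ≡ proj₁ b → a ≡ b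
        S-ext {a , p} {_ , q} refl = cong (a ,_) (K-prop p q)

        S-∷ : ∀ φ a (ρ : Env (Σ Nᶜ K)) → Sat N φ (proj₁ ∘ (a ∷ₑ ρ)) ⟷ Sat N φ (proj₁ a ∷ₑ (proj₁ ∘ ρ))
        S-∷ φ a ρ = Sat-ext N φ λ { zero → refl ; (suc i) → refl }

      -- Elements of the substructure are pairs, so reflecting equality is the point where
      -- membership has to be proof-irrelevant.
      tarski-vaught : ElemEmb S N proj₁
      tarski-vaught (t ≐ s) ρ = ⟷-trans (cong proj₁ , S-ext) (≡-cong (eval-S t ρ) (eval-S s ρ))
      tarski-vaught (t ≺ s) ρ = subst₂ (lt N) (eval-S t ρ) (eval-S s ρ) , subst₂ (lt N) (sym (eval-S t ρ)) (sym (eval-S s ρ))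
      tarski-vaught ff ρ = ⟷-refl
      tarski-vaught (¬f φ) ρ = ¬-cong (tarski-vaught φ ρ)
      tarski-vaught (φ ∧f ψ) ρ = ×-cong (tarski-vaught φ ρ) (tarski-vaught ψ ρ)
      tarski-vaught (φ ∨f ψ) ρ = ⊎-cong (tarski-vaught φ ρ) (tarski-vaught ψ ρ)
      tarski-vaught (φ ⇒f ψ) ρ = →-cong (tarski-vaught φ ρ) (tarski-vaught ψ ρ)
      tarski-vaught (∃f φ) ρ = (λ (a , p) → proj₁ a , proj₁ (S-∷ φ a ρ) (proj₁ (tarski-vaught φ (a ∷ₑ ρ)) p)) , from
        where
          from : Sat N (∃f φ) (proj₁ ∘ ρ) → Sat S (∃f φ) ρ
          from p with K-witness φ ρ p
          ... | a , k , q = (a , k) , proj₂ (tarski-vaught φ ((a , k) ∷ₑ ρ)) (proj₂ (S-∷ φ (a , k) ρ) q)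
      tarski-vaught (∀f φ) ρ = to , λ p a → proj₂ (tarski-vaught φ (a ∷ₑ ρ)) (proj₂ (S-∷ φ a ρ) (p (proj₁ a)))
        where
          to : Sat S (∀f φ) ρ → Sat N (∀f φ) (proj₁ ∘ ρ)
          to p a with dec (Sat N φ (a ∷ₑ (proj₁ ∘ ρ)))
          ... | yes q = q
          ... | no q with K-witness (¬f φ) ρ (a , q)
          ...   | b , k , r = ⊥-elim (r (proj₁ (S-∷ φ (b , k) ρ) (proj₁ (tarski-vaught φ ((b , k) ∷ₑ ρ)) (p (b , k)))))

    -- Intermediate models

    μ-cong : ∀ {P Q : C → Set} → (∀ a → P a ⟷ Q a) → μ P ≡ μ Q
    μ-cong {P} {Q} i = by-cases
      where
        move : ∀ {P Q : C → Set} → (∀ a → P a ⟷ Q a) → ∀ {a} → Least P a → Least Q a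
        move i (p , q) = proj₁ (i _) p , λ z l r → q z l (proj₂ (i z) r)
        by-cases : μ P ≡ μ Q
        by-cases with dec (Σ C (Least P))
        ... | yes (a , l) = trans (μ-least l) (sym (μ-least (move i l)))
        ... | no n = trans (μ-default n) (sym (μ-default λ (a , l) → n (a , move (λ a → ⟷-sym (i a)) l)))

    -- K F consists of the elements of N that are functions of F(c): the elementary extension of M generated by F(c).
    record _Below_ (a : Nᶜ) (F : C → C) : Set where
      constructor _,_
      field
        depth : ℕ
        factors : ∀ {x y} → Xₛ depth x → Xₛ depth y → F (num x) ≡ F (num y) → val a (num x) ≡ val a (num y)

    -- Going through the decision makes membership proof-irrelevant, as `tarski-vaught` demands.
    K : (C → C) → Pred N
    K F a = True (dec (a Below F))

    below-class : ∀ {F W} (d : Definable₁ W) s → (∀ {x y} → Xₛ s x → Xₛ s y → F (num x) ≡ F (num y) → W (num x) ≡ W (num y)) → [ d ] Below F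
    below-class d s p with proj₂ (class d)
    ... | t , q = s ⊔ t , λ x y r → trans (q (shrink (m≤n⊔m s t) x)) (trans (p (shrink (m≤m⊔n s t) x) (shrink (m≤m⊔n s t) y) r) (sym (q (shrink (m≤n⊔m s t) y))))

    class-below : ∀ {F W} (d : Definable₁ W) → [ d ] Below F →
      Σ ℕ λ s → ∀ {x y} → Xₛ s x → Xₛ s y → F (num x) ≡ F (num y) → W (num x) ≡ W (num y)
    class-below d (s , p) with proj₂ (class d)
    ... | t , q = s ⊔ t , λ x y r → trans (sym (q (shrink (m≤n⊔m s t) x))) (trans (p (shrink (m≤m⊔n s t) x) (shrink (m≤m⊔n s t) y) r) (q (shrink (m≤n⊔m s t) y)))

    below-trans : ∀ {a F G} (d : Definable₁ F) → a Below F → [ d ] Below G → a Below G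
    below-trans d (s , p) q with class-below d q
    ... | t , r = s ⊔ t , λ x y u → p (shrink (m≤m⊔n s t) x) (shrink (m≤m⊔n s t) y) (r (shrink (m≤n⊔m s t) x) (shrink (m≤n⊔m s t) y) u)

    below-finite : ∀ {F} (ρ : Env Nᶜ) → (∀ i → ρ i Below F) → ∀ n →
      Σ ℕ λ s → ∀ {x y} → Xₛ s x → Xₛ s y → F (num x) ≡ F (num y) → ∀ i → i < n → val (ρ i) (num x) ≡ val (ρ i) (num y)
    below-finite ρ h zero = 0 , λ _ _ _ i ()
    below-finite ρ h (suc n) with h 0 | below-finite (tl ρ) (λ i → h (suc i)) n
    ... | s , p | t , q = s ⊔ t , λ x y r → λ where
      zero _ → p (shrink (m≤m⊔n s t) x) (shrink (m≤m⊔n s t) y) r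
      (suc i) (s≤s l) → q (shrink (m≤n⊔m s t) x) (shrink (m≤n⊔m s t) y) r i l

    -- The least witness depends only on the finitely many parameters that occur in `φ`, and on a
    -- common condition these are all functions of `F`.
    skolem-below : ∀ {F} φ (ρ : Env Nᶜ) → (∀ i → ρ i Below F) → [ skolem-def φ ρ ] Below F
    skolem-below φ ρ p with below-finite ρ p (bound φ)
    ... | s , q = below-class (skolem-def φ ρ) s λ {x} {y} u v r → μ-cong λ a →
      Sat-local M φ (a ∷ₑ at ρ (num x)) (a ∷ₑ at ρ (num y)) λ where
        zero _ → refl
        (suc i) l → q u v r i (≤-trans (n≤1+n _) l)

    K-closed : ∀ F → Closed N (K F)
    K-closed F = record
      { cl-zer = fromWitness (below-class (const-def (zer M)) 0 λ _ _ _ → refl)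
      ; cl-one = fromWitness (below-class (const-def (one M)) 0 λ _ _ _ → refl)
      ; cl-add = λ a b p q → fromWitness (binary (add M) (add-def a b) (toWitness p) (toWitness q))
      ; cl-mul = λ a b p q → fromWitness (binary (mul M) (mul-def a b) (toWitness p) (toWitness q)) }
      where
        binary : ∀ (_∙_ : C → C → C) {a b} (d : Definable₁ (λ x → val a x ∙ val b x)) → a Below F → b Below F → [ d ] Below F
        binary _∙_ d (s , p) (t , q) = below-class d (s ⊔ t) λ x y r →
          cong₂ _∙_ (p (shrink (m≤m⊔n s t) x) (shrink (m≤m⊔n s t) y) r) (q (shrink (m≤n⊔m s t) x) (shrink (m≤n⊔m s t) y) r)

    K-elementary : ∀ F → IsElemSub N (K F)
    K-elementary F = K-closed F , tarski-vaught (K F) (λ {a} → True-irrelevant (dec (a Below F))) (K-closed F)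
      λ φ ρ p → [ skolem-def φ (proj₁ ∘ ρ) ] , fromWitness (skolem-below φ (proj₁ ∘ ρ) (λ i → toWitness (proj₂ (ρ i)))) ,
        proj₂ (los φ ([ skolem-def φ (proj₁ ∘ ρ) ] ∷ₑ (proj₁ ∘ ρ))) (U-skolem φ (proj₁ ∘ ρ) (proj₁ (los (∃f φ) (proj₁ ∘ ρ)) p))

    h-below : ∀ a F → h a Below F
    h-below a F = below-class (const-def a) 0 λ _ _ _ → refl

    -- If a is a function of b on a set X of the ultrafilter, a = t(b) for the definable t that sends v to the value of a
    -- at the least x in X with b(x) = v.
    module _ (a b : Nᶜ) (s : ℕ) (below : ∀ {x y} → Xₛ s x → Xₛ s y → val b (num x) ≡ val b (num y) → val a (num x) ≡ val a (num y)) where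

      private
        P : Env C → Set
        P ρ = hat (X-I (cond s)) (λ _ → ρ 0) × val b (ρ 0) ≡ ρ 1

        P-def : Dfn P
        P-def = def-ren (λ _ → 0) (hat-def (X-I (cond s))) ∧ᵈ M.fun₁ (val b) (fun-def (val-def b)) (var-M 0) ≡ᵈ var-M 1

        t : C → C
        t v = val a (μ₁ P-def v)

        t-def : DFun (λ ρ → t (ρ 0))
        t-def = M.fun₁ (val a) (fun-def (val-def a)) (fun-def (μ₁-def P-def))

        hat-X : ∀ n → Xₛ s n ⟷ hat (X-I (cond s)) (λ _ → num n)
        hat-X n = ⟷-trans (Def.defines (X-I (cond s)) (λ _ → n)) (Sat-mix (Def.defining (X-I (cond s))) λ _ → refl)

        t-value : ∀ {n} → Xₛ s n → t (val b (num n)) ≡ val a (num n)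
        t-value {n} p with least-nat (λ m → Xₛ s m × val b (num m) ≡ val b (num n)) (n , p , refl)
        ... | m , (q , r) , least = trans (cong (val a) (μ-least ((proj₁ (hat-X m) q , r) , smaller))) (below q p r)
          where
            smaller : ∀ z → lt M z (num m) → ¬ P (z ∷ₑ λ _ → val b (num n))
            smaller z l (u , v) with below-num m l
            ... | k , k<m , refl = least k k<m (proj₂ (hat-X k) u , v)

        ψ : Formula
        ψ = Def.defining (graph t-def)

        graph-N : ∀ d → Sat N (up ψ) (d ∷ₑ mix (λ _ → b) (h ∘ e)) ⟷ U (λ x → val d x ≡ t (val b x))
        graph-N d = ⟷-trans (los-approx (up ψ) (d ∷ₑ mix (λ _ → b) (h ∘ e)) (λ x → val d x ∷ₑ mix (λ _ → val b x) e) approx)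
          (U-mono (λ x p → proj₂ (Def.defines (graph t-def) (val d x ∷ₑ λ _ → val b x)) (proj₁ (Sat-up ψ (val d x) (λ _ → val b x)) p)) ,
           U-mono (λ x p → proj₂ (Sat-up ψ (val d x) (λ _ → val b x)) (proj₁ (Def.defines (graph t-def) (val d x ∷ₑ λ _ → val b x)) p)))
          where
            mixed : ∀ (ρ π : Env Nᶜ) (f g : C → Env C) → (∀ i → U (λ x → val (ρ i) x ≡ f x i)) → (∀ i → U (λ x → val (π i) x ≡ g x i)) →
                    ∀ i → U (λ x → val (mix ρ π i) x ≡ mix (f x) (g x) i)
            mixed ρ π f g p q zero = p zero
            mixed ρ π f g p q (suc i) = mixed π (tl ρ) g (λ x → tl (f x)) q (λ j → p (suc j)) i
            approx : ∀ i → U (λ x → val ((d ∷ₑ mix (λ _ → b) (h ∘ e)) i) x ≡ (val d x ∷ₑ mix (λ _ → val b x) e) i)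
            approx zero = 0 , λ _ → refl
            approx (suc i) = mixed (λ _ → b) (h ∘ e) (λ x _ → val b x) (λ _ → e) (λ _ → 0 , λ _ → refl) (λ j → h-val (e j)) i

      -- In `N` the formula for the graph of `t` at `b` is solved by `a`, so by elementarity it has
      -- a solution in `K′`. Any two solutions agree modulo U, so this one is `a`.
      generated : ∀ (K′ : Pred N) → IsElemSub N K′ → _⊆_ {N} (Img {M} {N} h) K′ → K′ b → K′ a
      generated K′ (cl , elem) img kb = found (proj₂ (elem (∃f up ψ) ρ) (a , proj₂ (Sat-ext N (up ψ) (env a)) (proj₂ (graph-N a) (s , λ p → sym (t-value p)))))
        where
          ρ : Env (Σ Nᶜ K′)
          ρ = mix (λ _ → b , kb) (λ i → h (e i) , img _ (e i , refl))
          tail : ∀ i → proj₁ (ρ i) ≡ mix (λ _ → b) (h ∘ e) i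
          tail = mix-map proj₁ (λ _ → b , kb) (λ i → h (e i) , img _ (e i , refl)) (λ _ → b) (h ∘ e) (λ _ → refl) (λ _ → refl)
          env : ∀ d i → (d ∷ₑ (proj₁ ∘ ρ)) i ≡ (d ∷ₑ mix (λ _ → b) (h ∘ e)) i
          env d = ∷ₑ-cong refl tail
          found : Sat (Sub N K′ cl) (∃f up ψ) ρ → K′ a
          found ((d , kd) , p) = subst K′ (N-ext d a (U-zip (λ x q r → trans q (sym r)) (proj₁ (graph-N d)
              (proj₁ (Sat-ext N (up ψ) {proj₁ ∘ ((d , kd) ∷ₑ ρ)} λ { zero → refl ; (suc i) → tail i }) (proj₁ (elem (up ψ) ((d , kd) ∷ₑ ρ)) p)))
              (s , λ p → sym (t-value p)))) kd

    K-generated : ∀ {F} (d : Definable₁ F) → GeneratedBy N (_∪L_ {N} (Img {M} {N} h) ([ d ] ∷ [])) (K F)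
    K-generated {F} d = K-elementary F , (λ { _ (inj₁ (a , refl)) → fromWitness (h-below a F) ; _ (inj₂ (here refl)) → fromWitness (below-class d 0 λ _ _ p → p) }) ,
      λ K′ elem sub a p → let s , q = below-val (toWitness p) in generated a [ d ] s q K′ elem (λ x i → sub x (inj₁ i)) (sub _ (inj₂ (here refl)))
      where
        below-val : ∀ {a} → a Below F → a Below val [ d ]
        below-val p = below-trans d p (0 , λ _ _ q → q)

    -- Labels and the order of the intermediate models

    sorted-unique : ∀ {es} → Sorted es → ∀ {a b} → a ∈ es → b ∈ es → proj₁ a ≡ proj₁ b → a ≡ b
    sorted-unique (p ∷ s) (here refl) (here refl) q = refl
    sorted-unique (p ∷ s) (here refl) (there r) q = ⊥-elim (<₃-irrefl (subst (_<₃ _) q (lookupAll p r)))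
    sorted-unique (p ∷ s) (there r) (here refl) q = ⊥-elim (<₃-irrefl (subst (_ <₃_) q (lookupAll p r)))
    sorted-unique (p ∷ s) (there r) (there t) q = sorted-unique s r t q

    sorted-before : ∀ {es} → Sorted es → ∀ {a b} → a ∈ es → b ∈ es → proj₁ a <₃ proj₁ b →
      Σ (List Entry) λ As → Σ (List Entry) λ Bs → es ≡ As ++ a ∷ Bs × b ∈ Bs
    sorted-before (p ∷ s) (here refl) (here refl) l = ⊥-elim (<₃-irrefl l)
    sorted-before (p ∷ s) (here refl) (there r) l = [] , _ , refl , r
    sorted-before (p ∷ s) (there r) (here refl) l = ⊥-elim (<₃-irrefl (<₃-trans l (lookupAll p r)))
    sorted-before (p ∷ s) (there r) (there t) l with sorted-before s r t l
    ... | As , Bs , refl , q = _ ∷ As , Bs , refl , q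

    chain-before : ∀ As {F Bs G x y} → ChainAt (As ++ F ∷ Bs) x y → G ∈ Bs → G x ≡ G y → F x ≡ F y
    chain-before [] (p ∷ _) G∈ = lookupAll p G∈
    chain-before (_ ∷ As) (_ ∷ c) = chain-before As c

    level-entry : ∀ l → Σ Entry λ a → a ∈ entries (cond (suc (code Λ l))) × proj₁ a ≡ mid l
    level-entry l = proj₂ (proj₂ (proj₂ (next (code Λ l) (cond (code Λ l))))) l refl

    generator : Label → Σ (C → C) Definable₁
    generator bot = (λ _ → zer M) , const-def (zer M)
    generator (mid l) = proj₂ (proj₁ (level-entry l))
    generator top = proj₂ top-entry

    fₗ : Label → C → C
    fₗ y = proj₁ (generator y)

    fₗ-def : ∀ y → Definable₁ (fₗ y)
    fₗ-def y = proj₂ (generator y)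

    generator-entry : ∀ y → y ≢ bot → Σ ℕ λ s → (y , generator y) ∈ entries (cond s)
    generator-entry bot n = ⊥-elim (n refl)
    generator-entry (mid l) _ with level-entry l
    ... | (.(mid l) , _) , a∈ , refl = suc (code Λ l) , a∈
    generator-entry top _ = 0 , here refl

    common-stage : ∀ {y z} → y ≢ bot → z ≢ bot → ∀ s →
      Σ ℕ λ t → s ≤ t × (y , generator y) ∈ entries (cond t) × (z , generator z) ∈ entries (cond t)
    common-stage {y} {z} p q s with generator-entry y p | generator-entry z q
    ... | m , a∈ | n , b∈ = s ⊔ (m ⊔ n) , m≤m⊔n s _ , keeps (cond-≥ (≤-trans (m≤m⊔n m n) (m≤n⊔m s _))) a∈ ,
          keeps (cond-≥ (≤-trans (m≤n⊔m m n) (m≤n⊔m s _))) b∈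

    -- The step that treats the index of `a` has decided its function. If it is constant, `a` comes
    -- from `M`; otherwise it shares its kernel with a level, so that each is a function of the
    -- other.
    label-type : ∀ a → Σ Label λ y → a Below fₗ y × [ fₗ-def y ] Below val a
    label-type a@(j , _) with proj₁ (proj₂ (proj₂ (next j (cond j))))
    ... | inj₁ can = bot , (suc j , λ p q _ → proj₂ (can p q) refl) , below-class (fₗ-def bot) 0 (λ _ _ _ → refl)
    ... | inj₂ ((y , FD) , b∈ , can) with no-bot (cond (suc j)) b∈
    ...   | y≢bot with common-stage y≢bot y≢bot (suc j)
    -- The entry used by the decision and the generator of its label may come from different stages.
    -- A later condition contains both, and no label occurs there twice.
    ...     | t , j<t , a∈ , _ with sorted-unique (sorted (cond t)) (keeps (cond-≥ j<t) b∈) a∈ refl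
    ...       | refl = y , (suc j , λ p q → proj₂ (can p q)) , below-class (fₗ-def y) (suc j) (λ p q → proj₁ (can p q))

    <₃⇒≢bot : ∀ {y z : Label} → y <₃ z → z ≢ bot
    <₃⇒≢bot bot<mid ()
    <₃⇒≢bot bot<top ()
    <₃⇒≢bot (mid<mid _) ()
    <₃⇒≢bot mid<top ()

    below-< : ∀ {y z} → y <₃ z → [ fₗ-def y ] Below fₗ z
    below-< {bot} l = below-class (fₗ-def bot) 0 λ _ _ _ → refl
    below-< {mid k} {z} l with common-stage {mid k} {z} (λ ()) (<₃⇒≢bot l) 0
    ... | t , _ , a∈ , b∈ with sorted-before (sorted (cond t)) a∈ b∈ l
    ...   | As , Bs , eq , b∈Bs = below-class (fₗ-def (mid k)) t λ {x} {y} p q → chain-before (levels As)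
              (subst (λ Fs → ChainAt Fs x y) (trans (cong levels eq) (map-++ level As _)) (chain (cond t) p q)) (∈-map⁺ level b∈Bs)

    -- Every condition contains a tree of arity two, hence two leaves that agree at the level of `y`
    -- and differ at that of `z`. For `bot` any two values of the level of `z` do.
    not-below-< : ∀ {y z} → y <₃ z → ¬ [ fₗ-def z ] Below fₗ y
    not-below-< {bot} {z} l p with class-below (fₗ-def z) p
    ... | s , q with common-stage {z} {z} (<₃⇒≢bot l) (<₃⇒≢bot l) s
    ...   | t , s≤t , z∈ , _ with ∈-map⁺ level z∈
    ...     | m with tree-separate (levels (entries (cond t))) [] m (large (cond t) 1)
    ...       | x , x∈ , _ with tree-separate (levels (entries (cond t))) (fₗ z (num x) ∷ []) m (large (cond t) 2)
    ...         | y , y∈ , n = n (here (q (shrink s≤t y∈) (shrink s≤t x∈) refl))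
    not-below-< {mid k} {z} l p with class-below (fₗ-def z) p
    ... | s , q with common-stage {mid k} {z} (λ ()) (<₃⇒≢bot l) s
    ...   | t , s≤t , a∈ , b∈ with sorted-before (sorted (cond t)) a∈ b∈ l
    ...     | As , Bs , eq , b∈Bs with tree-strict (levels As) (∈-map⁺ level b∈Bs)
                  (subst (λ Fs → Tree Fs 2 (Xₛ t)) (trans (cong levels eq) (map-++ level As _)) (large (cond t) 2))
    ...       | x , y , x∈ , y∈ , r , n = n (q (shrink s≤t x∈) (shrink s≤t y∈) r)

    below-self : ∀ y → [ fₗ-def y ] Below fₗ y
    below-self y = below-class (fₗ-def y) 0 λ _ _ p → p

    below⇒≤ : ∀ {y z} → [ fₗ-def y ] Below fₗ z → y ≤₃ z
    below⇒≤ {y} {z} p with <₃-cmp y z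
    ... | inj₁ l = inj₁ l
    ... | inj₂ (inj₁ q) = inj₂ q
    ... | inj₂ (inj₂ l) = ⊥-elim (not-below-< l p)

    ≤⇒below : ∀ {y z} → y ≤₃ z → [ fₗ-def y ] Below fₗ z
    ≤⇒below (inj₁ l) = below-< l
    ≤⇒below {y} (inj₂ refl) = below-self y

    ≤₃-antisym : {y z : Label} → y ≤₃ z → z ≤₃ y → y ≡ z
    ≤₃-antisym (inj₂ p) _ = p
    ≤₃-antisym (inj₁ _) (inj₂ p) = sym p
    ≤₃-antisym (inj₁ p) (inj₁ q) = ⊥-elim (<₃-irrefl (<₃-trans p q))

    max₃ : Label → Label → Label
    max₃ y z with <₃-cmp y z
    ... | inj₁ _ = z
    ... | inj₂ _ = y

    max₃-upper : ∀ y z → y ≤₃ max₃ y z × z ≤₃ max₃ y z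
    max₃-upper y z with <₃-cmp y z
    ... | inj₁ l = inj₁ l , inj₂ refl
    ... | inj₂ (inj₁ p) = inj₂ refl , inj₂ (sym p)
    ... | inj₂ (inj₂ l) = inj₂ refl , inj₁ l

    max₃-either : ∀ y z → max₃ y z ≡ y ⊎ max₃ y z ≡ z
    max₃-either y z with <₃-cmp y z
    ... | inj₁ _ = inj₂ refl
    ... | inj₂ _ = inj₁ refl

    type : Nᶜ → Label
    type a = proj₁ (label-type a)

    max-type : List Nᶜ → Label
    max-type [] = bot
    max-type (a ∷ as) = max₃ (type a) (max-type as)

    max-type-upper : ∀ as {a} → a ∈ as → a Below fₗ (max-type as)
    max-type-upper (a ∷ as) (here refl) = below-trans (fₗ-def (type a)) (proj₁ (proj₂ (label-type a))) (≤⇒below (proj₁ (max₃-upper (type a) (max-type as))))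
    max-type-upper (a ∷ as) (there p) = below-trans (fₗ-def (max-type as)) (max-type-upper as p) (≤⇒below (proj₂ (max₃-upper (type a) (max-type as))))

    max-type-attained : ∀ as → max-type as ≡ bot ⊎ Σ Nᶜ λ a → a ∈ as × max-type as ≡ type a
    max-type-attained [] = inj₁ refl
    max-type-attained (a ∷ as) with max₃-either (type a) (max-type as)
    ... | inj₁ p = inj₂ (a , here refl , p)
    ... | inj₂ p with max-type-attained as
    ...   | inj₁ q = inj₁ (trans p q)
    ...   | inj₂ (b , b∈ , q) = inj₂ (b , there b∈ , trans p q)

    label : Lt0 M N h → Label
    label (_ , as , _) = max-type as

    -- Labels are linearly ordered, so a generator with the largest label already generates
    -- everything that the list does. If this label is `bot`, the model is `M`, which contains the
    -- class of zero.
    label-⊆ : ∀ (k : Lt0 M N h) → _⊆_ {N} (proj₁ k) (K (fₗ (label k))) × _⊆_ {N} (K (fₗ (label k))) (proj₁ k)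
    label-⊆ (K′ , as , elem , sub , minimal) =
      minimal (K (fₗ m)) (K-elementary (fₗ m)) (λ { _ (inj₁ (a , refl)) → fromWitness (h-below a (fₗ m)) ; _ (inj₂ p) → fromWitness (max-type-upper as p) }) ,
      proj₂ (proj₂ (K-generated (fₗ-def m))) K′ elem λ { _ (inj₁ i) → sub _ (inj₁ i) ; _ (inj₂ (here refl)) → top-in (max-type-attained as) }
      where
        m = max-type as
        top-in : m ≡ bot ⊎ (Σ Nᶜ λ a → a ∈ as × m ≡ type a) → K′ [ fₗ-def m ]
        top-in (inj₁ p) = subst (λ y → K′ [ fₗ-def y ]) (sym p) (sub _ (inj₁ (zer M , refl)))
        top-in (inj₂ (a , a∈ , p)) = subst (λ y → K′ [ fₗ-def y ]) (sym p)
          (let s , q = proj₂ (proj₂ (label-type a)) in generated [ fₗ-def (type a) ] a s q K′ elem (λ x i → sub x (inj₁ i)) (sub a (inj₂ a∈)))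

    order-type : HasOrderType1λ1 M N h Λ
    order-type = label , (λ k₁ k₂ → to k₁ k₂ , from k₁ k₂) , surjective
      where
        to : ∀ k₁ k₂ → _⊆_ {N} (proj₁ k₁) (proj₁ k₂) → label k₁ ≤₃ label k₂
        to k₁ k₂ p = below⇒≤ (toWitness (proj₁ (label-⊆ k₂) _ (p _ (proj₂ (label-⊆ k₁) _ (fromWitness (below-self (label k₁)))))))
        from : ∀ k₁ k₂ → label k₁ ≤₃ label k₂ → _⊆_ {N} (proj₁ k₁) (proj₁ k₂)
        from k₁ k₂ l a p = proj₂ (label-⊆ k₂) a (fromWitness (below-trans (fₗ-def (label k₁)) (toWitness (proj₁ (label-⊆ k₁) a p)) (≤⇒below l)))
        surjective : ∀ y → Σ (Lt0 M N h) λ k → label k ≡ y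
        -- The label of `k` comes from the decision about the class of `fₗ y`, so it is compared
        -- with `y` only through inclusions in both directions.
        surjective y = k , ≤₃-antisym
            (below⇒≤ (toWitness (proj₂ (label-⊆ k) _ (fromWitness (below-self (label k))))))
            (below⇒≤ (toWitness (proj₁ (label-⊆ k) _ (fromWitness (below-self y)))))
          where
            k : Lt0 M N h
            k = K (fₗ y) , [ fₗ-def y ] ∷ [] , K-generated (fₗ-def y)

    -- The cut filled by the generator

    c : Nᶜ
    c = [ fₗ-def top ]

    c-val : U (λ x → val c x ≡ x)
    c-val = proj₂ (class (fₗ-def top))

    generic-unbounded : ∀ n s → Σ ℕ λ x → Xₛ s x × n < x
    generic-unbounded n s = tree-nonempty (levels (entries (cond s))) ≤-refl
      (avoid-≤ (levels (entries (cond s))) n (∈-map⁺ level (has-top (cond s))) (large (cond s) (suc n + 1)))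

    -- If `h a` lies below `c`, then `a` lies below the numeral of a point of some condition and is
    -- standard. Conversely conditions are unbounded, so U contains every final segment of ω. For
    -- the same reason the identity is constant on no condition and `c` is not in the image of `h`.
    humble : Humble M N h
    humble = h-elementary , proper , c , (whole , (λ _ _ → tt) , minimal) , λ a → to a , from a
      where
        proper : ¬ (∀ y → Img {M} {N} h y)
        proper img with img c
        ... | a , p with U-zip (λ _ q r → trans (sym q) r) (subst (λ b → U (λ x → val b x ≡ a)) p (h-val a)) c-val
        ...   | s , q with generic-nonempty s
        ...     | x , x∈ with generic-unbounded x s
        ...       | y , y∈ , l = <⇒≱ l (≤-reflexive (num-injective (trans (sym (q y∈)) (q x∈))))
        whole : IsElemSub N (λ _ → ⊤)
        whole = closed , tarski-vaught (λ _ → ⊤) (λ _ _ → refl) closed λ φ ρ (a , p) → a , tt , p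
          where
            closed : Closed N (λ _ → ⊤)
            closed = record { cl-zer = tt ; cl-one = tt ; cl-add = λ _ _ _ _ → tt ; cl-mul = λ _ _ _ _ → tt }
        minimal : ∀ (K′ : Pred N) → IsElemSub N K′ → _⊆_ {N} (_∪L_ {N} (Img {M} {N} h) (c ∷ [])) K′ → _⊆_ {N} (λ _ → ⊤) K′
        minimal K′ elem sub a _ = proj₂ (proj₂ (K-generated (fₗ-def top))) K′ elem sub a (fromWitness (0 , λ _ _ → cong (val a)))
        to : ∀ a → lt N (h a) c → Σ ℕ λ n → a ≡ numeral M n
        to a p with U-zip (λ x (q , r) l → subst₂ (lt M) q r l) (U-∩ (h-val a) c-val) p
        ... | s , q with generic-nonempty s
        ...   | x , x∈ with below-num x (q x∈)
        ...     | n , _ , r = n , r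
        from : ∀ a → (Σ ℕ λ n → a ≡ numeral M n) → lt N (h a) c
        from a (n , refl) with U-dichotomy (lt M (num n)) (const-M (num n) <ᵈ var-M 0)
        ... | inj₁ p = U-zip (λ x (q , r) l → subst₂ (lt M) (sym q) (sym r) l) (U-∩ (h-val (num n)) c-val) p
        ... | inj₂ (s , p) with generic-unbounded n s
        ...   | x , x∈ , l = ⊥-elim (p x∈ (num-< l))

decide-small : ExcludedMiddle (lsuc 0ℓ) → (P : Set) → Dec P
decide-small em P with em {Lift (lsuc 0ℓ) P}
... | yes (lift p) = yes p
... | no n = no (λ p → n (lift p))

theorem2p13 : ExcludedMiddle (lsuc 0ℓ)
    → (M : Structure) → IsPA M → Countable M → Nonstandard M
    → (Λ : CountableLinOrder)
    → Σ Structure λ N → Σ (Carrier M → Carrier N) λ h →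
    Humble M N h × HasOrderType1λ1 M N h Λ
theorem2p13 em M pa (e , e-surjective) _ Λ = N , h , humble , order-type
  where
    open Construction (decide-small em) M pa e e-surjective
    open Generic Λ
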